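{- Let $m,d\ge 0$ be integers and let $S_{m,d}(\mathcal{CH})$ be a sparse paving matroid of rank $d$ on $[m+d]$ with set of circuit-hyperplanes $\mathcal{CH}$. For every integer $i\ge 0$, the coefficient of $t^i$ in the Kazhdan--Lusztig polynomial of $S_{m,d}(\mathcal{CH})$ is at most the coefficient of $t^i$ in the Kazhdan--Lusztig polynomial of the uniform matroid $U_{m,d}$ of rank $d$ on $[m+d]$; that is, $c^i_{m,d}(\mathcal{CH})\le c^i_{m,d}(\emptyset)$.
   Context: $[n]=\{1,\dots,n\}$ and $\binom{[n]}{d}$ is the set of $d$-element subsets of $[n]$. Sparse paving matroids: a matroid $M$ of rank $d$ on the ground set $[m+d]$ with set of bases $\mathcal B\subseteq\binom{[m+d]}{d}$ is sparse paving if, with $\mathcal{CH}:=\binom{[m+d]}{d}\setminus\mathcal B$, any two distinct $C,C'\in\mathcal{CH}$ satisfy $|C\triangle C'|\ge 4$; then $\mathcal{CH}$ is exactly the set of circuit-hyperplanes of $M$. This matroid is denoted $S_{m,d}(\mathcal{CH})$; $S_{m,d}(\emptyset)=U_{m,d}$ is the uniform matroid of rank $d$ on $m+d$ elements. $c^i_{m,d}(\mathcal{CH})$ denotes the coefficient of $t^i$ in $P_{S_{m,d}(\mathcal{CH})}(t)$. Kazhdan--Lusztig polynomials: for a matroid $M$ with rank function $\operatorname{rk}$ and lattice of flats $L(M)$ with minimum $\hat 0$, the characteristic polynomial is $\chi_M(t)=\sum_{F\in L(M)}\mu_{L(M)}(\hat 0,F)\,t^{\operatorname{rk}M-\operatorname{rk}F}$,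 $\mu$ being the Möbius function. For a flat $F$, the localization $M^F$ is the matroid on $F$ whose independent sets are the subsets of $F$ independent in $M$; the contraction $M_F$ is the matroid on the complement of $F$ whose independent sets are the subsets whose union with a basis of $F$ is independent in $M$. The Kazhdan--Lusztig polynomials $P_M(t)\in\mathbb Z[t]$ are the unique family (known to exist, by Elias--Proudfoot--Wakefield) such that: (1) if $\operatorname{rk}M=0$ then $P_M(t)=1$; (2) if $\operatorname{rk}M>0$ then $\deg P_M(t)<\frac12\operatorname{rk}M$; (3) $t^{\operatorname{rk}M}P_M(t^{ -1})=\sum_{F\text{ flat}}\chi_{M^F}(t)P_{M_F}(t)$. -}

module Defs where

open import Data.Bool.Base using (if_then_else_)
open import Data.Bool.Properties using () renaming (_≟_ to _≟ᵇ_)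
open import Data.Fin.Base using (Fin)
open import Data.Fin.Properties using (all?; any?)
open import Data.Fin.Subset
open import Data.Fin.Subset.Induction using (Acc; acc; ⊂-wellFounded; ⊃-wellFounded)
open import Data.Fin.Subset.Properties
open import Data.Integer.Base as ℤ using (ℤ; 0ℤ; 1ℤ)
open import Data.List.Base as List using (List; []; _∷_; _++_; filter; upTo)
open import Data.List.Extrema.Nat using (max)
open import Data.Nat.Base as ℕ using (ℕ; zero; suc; _+_; _*_; _∸_; _≤_; _<_; z≤n; s≤s)
import Data.Nat.Properties as ℕ
open import Data.Product.Base using (∃; _×_; _,_; proj₁; proj₂)
open import Data.Sum.Base using (inj₁; inj₂; [_,_]′)
open import Data.Vec.Base as Vec using (here; there)
open import Data.Vec.Properties using (≡-dec)
open import Function.Base using (_∘_)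
open import Relation.Binary.Definitions using (DecidableEquality)
open import Relation.Binary.PropositionalEquality
  using (_≡_; _≢_; refl; sym; cong; subst)
open import Relation.Nullary.Decidable
  using (Dec; does; yes; no; ¬?; map′; _×-dec_; _→-dec_)
open import Relation.Nullary.Negation using (¬_; contradiction)
open import Relation.Unary using (Decidable)

------------------------------------------------------------------------
-- Finite sets

private
  variable
    n : ℕ

infixl 6 _△_

_△_ : Subset n → Subset n → Subset n
p △ q = (p ─ q) ∪ (q ─ p)

_≟ˢ_ : DecidableEquality (Subset n)
_≟ˢ_ = ≡-dec _≟ᵇ_

-- Every subset of Fin n, each exactly once.

subsets : ∀ n → List (Subset n)
subsets zero    = Vec.[] ∷ []
subsets (suc n) = List.map (outside Vec.∷_) (subsets n)
               ++ List.map (inside Vec.∷_) (subsets n)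

∪-least : {p q r : Subset n} → p ⊆ r → q ⊆ r → p ∪ q ⊆ r
∪-least {p = p} {q} p⊆r q⊆r = [ p⊆r , q⊆r ]′ ∘ x∈p∪q⁻ p q

⊆∪ˡ : (p q : Subset n) → p ⊆ p ∪ q
⊆∪ˡ p q = p⊆p∪q q

⊆∪ʳ : (p q : Subset n) → q ⊆ p ∪ q
⊆∪ʳ p q = q⊆p∪q p q

⁅⁆⊆ : {x : Fin n} {p : Subset n} → x ∈ p → ⁅ x ⁆ ⊆ p
⁅⁆⊆ {x = x} {p} x∈p y∈ = subst (_∈ p) (sym (x∈⁅y⁆⇒x≡y x y∈)) x∈p

x∈p∪⁅x⁆ : (p : Subset n) (x : Fin n) → x ∈ p ∪ ⁅ x ⁆
x∈p∪⁅x⁆ p x = ⊆∪ʳ p ⁅ x ⁆ (x∈⁅x⁆ x)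

p⊂p∪⁅x⁆ : (p : Subset n) (x : Fin n) → x ∉ p → p ⊂ p ∪ ⁅ x ⁆
p⊂p∪⁅x⁆ p x x∉p = ⊆∪ˡ p ⁅ x ⁆ , x , x∈p∪⁅x⁆ p x , x∉p

∣p∪q∣≤∣p∣+∣q∣ : (p q : Subset n) → ∣ p ∪ q ∣ ≤ ∣ p ∣ + ∣ q ∣
∣p∪q∣≤∣p∣+∣q∣ Vec.[]              Vec.[]              = z≤n
∣p∪q∣≤∣p∣+∣q∣ (outside Vec.∷ p) (outside Vec.∷ q) = ∣p∪q∣≤∣p∣+∣q∣ p q
∣p∪q∣≤∣p∣+∣q∣ (outside Vec.∷ p) (inside  Vec.∷ q) =
  subst (suc ∣ p ∪ q ∣ ≤_) (sym (ℕ.+-suc ∣ p ∣ ∣ q ∣)) (s≤s (∣p∪q∣≤∣p∣+∣q∣ p q))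
∣p∪q∣≤∣p∣+∣q∣ (inside  Vec.∷ p) (outside Vec.∷ q) = s≤s (∣p∪q∣≤∣p∣+∣q∣ p q)
∣p∪q∣≤∣p∣+∣q∣ (inside  Vec.∷ p) (inside  Vec.∷ q) =
  s≤s (ℕ.≤-trans (∣p∪q∣≤∣p∣+∣q∣ p q) (ℕ.+-monoʳ-≤ ∣ p ∣ (ℕ.n≤1+n ∣ q ∣)))

disjoint⇒∣p∣+∣q∣≤∣p∪q∣ : (p q : Subset n) → (∀ {x} → x ∈ p → x ∉ q) →
                         ∣ p ∣ + ∣ q ∣ ≤ ∣ p ∪ q ∣
disjoint⇒∣p∣+∣q∣≤∣p∪q∣ Vec.[] Vec.[] _ = z≤n
disjoint⇒∣p∣+∣q∣≤∣p∪q∣ (outside Vec.∷ p) (outside Vec.∷ q) d =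
  disjoint⇒∣p∣+∣q∣≤∣p∪q∣ p q (λ x∈p x∈q → d (there x∈p) (there x∈q))
disjoint⇒∣p∣+∣q∣≤∣p∪q∣ (outside Vec.∷ p) (inside Vec.∷ q) d =
  subst (_≤ suc ∣ p ∪ q ∣) (sym (ℕ.+-suc ∣ p ∣ ∣ q ∣))
    (s≤s (disjoint⇒∣p∣+∣q∣≤∣p∪q∣ p q (λ x∈p x∈q → d (there x∈p) (there x∈q))))
disjoint⇒∣p∣+∣q∣≤∣p∪q∣ (inside Vec.∷ p) (outside Vec.∷ q) d =
  s≤s (disjoint⇒∣p∣+∣q∣≤∣p∪q∣ p q (λ x∈p x∈q → d (there x∈p) (there x∈q)))
disjoint⇒∣p∣+∣q∣≤∣p∪q∣ (inside Vec.∷ p) (inside Vec.∷ q) d =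
  contradiction here (d here)

∣p∣<∣q∣⇒∃x∈q─p : (p q : Subset n) → ∣ p ∣ < ∣ q ∣ → ∃ λ x → x ∈ q × x ∉ p
∣p∣<∣q∣⇒∃x∈q─p p q ∣p∣<∣q∣ with any? (λ x → (x ∈? q) ×-dec ¬? (x ∈? p))
... | yes found = found
... | no none   = contradiction (p⊆q⇒∣p∣≤∣q∣ q⊆p) (ℕ.<⇒≱ ∣p∣<∣q∣)
  where
  q⊆p : q ⊆ p
  q⊆p {x} x∈q with x ∈? p
  ... | yes x∈p = x∈p
  ... | no x∉p  = contradiction (x , x∈q , x∉p) none

------------------------------------------------------------------------
-- Matroids

-- The ground set is an arbitrary subset of Fin n, so that localizations and
-- contractions of a matroid live over the same n without relabelling.

record Matroid (n : ℕ) : Set₁ where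
  field
    ground  : Subset n
    Indep   : Subset n → Set
    indep?  : Decidable Indep
    support : ∀ {I} → Indep I → I ⊆ ground
    empty   : Indep ⊥
    down    : ∀ {I J} → I ⊆ J → Indep J → Indep I
    augment : ∀ {I J} → Indep I → Indep J → ∣ I ∣ < ∣ J ∣ →
              ∃ λ e → e ∈ J × e ∉ I × Indep (I ∪ ⁅ e ⁆)

open Matroid

module _ (M : Matroid n) where

  rk : Subset n → ℕ
  rk A = max 0 (List.map ∣_∣
    (filter (λ I → indep? M I ×-dec (I ⊆? A)) (subsets n)))

  rank : ℕ
  rank = rk (ground M)

  record IsBasisOf (A B : Subset n) : Set where
    field
      basis⊆  : B ⊆ A
      indep   : Indep M B
      maximal : ∀ I → Indep M I → B ⊆ I → I ⊆ A → I ⊆ B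

  IsBasis : Subset n → Set
  IsBasis = IsBasisOf (ground M)

  IsFlat : Subset n → Set
  IsFlat F = F ⊆ ground M
           × (∀ e → e ∈ ground M → e ∉ F → rk F < rk (F ∪ ⁅ e ⁆))

  isFlat? : Decidable IsFlat
  isFlat? F = (F ⊆? ground M) ×-dec all? λ e →
    (e ∈? ground M) →-dec (¬? (e ∈? F) →-dec (rk F ℕ.<? rk (F ∪ ⁅ e ⁆)))

  flats : List (Subset n)
  flats = filter isFlat? (subsets n)

  Stuck : Subset n → Subset n → Set
  Stuck A B = ∀ e → e ∈ A → e ∉ B → ¬ Indep M (B ∪ ⁅ e ⁆)

  stuck⇒basis : ∀ {A B} → B ⊆ A → Indep M B → Stuck A B → IsBasisOf A B
  stuck⇒basis {A} {B} B⊆A iB stuck = record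
    { basis⊆ = B⊆A ; indep = iB ; maximal = max′ }
    where
    max′ : ∀ I → Indep M I → B ⊆ I → I ⊆ A → I ⊆ B
    max′ I iI B⊆I I⊆A {x} x∈I with x ∈? B
    ... | yes x∈B = x∈B
    ... | no x∉B  = contradiction
      (down M (∪-least B⊆I (⁅⁆⊆ x∈I)) iI) (stuck x (I⊆A x∈I) x∉B)

  basis⇒stuck : ∀ {A B} → IsBasisOf A B → Stuck A B
  basis⇒stuck {A} {B} b e e∈A e∉B i = e∉B
    (maximal _ i (⊆∪ˡ B ⁅ e ⁆) (∪-least basis⊆ (⁅⁆⊆ e∈A)) (x∈p∪⁅x⁆ B e))
    where open IsBasisOf b

  basis-size : ∀ {A B C} → IsBasisOf A B → IsBasisOf A C → ∣ B ∣ ≤ ∣ C ∣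
  basis-size {A} {B} {C} b c = ℕ.≮⇒≥ λ ∣C∣<∣B∣ →
    let e , e∈B , e∉C , i = augment M (indep c) (indep b) ∣C∣<∣B∣
    in basis⇒stuck c e (basis⊆ b e∈B) e∉C i
    where open IsBasisOf

  extend : ∀ A B → B ⊆ A → Indep M B → Acc _⊃_ B → ∃ (IsBasisOf A)
  extend A B B⊆A iB (acc rs)
    with any? (λ e → (e ∈? A) ×-dec (¬? (e ∈? B) ×-dec indep? M (B ∪ ⁅ e ⁆)))
  ... | yes (e , e∈A , e∉B , i) =
    extend A (B ∪ ⁅ e ⁆) (∪-least B⊆A (⁅⁆⊆ e∈A)) i (rs (p⊂p∪⁅x⁆ B e e∉B))
  ... | no none =
    B , stuck⇒basis B⊆A iB (λ e e∈A e∉B i → none (e , e∈A , e∉B , i))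

  basis-exists : ∀ A → ∃ (IsBasisOf A)
  basis-exists A = extend A ⊥ (⊆-min A) (empty M) (⊃-wellFounded ⊥)

  isBasisOf? : ∀ A → Decidable (IsBasisOf A)
  isBasisOf? A B = map′ to from
    ((B ⊆? A) ×-dec (indep? M B ×-dec all? λ e →
      (e ∈? A) →-dec (¬? (e ∈? B) →-dec ¬? (indep? M (B ∪ ⁅ e ⁆)))))
    where
    to : B ⊆ A × Indep M B × Stuck A B → IsBasisOf A B
    to (B⊆A , iB , stuck) = stuck⇒basis B⊆A iB stuck

    from : IsBasisOf A B → B ⊆ A × Indep M B × Stuck A B
    from b = IsBasisOf.basis⊆ b , IsBasisOf.indep b , basis⇒stuck b

  localization : Subset n → Matroid n
  localization F = record
    { ground  = F
    ; Indep   = λ I → I ⊆ F × Indep M I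
    ; indep?  = λ I → (I ⊆? F) ×-dec indep? M I
    ; support = proj₁
    ; empty   = ⊆-min F , empty M
    ; down    = λ I⊆J (J⊆F , iJ) → (λ x∈I → J⊆F (I⊆J x∈I)) , down M I⊆J iJ
    ; augment = λ (I⊆F , iI) (J⊆F , iJ) lt →
        let e , e∈J , e∉I , i = augment M iI iJ lt
        in e , e∈J , e∉I , ∪-least I⊆F (⁅⁆⊆ (J⊆F e∈J)) , i
    }

  contraction : Subset n → Matroid n
  contraction F = record
    { ground  = ground M ─ F
    ; Indep   = Indep′
    ; indep?  = λ I → (I ⊆? (ground M ─ F)) ×-dec
                      anySubset? (λ B → isBasisOf? F B ×-dec indep? M (I ∪ B))
    ; support = proj₁
    ; empty   = ⊆-min (ground M ─ F) ,
                (let B , b = basis-exists F in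
                 B , b , down M (∪-least (⊆-min B) (λ x∈B → x∈B)) (indep b))
    ; down    = λ { {I} {J} I⊆J (J⊆ , B , b , i) →
                  (λ x∈I → J⊆ (I⊆J x∈I)) , B , b ,
                  down M (∪-least (⊆∪ˡ J B ∘ I⊆J) (⊆∪ʳ J B)) i }
    ; augment = augment′
    }
    where
    open IsBasisOf

    Indep′ : Subset n → Set
    Indep′ I = I ⊆ ground M ─ F × ∃ λ B → IsBasisOf F B × Indep M (I ∪ B)

    x∈p─q⇒x∉q : ∀ {k} {x : Fin k} (p q : Subset k) → x ∈ p ─ q → x ∉ q
    x∈p─q⇒x∉q (_ Vec.∷ p) (_ Vec.∷ q) (there x∈) (there x∈q) =
      x∈p─q⇒x∉q p q x∈ x∈q
    x∈p─q⇒x∉q (outside Vec.∷ p) (inside Vec.∷ q) () here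
    x∈p─q⇒x∉q (inside  Vec.∷ p) (inside Vec.∷ q) () here

    augment′ : ∀ {I J} → Indep′ I → Indep′ J → ∣ I ∣ < ∣ J ∣ →
               ∃ λ e → e ∈ J × e ∉ I × Indep′ (I ∪ ⁅ e ⁆)
    augment′ {I} {J} (I⊆ , B , b , i) (J⊆ , C , c , j) ∣I∣<∣J∣ =
      e , e∈J , e∉IB ∘ ⊆∪ˡ I B , ∪-least I⊆ (⁅⁆⊆ (J⊆ e∈J)) , B , b ,
      down M (∪-least (∪-least (⊆∪ˡ IB ⁅ e ⁆ ∘ ⊆∪ˡ I B) (⊆∪ʳ IB ⁅ e ⁆))
                      (⊆∪ˡ IB ⁅ e ⁆ ∘ ⊆∪ʳ I B)) k
      where
      IB = I ∪ B

      larger : ∣ I ∪ B ∣ < ∣ J ∪ C ∣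
      larger = ℕ.≤-trans (s≤s (∣p∪q∣≤∣p∣+∣q∣ I B))
        (ℕ.≤-trans (ℕ.+-mono-≤ ∣I∣<∣J∣ (basis-size b c))
          (disjoint⇒∣p∣+∣q∣≤∣p∪q∣ J C
            (λ x∈J x∈C → x∈p─q⇒x∉q (ground M) F (J⊆ x∈J) (basis⊆ c x∈C))))

      new = augment M i j larger
      e = proj₁ new
      e∉IB = proj₁ (proj₂ (proj₂ new))
      k = proj₂ (proj₂ (proj₂ new))

      e∈J : e ∈ J
      e∈J with x∈p∪q⁻ J C (proj₁ (proj₂ new))
      ... | inj₁ e∈J′ = e∈J′
      ... | inj₂ e∈C  = contradiction
        (down M (∪-least (⊆∪ˡ IB ⁅ e ⁆ ∘ ⊆∪ʳ I B) (⊆∪ʳ IB ⁅ e ⁆)) k)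
        (basis⇒stuck b e (basis⊆ c e∈C) (e∉IB ∘ ⊆∪ʳ I B))

-- U_{m,d}

uniform : ∀ m d → Matroid (m + d)
uniform m d = record
  { ground  = ⊤
  ; Indep   = λ I → ∣ I ∣ ≤ d
  ; indep?  = λ I → ∣ I ∣ ℕ.≤? d
  ; support = λ _ → ⊆-max _
  ; empty   = subst (_≤ d) (sym (∣⊥∣≡0 (m + d))) z≤n
  ; down    = λ I⊆J → ℕ.≤-trans (p⊆q⇒∣p∣≤∣q∣ I⊆J)
  ; augment = λ { {I} {J} _ ∣J∣≤d lt →
      let e , e∈J , e∉I = ∣p∣<∣q∣⇒∃x∈q─p I J lt
      in e , e∈J , e∉I , ℕ.≤-trans (size I e) (ℕ.≤-trans lt ∣J∣≤d) }
  }
  where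
  size : ∀ {k} (I : Subset k) e → ∣ I ∪ ⁅ e ⁆ ∣ ≤ suc ∣ I ∣
  size I e = subst (∣ I ∪ ⁅ e ⁆ ∣ ≤_)
    (subst (λ s → ∣ I ∣ + s ≡ suc ∣ I ∣) (sym (∣⁅x⁆∣≡1 e)) (ℕ.+-comm ∣ I ∣ 1))
    (∣p∪q∣≤∣p∣+∣q∣ I ⁅ e ⁆)

-- The family 𝒞ℋ of d-subsets of the ground set that are not bases.

𝒞ℋ : ∀ {m d} → Matroid (m + d) → Subset (m + d) → Set
𝒞ℋ {d = d} M C = ∣ C ∣ ≡ d × ¬ IsBasis M C

record IsSparsePaving (m d : ℕ) (M : Matroid (m + d)) : Set where
  field
    ground≡⊤  : ground M ≡ ⊤
    rank≡d    : rank M ≡ d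
    separated : ∀ C C′ → 𝒞ℋ {m} {d} M C → 𝒞ℋ {m} {d} M C′ → C ≢ C′ →
                4 ≤ ∣ C △ C′ ∣

------------------------------------------------------------------------
-- Integer polynomials

-- Coefficient lists, constant term first; trailing zeros are allowed, so
-- polynomials are compared by _≈_.

Poly : Set
Poly = List ℤ

coeff : Poly → ℕ → ℤ
coeff []      _       = 0ℤ
coeff (a ∷ p) zero    = a
coeff (a ∷ p) (suc i) = coeff p i

infix  4 _≈_
infixl 6 _⊕_
infixl 7 _⊛_

_≈_ : Poly → Poly → Set
p ≈ q = ∀ i → coeff p i ≡ coeff q i

_⊕_ : Poly → Poly → Poly
[]      ⊕ q       = q
(a ∷ p) ⊕ []      = a ∷ p
(a ∷ p) ⊕ (b ∷ q) = (a ℤ.+ b) ∷ (p ⊕ q)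

_⊛_ : Poly → Poly → Poly
[]      ⊛ q = []
(a ∷ p) ⊛ q = List.map (a ℤ.*_) q ⊕ (0ℤ ∷ (p ⊛ q))

∑ : ∀ {A : Set} → List A → (A → Poly) → Poly
∑ xs f = List.foldr (λ x p → f x ⊕ p) [] xs

monomial : ℤ → ℕ → Poly
monomial a k = List.replicate k 0ℤ ++ (a ∷ [])

-- t^r · p(t⁻¹), for p of degree at most r.

reciprocal : ℕ → Poly → Poly
reciprocal r p = List.map (λ j → coeff p (r ∸ j)) (upTo (suc r))

------------------------------------------------------------------------
-- Characteristic and Kazhdan–Lusztig polynomials

-- The Möbius function of the poset formed by the members of L under
-- inclusion: μ(x,x) = 1 and μ(x,y) = - ∑ μ(x,z) over x ⊆ z ⊂ y for x ≢ y
-- (the sum is empty, and the value 0, when x ⊈ y).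

module _ (L : List (Subset n)) (x : Subset n) where

  mutual

    möbius-acc : ∀ y → Acc _⊂_ y → ℤ
    möbius-acc y (acc rs) =
      if does (x ≟ˢ y) then 1ℤ
      else ℤ.- List.foldr (λ z s → möbius-term rs z (x ⊆? z) (z ⊂? y) ℤ.+ s) 0ℤ L

    möbius-term : ∀ {y} → (∀ {z} → z ⊂ y → Acc _⊂_ z) →
                  ∀ z → Dec (x ⊆ z) → Dec (z ⊂ y) → ℤ
    möbius-term rs z (yes _) (yes z⊂y) = möbius-acc z (rs z⊂y)
    möbius-term rs z (yes _) (no _)    = 0ℤ
    möbius-term rs z (no _)  _         = 0ℤ

  möbius : Subset n → ℤ
  möbius y = möbius-acc y (⊂-wellFounded y)

module _ (M : Matroid n) where

  -- Flats are closed under intersection, so this is the minimum of L(M).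

  0̂ : Subset n
  0̂ = ⋂ (flats M)

  χ : Poly
  χ = ∑ (flats M) λ F →
    monomial (möbius (flats M) 0̂ F) (rank M ∸ rk M F)

-- Such a family P exists and is unique up to _≈_ (Elias–Proudfoot–Wakefield).

record IsKazhdanLusztig (P : ∀ {n} → Matroid n → Poly) : Set₁ where
  field
    rank-zero : ∀ {n} (M : Matroid n) → rank M ≡ 0 → P M ≈ 1ℤ ∷ []
    degree    : ∀ {n} (M : Matroid n) → 0 < rank M →
                ∀ i → coeff (P M) i ≢ 0ℤ → 2 * i < rank M
    recursion : ∀ {n} (M : Matroid n) →
                reciprocal (rank M) (P M)
                  ≈ ∑ (flats M) λ F → χ (localization M F) ⊛ P (contraction M F)

{-# OPTIONS --safe #-}
module Submission where

-- Let M be a sparse paving matroid of rank d ≥ 2 and U the uniform matroid of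
-- the same rank on the same ground set.  The coefficients of P_U − P_M are
-- shown, by induction on d, to be |𝒞ℋ| times those of a polynomial p_d that
-- depends only on d.  For 2i < d, the coefficient of t^i in P_M is the one of
-- t^(d−i) in the sum over the non-empty flats F of χ_{M^F} P_{M_F}.  Comparing
-- this sum with the one for U flat by flat, the difference at F is the number
-- of circuit-hyperplanes containing F times a quantity depending on |F|: flats
-- of size at most d − 2 are common and their contractions are again sparse
-- paving, a (d−1)-set is a flat of M unless it lies in a (unique)
-- circuit-hyperplane, and a circuit-hyperplane is a flat of M only.  Since
-- d − i ≥ 2, the Möbius function is needed only where the lattice of flats is
-- Boolean.  This gives a recursion for p_d, solved by p_d = ∑ₙ C(d,n) ψₙ with
-- ψₙ = ∑_{2i<n} (−1)ⁿ (C(n,i−1) − C(n,i+1)) tⁱ, that is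
--   [tⁱ] p_d = C(d,i+1) C(d−i−2,i−1) − C(d,i−1) C(d−i,i+1) ≥ 0   (i ≥ 1).

open import Data.Bool.Base using (Bool; true; false; if_then_else_; _∧_)
import Data.Bool.Properties as Bool
open import Data.Fin.Base using (Fin)
open import Data.Fin.Subset
open import Data.Fin.Subset.Induction using (Acc; acc; ⊂-wellFounded)
open import Data.Fin.Subset.Properties
open import Data.Integer.Base as ℤ using (ℤ; 0ℤ; 1ℤ; _≤_) renaming (+_ to pos)
import Data.Integer.Properties as ℤ
import Data.Integer.Tactic.RingSolver as ℤ-Ring
open import Data.List.Base as List using (List; []; _∷_; _++_; filter; applyUpTo)
open import Data.List.Extrema.Nat using (max≤v⁺; xs≤max)
open import Data.List.Membership.Propositional using () renaming (_∈_ to _∈ᴸ_)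
open import Data.List.Membership.Propositional.Properties
  using (∈-map⁺; ∈-filter⁺; ∈-filter⁻; ∈-++⁺ˡ; ∈-++⁺ʳ)
open import Data.List.Relation.Unary.All as All using ()
open import Data.List.Relation.Unary.All.Properties using (all-filter; map⁺)
open import Data.List.Relation.Unary.Any using (here; there)
open import Data.Nat.Base as ℕ using (ℕ; zero; suc; _+_; _*_; _∸_; _!; z≤n; s≤s)
open import Data.Nat.Combinatorics
  using (nCk+nC[k+1]≡[n+1]C[k+1]; k>n⇒nCk≡0; nCk≡nC[n∸k]; nCn≡1; nCk≡n!/k![n-k]!; k![n∸k]!∣n!)
  renaming (_C_ to _choose_)
open import Data.Nat.DivMod using (m/n*n≡m)
open import Data.Nat.Induction using (<-rec)
import Data.Nat.Properties as ℕ
import Data.Nat.Tactic.RingSolver as ℕ-Ring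
open import Data.Product.Base using (∃; _×_; _,_; proj₁; proj₂)
open import Data.Sum.Base using (inj₁; inj₂)
import Data.Vec.Base as Vec
import Data.Vec.Properties as Vec
open import Function.Base using (_∘_; id)
open import Relation.Binary.Definitions using (Tri; tri<; tri≈; tri>)
open import Relation.Binary.PropositionalEquality
open import Relation.Nullary.Decidable
  using (Dec; does; yes; no; ¬?; _×-dec_; dec-true; dec-false)
open import Relation.Nullary.Negation using (¬_; contradiction)
open import Relation.Unary using (Decidable)
open import Defs

open ≡-Reasoning
open Matroid

-- The factor |𝒞ℋ| is a double count: summing over F with the number of circuit-hyperplanes above F
-- as weight is summing over pairs F ⊆ C, and every C has the same number of subsets of each size.
-- The empty flat, whose contraction still has rank d, drops out because d - i exceeds the degree
-- bound.
--
-- The ψₙ come from generating functions. If p has exponential generating function eˣ Ψ(t,x), then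
-- ∑ₖ C(d,k) (t-1)ᵏ p_(d-k) gives e^(tx) Ψ(t,x), and t^d p_d(1/t) gives e^(tx) Ψ(1/t,tx). So ψₙ and
-- its reversal tⁿ ψₙ(1/t) must agree up to terms that the binomial sum over n cancels, such as
-- (-1)ⁿ C(n,a) with a < d. The choice a = i - 1 is dictated by its value (-1)ⁿ at i = n + 1, just
-- outside the range of the reversal: this reproduces the contribution of the circuit-hyperplane
-- itself. Subtracting the term a = i + 1 makes the difference antisymmetric, as the difference of a
-- polynomial and its reversal must be, and keeping only 2i < n respects the degree bound.

private
  variable
    Index Index′ : Set
    n : ℕ

-- Binomial sums and coefficient sequences

-- ∑ₖ C(d,k) f(k,d∸k), in the form of Pascal's rule.

binomialSum : ℕ → (ℕ → ℕ → ℤ) → ℤ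
binomialSum zero    f = f 0 0
binomialSum (suc d) f =
  binomialSum d (λ k l → f k (suc l)) ℤ.+ binomialSum d (λ k l → f (suc k) l)

binomialSum-cong : ∀ d {f g : ℕ → ℕ → ℤ} → (∀ k l → k + l ≡ d → f k l ≡ g k l) →
                   binomialSum d f ≡ binomialSum d g
binomialSum-cong zero    f≡g = f≡g 0 0 refl
binomialSum-cong (suc d) f≡g = cong₂ ℤ._+_
  (binomialSum-cong d λ k l eq → f≡g k (suc l) (trans (ℕ.+-suc k l) (cong suc eq)))
  (binomialSum-cong d λ k l eq → f≡g (suc k) l (cong suc eq))

binomialSum-linear : ∀ d a b (f g : ℕ → ℕ → ℤ) →
  binomialSum d (λ k l → a ℤ.* f k l ℤ.+ b ℤ.* g k l) ≡
  a ℤ.* binomialSum d f ℤ.+ b ℤ.* binomialSum d g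
binomialSum-linear zero    a b f g = refl
binomialSum-linear (suc d) a b f g = begin
  _ ≡⟨ cong₂ ℤ._+_ (binomialSum-linear d a b _ _) (binomialSum-linear d a b _ _) ⟩
  _ ≡⟨ regroup a b (binomialSum d λ k l → f k (suc l)) (binomialSum d λ k l → f (suc k) l)
               (binomialSum d λ k l → g k (suc l)) (binomialSum d λ k l → g (suc k) l) ⟩
  _ ∎
  where
  regroup : ∀ a b x y z w → (a ℤ.* x ℤ.+ b ℤ.* z) ℤ.+ (a ℤ.* y ℤ.+ b ℤ.* w) ≡
            a ℤ.* (x ℤ.+ y) ℤ.+ b ℤ.* (z ℤ.+ w)
  regroup = ℤ-Ring.solve-∀

binomialSum-zero : ∀ d → binomialSum d (λ _ _ → 0ℤ) ≡ 0ℤ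
binomialSum-zero zero    = refl
binomialSum-zero (suc d) = cong₂ ℤ._+_ (binomialSum-zero d) (binomialSum-zero d)

binomialSum-+ : ∀ d (f g : ℕ → ℕ → ℤ) →
  binomialSum d (λ k l → f k l ℤ.+ g k l) ≡ binomialSum d f ℤ.+ binomialSum d g
binomialSum-+ d f g = begin
  _ ≡⟨ binomialSum-cong d (λ k l _ → expand (f k l) (g k l)) ⟩
  _ ≡⟨ binomialSum-linear d 1ℤ 1ℤ f g ⟩
  _ ≡⟨ sym (expand (binomialSum d f) (binomialSum d g)) ⟩
  _ ∎
  where
  expand : ∀ x y → x ℤ.+ y ≡ 1ℤ ℤ.* x ℤ.+ 1ℤ ℤ.* y
  expand = ℤ-Ring.solve-∀

binomialSum-− : ∀ d (f g : ℕ → ℕ → ℤ) →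
  binomialSum d (λ k l → f k l ℤ.- g k l) ≡ binomialSum d f ℤ.- binomialSum d g
binomialSum-− d f g = begin
  _ ≡⟨ binomialSum-cong d (λ k l _ → expand (f k l) (g k l)) ⟩
  _ ≡⟨ binomialSum-linear d 1ℤ (ℤ.- 1ℤ) f g ⟩
  _ ≡⟨ sym (expand (binomialSum d f) (binomialSum d g)) ⟩
  _ ∎
  where
  expand : ∀ x y → x ℤ.- y ≡ 1ℤ ℤ.* x ℤ.+ (ℤ.- 1ℤ) ℤ.* y
  expand = ℤ-Ring.solve-∀

binomialSum-neg : ∀ d (f : ℕ → ℕ → ℤ) →
  binomialSum d (λ k l → ℤ.- f k l) ≡ ℤ.- binomialSum d f
binomialSum-neg zero    f = refl
binomialSum-neg (suc d) f = trans
  (cong₂ ℤ._+_ (binomialSum-neg d _) (binomialSum-neg d _))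
  (sym (ℤ.neg-distrib-+ (binomialSum d λ k l → f k (suc l)) _))

binomialSum-swap : ∀ d (f : ℕ → ℕ → ℤ) → binomialSum d f ≡ binomialSum d (λ k l → f l k)
binomialSum-swap zero    f = refl
binomialSum-swap (suc d) f = trans
  (cong₂ ℤ._+_ (binomialSum-swap d _) (binomialSum-swap d _))
      (ℤ.+-comm (binomialSum d λ k l → f l (suc k)) _)

binomialSum-select : ∀ d a x →
  binomialSum d (λ _ n → if n ℕ.≡ᵇ a then x else 0ℤ) ≡ pos (d choose a) ℤ.* x
binomialSum-select zero    zero    x = sym (ℤ.*-identityˡ x)
binomialSum-select zero    (suc a) x = sym (ℤ.*-zeroˡ x)
binomialSum-select (suc d) zero    x = begin
  binomialSum d (λ _ _ → 0ℤ) ℤ.+ binomialSum d (λ _ n → if n ℕ.≡ᵇ 0 then x else 0ℤ)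
    ≡⟨ cong₂ ℤ._+_ (binomialSum-zero d) (binomialSum-select d 0 x) ⟩
  0ℤ ℤ.+ pos 1 ℤ.* x ≡⟨ ℤ.+-identityˡ _ ⟩
  pos 1 ℤ.* x ∎
binomialSum-select (suc d) (suc a) x = begin
  _ ≡⟨ cong₂ ℤ._+_ (binomialSum-select d a x) (binomialSum-select d (suc a) x) ⟩
  pos (d choose a) ℤ.* x ℤ.+ pos (d choose suc a) ℤ.* x
      ≡⟨ sym (ℤ.*-distribʳ-+ x (pos (d choose a)) (pos (d choose suc a))) ⟩
  pos (d choose a + d choose suc a) ℤ.* x ≡⟨ cong (λ c → pos c ℤ.* x)
      (nCk+nC[k+1]≡[n+1]C[k+1] d a) ⟩
  _ ∎

[-1]^ : ℕ → ℤ
[-1]^ zero    = 1ℤ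
[-1]^ (suc n) = ℤ.- [-1]^ n

-- Up to sign this is a `d`-th finite difference of C(n,a), a polynomial in n of degree `a` less
-- than `d`.
alternating-sum : ∀ {d a} → a ℕ.< d → binomialSum d (λ _ n → [-1]^ n ℤ.* pos (n choose a)) ≡ 0ℤ
alternating-sum {suc d} {zero} _ = begin
  _ ≡⟨ cong (ℤ._+ S) (trans
         (binomialSum-cong d λ _ n _ → sym (ℤ.neg-distribˡ-* ([-1]^ n) 1ℤ))
         (binomialSum-neg d λ _ n → [-1]^ n ℤ.* 1ℤ)) ⟩
  ℤ.- S ℤ.+ S ≡⟨ ℤ.+-inverseˡ S ⟩
  0ℤ ∎
  where
  S : ℤ
  S = binomialSum d (λ _ n → [-1]^ n ℤ.* 1ℤ)
alternating-sum {suc d} {suc a} (s≤s a<d) = begin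
  _ ≡⟨ cong (ℤ._+ S (suc a)) (trans
         (binomialSum-cong d λ _ n _ → trans
           (cong (λ c → ℤ.- [-1]^ n ℤ.* pos c) (sym (nCk+nC[k+1]≡[n+1]C[k+1] n a)))
           (split ([-1]^ n) (pos (n choose a)) (pos (n choose suc a))))
         (binomialSum-linear d (ℤ.- 1ℤ) (ℤ.- 1ℤ) _ _)) ⟩
  (ℤ.- 1ℤ ℤ.* S a ℤ.+ ℤ.- 1ℤ ℤ.* S (suc a)) ℤ.+ S (suc a)
    ≡⟨ cong (λ s → (ℤ.- 1ℤ ℤ.* s ℤ.+ ℤ.- 1ℤ ℤ.* S (suc a)) ℤ.+ S (suc a)) (alternating-sum a<d) ⟩
  (ℤ.- 1ℤ ℤ.* 0ℤ ℤ.+ ℤ.- 1ℤ ℤ.* S (suc a)) ℤ.+ S (suc a) ≡⟨ cancel (S (suc a)) ⟩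
  0ℤ ∎
  where
  S : ℕ → ℤ
  S b = binomialSum d (λ _ n → [-1]^ n ℤ.* pos (n choose b))
  split : ∀ s x y → ℤ.- s ℤ.* (x ℤ.+ y) ≡ ℤ.- 1ℤ ℤ.* (s ℤ.* x) ℤ.+ ℤ.- 1ℤ ℤ.* (s ℤ.* y)
  split = ℤ-Ring.solve-∀
  cancel : ∀ x → (ℤ.- 1ℤ ℤ.* 0ℤ ℤ.+ ℤ.- 1ℤ ℤ.* x) ℤ.+ x ≡ 0ℤ
  cancel = ℤ-Ring.solve-∀

-- Coefficient sequences are functions rather than members of `Poly`: multiplication by t is then a
-- shift, equality is pointwise, and trailing zeros do not arise.
t·_ : (ℕ → ℤ) → ℕ → ℤ
(t· f) zero    = 0ℤ
(t· f) (suc j) = f j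

t^_·_ : ℕ → (ℕ → ℤ) → ℕ → ℤ
t^ zero  · f = f
t^ suc k · f = t· (t^ k · f)

[t-1]^_·_ : ℕ → (ℕ → ℤ) → ℕ → ℤ
([t-1]^ zero  · f) j = f j
([t-1]^ suc k · f) j = (t· ([t-1]^ k · f)) j ℤ.- ([t-1]^ k · f) j

one : ℕ → ℤ
one = coeff (1ℤ ∷ [])

t·-cong : ∀ {f g : ℕ → ℤ} → (∀ j → f j ≡ g j) → ∀ j → (t· f) j ≡ (t· g) j
t·-cong f≡g zero    = refl
t·-cong f≡g (suc j) = f≡g j

t·-linear : ∀ a b (f g : ℕ → ℤ) j →
  (t· λ i → a ℤ.* f i ℤ.+ b ℤ.* g i) j ≡ a ℤ.* (t· f) j ℤ.+ b ℤ.* (t· g) j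
t·-linear a b f g zero    = sym (cong₂ ℤ._+_ (ℤ.*-zeroʳ a) (ℤ.*-zeroʳ b))
t·-linear a b f g (suc j) = refl

t^-cong : ∀ k {f g : ℕ → ℤ} → (∀ j → f j ≡ g j) → ∀ j → (t^ k · f) j ≡ (t^ k · g) j
t^-cong zero    f≡g = f≡g
t^-cong (suc k) f≡g = t·-cong (t^-cong k f≡g)

[t-1]^-cong : ∀ k {f g : ℕ → ℤ} → (∀ j → f j ≡ g j) → ∀ j →
              ([t-1]^ k · f) j ≡ ([t-1]^ k · g) j
[t-1]^-cong zero    f≡g j = f≡g j
[t-1]^-cong (suc k) f≡g j =
  cong₂ ℤ._-_ (t·-cong ([t-1]^-cong k f≡g) j) ([t-1]^-cong k f≡g j)

[t-1]^-linear : ∀ k a b (f g : ℕ → ℤ) j →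
  ([t-1]^ k · λ i → a ℤ.* f i ℤ.+ b ℤ.* g i) j ≡
  a ℤ.* ([t-1]^ k · f) j ℤ.+ b ℤ.* ([t-1]^ k · g) j
[t-1]^-linear zero    a b f g j = refl
[t-1]^-linear (suc k) a b f g j = begin
  _ ≡⟨ cong₂ ℤ._-_
         (trans (t·-cong ([t-1]^-linear k a b f g) j)
             (t·-linear a b ([t-1]^ k · f) ([t-1]^ k · g) j))
         ([t-1]^-linear k a b f g j) ⟩
  _ ≡⟨ regroup a b ((t· ([t-1]^ k · f)) j) (([t-1]^ k · f) j)
               ((t· ([t-1]^ k · g)) j) (([t-1]^ k · g) j) ⟩
  _ ∎
  where
  regroup : ∀ a b x y z w → (a ℤ.* x ℤ.+ b ℤ.* z) ℤ.- (a ℤ.* y ℤ.+ b ℤ.* w) ≡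
            a ℤ.* (x ℤ.- y) ℤ.+ b ℤ.* (z ℤ.- w)
  regroup = ℤ-Ring.solve-∀

[t-1]^-+ : ∀ k (f g : ℕ → ℤ) j →
  ([t-1]^ k · λ i → f i ℤ.+ g i) j ≡ ([t-1]^ k · f) j ℤ.+ ([t-1]^ k · g) j
[t-1]^-+ k f g j = begin
  _ ≡⟨ [t-1]^-cong k (λ i → expand (f i) (g i)) j ⟩
  _ ≡⟨ [t-1]^-linear k 1ℤ 1ℤ f g j ⟩
  _ ≡⟨ sym (expand (([t-1]^ k · f) j) (([t-1]^ k · g) j)) ⟩
  _ ∎
  where
  expand : ∀ x y → x ℤ.+ y ≡ 1ℤ ℤ.* x ℤ.+ 1ℤ ℤ.* y
  expand = ℤ-Ring.solve-∀

[t-1]^-zero : ∀ k {f : ℕ → ℤ} → (∀ j → f j ≡ 0ℤ) → ∀ j → ([t-1]^ k · f) j ≡ 0ℤ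
[t-1]^-zero k {f} f≡0 j = begin
  _ ≡⟨ [t-1]^-cong k (λ i → trans (f≡0 i) (sym (expand (f i) (f i)))) j ⟩
  _ ≡⟨ [t-1]^-linear k 0ℤ 0ℤ f f j ⟩
  _ ≡⟨ expand (([t-1]^ k · f) j) (([t-1]^ k · f) j) ⟩
  0ℤ ∎
  where
  expand : ∀ x y → 0ℤ ℤ.* x ℤ.+ 0ℤ ℤ.* y ≡ 0ℤ
  expand = ℤ-Ring.solve-∀

t·-binomialSum : ∀ d (F : ℕ → ℕ → ℕ → ℤ) j →
  binomialSum d (λ k l → (t· F k l) j) ≡ (t· λ i → binomialSum d (λ k l → F k l i)) j
t·-binomialSum d F zero    = binomialSum-zero d
t·-binomialSum d F (suc j) = refl

t^-coeff : ∀ k f i → (t^ k · f) (k + i) ≡ f i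
t^-coeff zero    f i = refl
t^-coeff (suc k) f i = t^-coeff k f i

t^-coeff-< : ∀ {k j} f → j ℕ.< k → (t^ k · f) j ≡ 0ℤ
t^-coeff-< {suc k} {zero}  f _         = refl
t^-coeff-< {suc k} {suc j} f (s≤s j<k) = t^-coeff-< {k} f j<k

[t-1]^-expand : ∀ k f j →
  ([t-1]^ k · f) j ≡ binomialSum k (λ a l → [-1]^ a ℤ.* (t^ l · f) j)
[t-1]^-expand zero    f j = sym (ℤ.*-identityˡ (f j))
[t-1]^-expand (suc k) f j = cong₂ ℤ._+_
  (begin
    _ ≡⟨ t·-cong ([t-1]^-expand k f) j ⟩
    _ ≡⟨ sym (t·-binomialSum k (λ a l i → [-1]^ a ℤ.* (t^ l · f) i) j) ⟩
    _ ≡⟨ binomialSum-cong k (λ a l _ → scale ([-1]^ a) (t^ l · f) j) ⟩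
    _ ∎)
  (begin
    _ ≡⟨ cong ℤ.-_ ([t-1]^-expand k f j) ⟩
    _ ≡⟨ sym (binomialSum-neg k _) ⟩
    _ ≡⟨ binomialSum-cong k (λ a l _ → ℤ.neg-distribˡ-* ([-1]^ a) ((t^ l · f) j)) ⟩
    _ ∎)
  where
  scale : ∀ c f j → (t· λ i → c ℤ.* f i) j ≡ c ℤ.* (t· f) j
  scale c f zero    = sym (ℤ.*-zeroʳ c)
  scale c f (suc j) = refl

-- With ψ and a = ∑ₙ C(·,n) ψₙ having exponential generating functions Ψ and
-- eˣ Ψ, this is e^((t−1)x) eˣ Ψ = e^(tx) Ψ.

binomial-transform : ∀ d (ψ : ℕ → ℕ → ℤ) j →
  binomialSum d (λ k l → ([t-1]^ k · λ i → binomialSum l (λ _ n → ψ n i)) j) ≡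
  binomialSum d (λ k l → (t^ k · ψ l) j)
binomial-transform zero    ψ j = refl
binomial-transform (suc d) ψ j = begin
  -- Raising `d` differentiates in x: the derivative of e^(tx) Ψ is e^(tx) Ψ′ + t e^(tx) Ψ, and Ψ′
  -- belongs to the sequence `ψ ∘ suc`.
  L (suc d) ψ j
    ≡⟨ cong₂ ℤ._+_
         (trans (binomialSum-cong d λ k l _ → [t-1]^-+ k (λ i → A l (ψ ∘ suc) i) (A l ψ) j)
                (binomialSum-+ d _ _))
         (trans (binomialSum-− d _ _)
                (cong (ℤ._- L d ψ j) (t·-binomialSum d (λ k l → [t-1]^ k · A l ψ) j))) ⟩
  (L d (ψ ∘ suc) j ℤ.+ L d ψ j) ℤ.+ ((t· L d ψ) j ℤ.- L d ψ j)
    ≡⟨ cancel (L d (ψ ∘ suc) j) (L d ψ j) ((t· L d ψ) j) ⟩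
  L d (ψ ∘ suc) j ℤ.+ (t· L d ψ) j
    ≡⟨ cong₂ ℤ._+_ (binomial-transform d (ψ ∘ suc) j) (t·-cong (binomial-transform d ψ) j) ⟩
  R d (ψ ∘ suc) j ℤ.+ (t· R d ψ) j
    ≡⟨ cong (λ s → R d (ψ ∘ suc) j ℤ.+ s) (sym (t·-binomialSum d (λ k l → t^ k · ψ l) j)) ⟩
  R (suc d) ψ j ∎
  where
  A : ℕ → (ℕ → ℕ → ℤ) → ℕ → ℤ
  A l ψ i = binomialSum l (λ _ n → ψ n i)
  L R : ℕ → (ℕ → ℕ → ℤ) → ℕ → ℤ
  L d ψ j = binomialSum d (λ k l → ([t-1]^ k · A l ψ) j)
  R d ψ j = binomialSum d (λ k l → (t^ k · ψ l) j)
  cancel : ∀ x y z → (x ℤ.+ y) ℤ.+ (z ℤ.- y) ≡ x ℤ.+ z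
  cancel = ℤ-Ring.solve-∀

-- The relaxation polynomial

-- C(n, i − 1), with C(n, −1) = 0.

_choose-pred_ : ℕ → ℕ → ℕ
n choose-pred zero  = 0
n choose-pred suc i = n choose i

-- The weight is antisymmetric under i ↦ n − i, so that the kernel, its
-- restriction to 2i < n, satisfies kernel n i − kernel n (n − i) = weight n i.

weight : ℕ → ℕ → ℤ
weight n i = [-1]^ n ℤ.* (pos (n choose-pred i) ℤ.- pos (n choose suc i))

kernel : ℕ → ℕ → ℤ
kernel n i = if does (2 * i ℕ.<? n) then weight n i else 0ℤ

-- The coefficient of t^i in the polynomial by which the Kazhdan–Lusztig
-- polynomial grows when a circuit-hyperplane of a rank d matroid is relaxed, for
-- d ≥ 2.  The value 1 at d = 1 accounts for the hyperplanes that are flats of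
-- the uniform matroid only.

relaxation : ℕ → ℕ → ℤ
relaxation d i = binomialSum d (λ _ n → kernel n i)

kernel-< : ∀ {n i} → 2 * i ℕ.< n → kernel n i ≡ weight n i
kernel-< {n} {i} 2i<n = cong (if_then weight n i else 0ℤ) (dec-true (2 * i ℕ.<? n) 2i<n)

kernel-≥ : ∀ {n i} → n ℕ.≤ 2 * i → kernel n i ≡ 0ℤ
kernel-≥ {n} {i} n≤2i =
  cong (if_then weight n i else 0ℤ) (dec-false (2 * i ℕ.<? n) (ℕ.≤⇒≯ n≤2i))

C-pred-sym : ∀ i r → (i + r) choose-pred r ≡ (i + r) choose suc i
C-pred-sym i zero    = sym (k>n⇒nCk≡0 (ℕ.≤-reflexive (cong suc (ℕ.+-identityʳ i))))
C-pred-sym i (suc r) = begin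
  (i + suc r) choose r                       ≡⟨ cong ((i + suc r) choose_) (sym (ℕ.m+n∸m≡n i r)) ⟩
  (i + suc r) choose (suc (i + r) ∸ suc i)   ≡⟨ cong (λ n → (i + suc r) choose (n ∸ suc i))
      (sym (ℕ.+-suc i r)) ⟩
  (i + suc r) choose ((i + suc r) ∸ suc i)
    ≡⟨ sym (nCk≡nC[n∸k] (ℕ.≤-trans (s≤s (ℕ.m≤m+n i r)) (ℕ.≤-reflexive (sym (ℕ.+-suc i r))))) ⟩
  (i + suc r) choose suc i                   ∎

weight-antisym : ∀ i r → weight (i + r) r ≡ ℤ.- weight (i + r) i
weight-antisym i r = begin
  [-1]^ N ℤ.* (pos (N choose-pred r) ℤ.- pos (N choose suc r))
    ≡⟨ cong₂ (λ a b → [-1]^ N ℤ.* (pos a ℤ.- pos b)) (C-pred-sym i r) C-suc ⟩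
  [-1]^ N ℤ.* (pos (N choose suc i) ℤ.- pos (N choose-pred i))
    ≡⟨ flip ([-1]^ N) (pos (N choose suc i)) (pos (N choose-pred i)) ⟩
  ℤ.- weight N i ∎
  where
  N : ℕ
  N = i + r
  C-suc : N choose suc r ≡ N choose-pred i
  C-suc = begin
    (i + r) choose suc r  ≡⟨ cong (_choose suc r) (ℕ.+-comm i r) ⟩
    (r + i) choose suc r  ≡⟨ sym (C-pred-sym r i) ⟩
    (r + i) choose-pred i ≡⟨ cong (_choose-pred i) (ℕ.+-comm r i) ⟩
    (i + r) choose-pred i ∎
  flip : ∀ s x y → s ℤ.* (x ℤ.- y) ≡ ℤ.- (s ℤ.* (y ℤ.- x))
  flip = ℤ-Ring.solve-∀

weight-middle : ∀ i → weight (i + i) i ≡ 0ℤ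
weight-middle i = trans
  (cong (λ c → [-1]^ (i + i) ℤ.* (pos c ℤ.- pos ((i + i) choose suc i))) (C-pred-sym i i))
  (trans (cong ([-1]^ (i + i) ℤ.*_) (ℤ.+-inverseʳ (pos ((i + i) choose suc i))))
      (ℤ.*-zeroʳ ([-1]^ (i + i))))

2*n≡n+n : ∀ n → 2 * n ≡ n + n
2*n≡n+n n = cong (λ m → n + m) (ℕ.+-identityʳ n)

kernel-reflect : ∀ i r → kernel (i + r) r ≡ kernel (i + r) i ℤ.- weight (i + r) i
kernel-reflect i r with ℕ.<-cmp i r
... | tri< i<r _ _ = begin
  kernel (i + r) r ≡⟨ kernel-≥ (subst (i + r ℕ.≤_) (sym (2*n≡n+n r)) (ℕ.+-monoˡ-≤ r (ℕ.<⇒≤ i<r))) ⟩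
  0ℤ               ≡⟨ sym (ℤ.+-inverseʳ (weight (i + r) i)) ⟩
  weight (i + r) i ℤ.- weight (i + r) i
    ≡⟨ cong (ℤ._- weight (i + r) i)
         (sym (kernel-< (subst (ℕ._< i + r) (sym (2*n≡n+n i)) (ℕ.+-monoʳ-< i i<r)))) ⟩
  kernel (i + r) i ℤ.- weight (i + r) i ∎
... | tri≈ _ refl _ = begin
  kernel (i + i) i ≡⟨ sym (ℤ.+-identityʳ _) ⟩
  kernel (i + i) i ℤ.- 0ℤ ≡⟨ cong (λ w → kernel (i + i) i ℤ.- w) (sym (weight-middle i)) ⟩
  kernel (i + i) i ℤ.- weight (i + i) i ∎
... | tri> _ _ r<i = begin
  kernel (i + r) r
    ≡⟨ kernel-< (subst (ℕ._< i + r) (sym (2*n≡n+n r)) (ℕ.+-monoˡ-< r r<i)) ⟩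
  weight (i + r) r ≡⟨ weight-antisym i r ⟩
  ℤ.- weight (i + r) i ≡⟨ sym (ℤ.+-identityˡ _) ⟩
  0ℤ ℤ.- weight (i + r) i
    ≡⟨ cong (ℤ._- weight (i + r) i)
         (sym (kernel-≥ (subst (i + r ℕ.≤_) (sym (2*n≡n+n i)) (ℕ.+-monoʳ-≤ i (ℕ.<⇒≤ r<i))))) ⟩
  kernel (i + r) i ℤ.- weight (i + r) i ∎

-- The reflection i ↦ n − i leaves the range 0 ≤ i ≤ n only when n < i, and the
-- weight then vanishes unless n = i − 1.

edge : ℕ → ℕ → ℤ
edge n i = if suc n ℕ.≡ᵇ i then [-1]^ n else 0ℤ

≡ᵇ-refl : ∀ n → (n ℕ.≡ᵇ n) ≡ true
≡ᵇ-refl zero    = refl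
≡ᵇ-refl (suc n) = ≡ᵇ-refl n

≢⇒≡ᵇ : ∀ {m n} → m ≢ n → (m ℕ.≡ᵇ n) ≡ false
≢⇒≡ᵇ {zero}  {zero}  m≢n = contradiction refl m≢n
≢⇒≡ᵇ {zero}  {suc n} m≢n = refl
≢⇒≡ᵇ {suc m} {zero}  m≢n = refl
≢⇒≡ᵇ {suc m} {suc n} m≢n = ≢⇒≡ᵇ (m≢n ∘ cong suc)

edge-≡ : ∀ n → edge n (suc n) ≡ [-1]^ n
edge-≡ n = cong (if_then [-1]^ n else 0ℤ) (≡ᵇ-refl n)

edge-≢ : ∀ {n i} → suc n ≢ i → edge n i ≡ 0ℤ
edge-≢ {n} 1+n≢i = cong (if_then [-1]^ n else 0ℤ) (≢⇒≡ᵇ 1+n≢i)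

weight-beyond : ∀ {n i} → n ℕ.< i → weight n i ≡ edge n i
weight-beyond {n} {suc i} n<1+i with n ℕ.≟ i
... | yes refl = begin
  [-1]^ n ℤ.* (pos (n choose n) ℤ.- pos (n choose suc (suc n)))
    ≡⟨ cong₂ (λ a b → [-1]^ n ℤ.* (pos a ℤ.- pos b)) (nCn≡1 n)
        (k>n⇒nCk≡0 (ℕ.m<n⇒m<1+n (ℕ.n<1+n n))) ⟩
  [-1]^ n ℤ.* 1ℤ ≡⟨ ℤ.*-identityʳ _ ⟩
  [-1]^ n ≡⟨ sym (edge-≡ n) ⟩
  edge n (suc n) ∎
... | no n≢i = begin
  [-1]^ n ℤ.* (pos (n choose i) ℤ.- pos (n choose suc (suc i)))
    ≡⟨ cong₂ (λ a b → [-1]^ n ℤ.* (pos a ℤ.- pos b)) (k>n⇒nCk≡0 n<i)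
        (k>n⇒nCk≡0 (ℕ.m<n⇒m<1+n (ℕ.m<n⇒m<1+n n<i))) ⟩
  [-1]^ n ℤ.* 0ℤ ≡⟨ ℤ.*-zeroʳ ([-1]^ n) ⟩
  0ℤ ≡⟨ sym (edge-≢ (n≢i ∘ ℕ.suc-injective)) ⟩
  edge n (suc i) ∎
  where
  n<i : n ℕ.< i
  n<i = ℕ.≤∧≢⇒< (ℕ.s≤s⁻¹ n<1+i) n≢i

-- The shift by `k` reads `kernel l` at j - k = l - i, the reflection of `i`. For l < i that index
-- is negative and the left side is 0, but `weight l i` may survive; `edge l i` compensates for it.
shifted-kernel : ∀ {k l i j} → k + l ≡ j + i →
  (t^ k · kernel l) j ≡ (kernel l i ℤ.- weight l i) ℤ.+ edge l i
shifted-kernel {k} {l} {i} {j} eq with ℕ.<-≤-connex l i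
... | inj₁ l<i = begin
  (t^ k · kernel l) j ≡⟨ t^-coeff-< {k} (kernel l) j<k ⟩
  0ℤ ≡⟨ sym (ℤ.+-inverseˡ (edge l i)) ⟩
  ℤ.- edge l i ℤ.+ edge l i
    ≡⟨ cong (ℤ._+ edge l i) (sym (ℤ.+-identityˡ (ℤ.- edge l i))) ⟩
  (0ℤ ℤ.- edge l i) ℤ.+ edge l i
    ≡⟨ cong₂ (λ a b → (a ℤ.- b) ℤ.+ edge l i)
         (sym (kernel-≥ (ℕ.≤-trans (ℕ.<⇒≤ l<i) (ℕ.m≤m+n i _)))) (sym (weight-beyond l<i)) ⟩
  _ ∎
  where
  j<k : j ℕ.< k
  j<k = ℕ.+-cancelʳ-< l j k (ℕ.<-≤-trans (ℕ.+-monoʳ-< j l<i) (ℕ.≤-reflexive (sym eq)))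
... | inj₂ i≤l with ℕ.m≤n⇒∃[o]m+o≡n i≤l
...   | r , refl = begin
  (t^ k · kernel (i + r)) j ≡⟨ cong (t^ k · kernel (i + r)) (sym k+r≡j) ⟩
  (t^ k · kernel (i + r)) (k + r) ≡⟨ t^-coeff k (kernel (i + r)) r ⟩
  kernel (i + r) r ≡⟨ kernel-reflect i r ⟩
  kernel (i + r) i ℤ.- weight (i + r) i ≡⟨ sym (ℤ.+-identityʳ _) ⟩
  (kernel (i + r) i ℤ.- weight (i + r) i) ℤ.+ 0ℤ
    ≡⟨ cong (λ e → (kernel (i + r) i ℤ.- weight (i + r) i) ℤ.+ e)
         (sym (edge-≢ (ℕ.m+1+n≢m i ∘ trans (ℕ.+-suc i r)))) ⟩
  _ ∎
  where
  k+r≡j : k + r ≡ j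
  k+r≡j = ℕ.+-cancelʳ-≡ i (k + r) j (begin
    k + r + i   ≡⟨ ℕ.+-assoc k r i ⟩
    k + (r + i) ≡⟨ cong (λ m → k + m) (ℕ.+-comm r i) ⟩
    k + (i + r) ≡⟨ eq ⟩
    j + i       ∎)

-- The two parts of the weight are binomials of degree i - 1 and i + 1 in n; the hypothesis puts
-- both degrees below `d`.
weight-sum : ∀ {d i} → suc i ℕ.< d → binomialSum d (λ _ n → weight n i) ≡ 0ℤ
weight-sum {d} {i} 1+i<d = begin
  _ ≡⟨ binomialSum-cong d (λ _ n _ → distrib ([-1]^ n) (pos (n choose-pred i))
      (pos (n choose suc i))) ⟩
  _ ≡⟨ binomialSum-− d _ _ ⟩
  binomialSum d (λ _ n → [-1]^ n ℤ.* pos (n choose-pred i)) ℤ.-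
  binomialSum d (λ _ n → [-1]^ n ℤ.* pos (n choose suc i))
    ≡⟨ cong₂ ℤ._-_ (C-pred-sum i (ℕ.<⇒≤ 1+i<d)) (alternating-sum 1+i<d) ⟩
  0ℤ ∎
  where
  distrib : ∀ s x y → s ℤ.* (x ℤ.- y) ≡ s ℤ.* x ℤ.- s ℤ.* y
  distrib = ℤ-Ring.solve-∀
  C-pred-sum : ∀ i → i ℕ.< d → binomialSum d (λ _ n → [-1]^ n ℤ.* pos (n choose-pred i)) ≡ 0ℤ
  C-pred-sum zero    _   = trans (binomialSum-cong d λ _ n _ → ℤ.*-zeroʳ ([-1]^ n))
      (binomialSum-zero d)
  C-pred-sum (suc i) i<d = alternating-sum (ℕ.<-trans (ℕ.n<1+n i) i<d)

-- The term (-1)ᵏ tˡ in the expansion of (t - 1)^(k+l) reaches t^(j+1) only for l = j + 1, which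
-- under k + l = j + i means i = k + 1.
t^-one : ∀ {k l i j} → k + l ≡ j + i →
  [-1]^ k ℤ.* (t^ l · one) (suc j) ≡ edge k i
t^-one {k} {l} {i} {j} eq with ℕ.<-cmp l (suc j)
... | tri< l<1+j l≢1+j _ = trans
  (cong ([-1]^ k ℤ.*_) (vanish (ℕ.m≤n⇒∃[o]m+o≡n (ℕ.s≤s⁻¹ l<1+j))))
  (trans (ℤ.*-zeroʳ ([-1]^ k)) (sym (edge-≢ {k} {i} λ { refl → l≢1+j (ℕ.+-cancelˡ-≡ k l (suc j)
    (trans eq (trans (ℕ.+-suc j k) (trans (cong suc (ℕ.+-comm j k)) (sym (ℕ.+-suc k j)))))) })))
  where
  vanish : ∀ {j} → (∃ λ r → l + r ≡ j) → (t^ l · one) (suc j) ≡ 0ℤ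
  vanish (r , refl) =
    trans (cong (t^ l · one) (sym (ℕ.+-suc l r))) (t^-coeff l (one) (suc r))
... | tri≈ _ refl _ = begin
  [-1]^ k ℤ.* (t^ suc j · one) (suc j)
    ≡⟨ cong ([-1]^ k ℤ.*_) (trans (cong (t^ suc j · one) (sym (ℕ.+-identityʳ (suc j))))
                             (t^-coeff (suc j) (one) 0)) ⟩
  [-1]^ k ℤ.* 1ℤ ≡⟨ ℤ.*-identityʳ _ ⟩
  [-1]^ k        ≡⟨ sym (edge-≡ k) ⟩
  edge k (suc k) ≡⟨ cong (edge k) (ℕ.+-cancelˡ-≡ j (suc k) i
                      (trans (trans (ℕ.+-suc j k)
                          (trans (cong suc (ℕ.+-comm j k)) (sym (ℕ.+-suc k j)))) eq)) ⟩
  edge k i ∎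
... | tri> _ l≢1+j 1+j<l = trans
  (cong ([-1]^ k ℤ.*_) (t^-coeff-< {l} (one) 1+j<l))
  (trans (ℤ.*-zeroʳ ([-1]^ k)) (sym (edge-≢ {k} {i} λ { refl → l≢1+j (ℕ.+-cancelˡ-≡ k l (suc j)
    (trans eq (trans (ℕ.+-suc j k) (trans (cong suc (ℕ.+-comm j k)) (sym (ℕ.+-suc k j)))))) })))

-- This is the recursion that the sum over flats imposes on p_d; the subtracted term belongs to the
-- circuit-hyperplane itself. It cancels exactly against the `edge` terms left over from reflecting
-- the kernels.
relaxation-recursion : ∀ {d i j} → j + i ≡ d → suc i ℕ.< d →
  binomialSum d (λ k l → ([t-1]^ k · relaxation l) j) ℤ.-
    ([t-1]^ d · one) (suc j) ≡ relaxation d i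
relaxation-recursion {d} {i} {j} j+i≡d 1+i<d = begin
  _ ≡⟨ cong₂ ℤ._-_ main boundary ⟩
  (relaxation d i ℤ.+ E) ℤ.- E ≡⟨ cancel (relaxation d i) E ⟩
  relaxation d i ∎
  where
  E : ℤ
  E = binomialSum d (λ _ n → edge n i)
  main : binomialSum d (λ k l → ([t-1]^ k · relaxation l) j) ≡ relaxation d i ℤ.+ E
  main = begin
    _ ≡⟨ binomial-transform d kernel j ⟩
    _ ≡⟨ binomialSum-cong d (λ k l eq → shifted-kernel {k} (trans eq (sym j+i≡d))) ⟩
    _ ≡⟨ binomialSum-+ d _ _ ⟩
    _ ≡⟨ cong (ℤ._+ E) (binomialSum-− d _ _) ⟩
    _ ≡⟨ cong (λ w → (relaxation d i ℤ.- w) ℤ.+ E) (weight-sum 1+i<d) ⟩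
    _ ≡⟨ cong (ℤ._+ E) (ℤ.+-identityʳ (relaxation d i)) ⟩
    _ ∎
  boundary : ([t-1]^ d · one) (suc j) ≡ E
  boundary = begin
    _ ≡⟨ [t-1]^-expand d (one) (suc j) ⟩
    _ ≡⟨ binomialSum-cong d (λ k l eq → t^-one {k} {l} (trans eq (sym j+i≡d))) ⟩
    _ ≡⟨ binomialSum-swap d _ ⟩
    _ ∎
  cancel : ∀ x y → (x ℤ.+ y) ℤ.- y ≡ x
  cancel = ℤ-Ring.solve-∀

relaxation-≥ : ∀ {d i} → d ℕ.≤ 2 * i → relaxation d i ≡ 0ℤ
relaxation-≥ {d} {i} d≤2i = trans
  (binomialSum-cong d λ k l eq → kernel-≥ (ℕ.≤-trans
      (ℕ.≤-trans (ℕ.m≤n+m l k) (ℕ.≤-reflexive eq)) d≤2i))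
  (binomialSum-zero d)

relaxation-1 : ∀ i → relaxation 1 i ≡ one i
relaxation-1 zero    = refl
relaxation-1 (suc i) = relaxation-≥ {1} {suc i} (s≤s z≤n)

-- Closed form and sign of the relaxation coefficients

C*!*!≡! : ∀ a b → ((a + b) choose a) * (a ! * b !) ≡ (a + b) !
C*!*!≡! a b = begin
  ((a + b) choose a) * (a ! * b !)
    ≡⟨ cong (λ c → ((a + b) choose a) * (a ! * c !)) (sym (ℕ.m+n∸m≡n a b)) ⟩
  ((a + b) choose a) * (a ! * (a + b ∸ a) !)
    ≡⟨ cong (_* (a ! * (a + b ∸ a) !)) (nCk≡n!/k![n-k]! (ℕ.m≤m+n a b)) ⟩
  ((a + b) ! ℕ./ (a ! * (a + b ∸ a) !)) * (a ! * (a + b ∸ a) !)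
    ≡⟨ m/n*n≡m (k![n∸k]!∣n! (ℕ.m≤m+n a b)) ⟩
  (a + b) ! ∎
  where instance
    nonZero : ℕ.NonZero (a ! * (a + b ∸ a) !)
    nonZero = a ℕ.!* (a + b ∸ a) !≢0

trinomial-revision : ∀ a b c →
  ((a + b + c) choose (a + b)) * ((a + b) choose a) ≡ ((a + (b + c)) choose a) * ((b + c) choose b)
trinomial-revision a b c = ℕ.*-cancelʳ-≡ _ _ (a ! * b ! * c !) (begin
  C₁ * C₂ * (a ! * b ! * c !)       ≡⟨ regroup₁ C₁ C₂ (a !) (b !) (c !) ⟩
  C₁ * (C₂ * (a ! * b !) * c !)     ≡⟨ cong (λ x → C₁ * (x * c !)) (C*!*!≡! a b) ⟩
  C₁ * ((a + b) ! * c !)            ≡⟨ C*!*!≡! (a + b) c ⟩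
  (a + b + c) !                     ≡⟨ cong _! (ℕ.+-assoc a b c) ⟩
  (a + (b + c)) !                   ≡⟨ sym (C*!*!≡! a (b + c)) ⟩
  C₃ * (a ! * (b + c) !)            ≡⟨ cong (λ x → C₃ * (a ! * x)) (sym (C*!*!≡! b c)) ⟩
  C₃ * (a ! * (C₄ * (b ! * c !)))   ≡⟨ regroup₂ C₃ C₄ (a !) (b !) (c !) ⟩
  C₃ * C₄ * (a ! * b ! * c !)       ∎)
  where
  C₁ C₂ C₃ C₄ : ℕ
  C₁ = (a + b + c) choose (a + b)
  C₂ = (a + b) choose a
  C₃ = (a + (b + c)) choose a
  C₄ = (b + c) choose b
  instance
    nonZero : ℕ.NonZero (a ! * b ! * c !)
    nonZero = ℕ.m*n≢0 (a ! * b !) (c !) {{a ℕ.!* b !≢0}} {{c ℕ.!≢0}}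
  regroup₁ : ∀ x y a b c → x * y * (a * b * c) ≡ x * (y * (a * b) * c)
  regroup₁ = ℕ-Ring.solve-∀
  regroup₂ : ∀ x y a b c → x * (a * (y * (b * c))) ≡ x * y * (a * b * c)
  regroup₂ = ℕ-Ring.solve-∀

-- The cut-off 2i < n in `kernel` leaves only the tail of an alternating sum that would vanish in
-- full.
truncated : ℕ → ℕ → ℕ → ℤ
truncated K a n = if does (K ℕ.≤? n) then [-1]^ n ℤ.* pos (n choose a) else 0ℤ

truncated-step : ∀ K a n → truncated (suc K) a n ≡
  truncated K a n ℤ.- (if n ℕ.≡ᵇ K then [-1]^ K ℤ.* pos (K choose a) else 0ℤ)
truncated-step K a n with ℕ.<-cmp n K
... | tri< n<K n≢K _ = begin
  truncated (suc K) a n ≡⟨ cong (if_then w else 0ℤ)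
      (dec-false (suc K ℕ.≤? n) (ℕ.<⇒≱ (ℕ.m<n⇒m<1+n n<K))) ⟩
  0ℤ ≡⟨ cong₂ (λ x y → (if x then w else 0ℤ) ℤ.- (if y then [-1]^ K ℤ.* pos (K choose a) else 0ℤ))
      (sym (dec-false (K ℕ.≤? n) (ℕ.<⇒≱ n<K))) (sym (≢⇒≡ᵇ n≢K)) ⟩
  _ ∎
  where
  w : ℤ
  w = [-1]^ n ℤ.* pos (n choose a)
... | tri≈ _ refl _ = begin
  truncated (suc n) a n ≡⟨ cong (if_then w else 0ℤ) (dec-false (suc n ℕ.≤? n) (ℕ.<⇒≱ (ℕ.n<1+n n))) ⟩
  0ℤ ≡⟨ sym (ℤ.+-inverseʳ w) ⟩
  w ℤ.- w ≡⟨ cong₂ (λ x y → (if x then w else 0ℤ) ℤ.- (if y then w else 0ℤ))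
      (sym (dec-true (n ℕ.≤? n) ℕ.≤-refl)) (sym (≡ᵇ-refl n)) ⟩
  _ ∎
  where
  w : ℤ
  w = [-1]^ n ℤ.* pos (n choose a)
... | tri> _ n≢K K<n = begin
  truncated (suc K) a n ≡⟨ cong (if_then w else 0ℤ) (dec-true (suc K ℕ.≤? n) K<n) ⟩
  w ≡⟨ sym (ℤ.+-identityʳ w) ⟩
  w ℤ.- 0ℤ ≡⟨ cong₂ (λ x y → (if x then w else 0ℤ) ℤ.-
      (if y then [-1]^ K ℤ.* pos (K choose a) else 0ℤ)) (sym (dec-true (K ℕ.≤? n) (ℕ.<⇒≤ K<n)))
          (sym (≢⇒≡ᵇ n≢K)) ⟩
  _ ∎
  where
  w : ℤ
  w = [-1]^ n ℤ.* pos (n choose a)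

truncated-sum-step : ∀ d K a → binomialSum d (λ _ n → truncated (suc K) a n) ≡
  binomialSum d (λ _ n → truncated K a n) ℤ.- [-1]^ K ℤ.* (pos ((d choose K) * (K choose a)))
truncated-sum-step d K a = begin
  _ ≡⟨ binomialSum-cong d (λ _ n _ → truncated-step K a n) ⟩
  _ ≡⟨ binomialSum-− d _ _ ⟩
  _ ≡⟨ cong (λ s → S ℤ.- s) (binomialSum-select d K _) ⟩
  S ℤ.- pos (d choose K) ℤ.* ([-1]^ K ℤ.* pos (K choose a))
      ≡⟨ cong (λ s → S ℤ.- s) (regroup (pos (d choose K)) ([-1]^ K) (pos (K choose a))) ⟩
  S ℤ.- [-1]^ K ℤ.* (pos (d choose K) ℤ.* pos (K choose a))
      ≡⟨ cong (λ s → S ℤ.- [-1]^ K ℤ.* s) (sym (ℤ.pos-* (d choose K) (K choose a))) ⟩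
  _ ∎
  where
  S : ℤ
  S = binomialSum d (λ _ n → truncated K a n)
  regroup : ∀ x y z → x ℤ.* (y ℤ.* z) ≡ y ℤ.* (x ℤ.* z)
  regroup = ℤ-Ring.solve-∀

truncated-sum-start : ∀ d a → a ℕ.< d → binomialSum d (λ _ n → truncated a a n) ≡ 0ℤ
truncated-sum-start d a a<d = trans (binomialSum-cong d λ _ n _ → untruncated n)
    (alternating-sum a<d)
  where
  untruncated : ∀ n → truncated a a n ≡ [-1]^ n ℤ.* pos (n choose a)
  untruncated n with ℕ.<-≤-connex n a
  ... | inj₁ n<a = trans (cong (if_then [-1]^ n ℤ.* pos (n choose a) else 0ℤ)
      (dec-false (a ℕ.≤? n) (ℕ.<⇒≱ n<a)))
    (sym (trans (cong (λ c → [-1]^ n ℤ.* pos c) (k>n⇒nCk≡0 n<a)) (ℤ.*-zeroʳ ([-1]^ n))))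
  ... | inj₂ a≤n = cong (if_then [-1]^ n ℤ.* pos (n choose a) else 0ℤ) (dec-true (a ℕ.≤? n) a≤n)

-- From n = `a` on the sum is complete, hence 0. Each further step removes one term, which trinomial
-- revision turns into C(d,a) times an entry of row e + 1 of Pascal's triangle; alternating partial
-- sums of that row are, up to sign, entries of row `e`.
truncated-sum : ∀ a e m → binomialSum (suc (a + e)) (λ _ n → truncated (suc (a + m)) a n) ≡
  [-1]^ (suc (a + m)) ℤ.* pos ((suc (a + e) choose a) * (e choose m))
truncated-sum a e zero = begin
  _ ≡⟨ truncated-sum-step (suc (a + e)) (a + 0) a ⟩
  _ ≡⟨ cong (λ k → binomialSum (suc (a + e)) (λ _ n → truncated k a n) ℤ.- [-1]^ k ℤ.*
      (pos ((suc (a + e) choose k) * (k choose a))))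
         (ℕ.+-identityʳ a) ⟩
  _ ≡⟨ cong₂ (λ x y → x ℤ.- [-1]^ a ℤ.* pos ((suc (a + e) choose a) * y))
      (truncated-sum-start (suc (a + e)) a (s≤s (ℕ.m≤m+n a e))) (nCn≡1 a) ⟩
  0ℤ ℤ.- [-1]^ a ℤ.* pos ((suc (a + e) choose a) * 1)
      ≡⟨ regroup ([-1]^ a) (pos ((suc (a + e) choose a) * 1)) ⟩
  ℤ.- [-1]^ a ℤ.* pos ((suc (a + e) choose a) * 1)
      ≡⟨ cong (λ k → ℤ.- [-1]^ k ℤ.* pos ((suc (a + e) choose a) * 1)) (sym (ℕ.+-identityʳ a)) ⟩
  _ ∎
  where
  regroup : ∀ x y → 0ℤ ℤ.- x ℤ.* y ≡ ℤ.- x ℤ.* y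
  regroup = ℤ-Ring.solve-∀
truncated-sum a e (suc m) = begin
  _ ≡⟨ cong (λ k → binomialSum d (λ _ n → truncated (suc k) a n)) (ℕ.+-suc a m) ⟩
  _ ≡⟨ truncated-sum-step d (suc (a + m)) a ⟩
  _ ≡⟨ cong₂ (λ x y → x ℤ.- s ℤ.* pos y) (truncated-sum a e m) (product m e) ⟩
  s ℤ.* pos (A * (e choose m)) ℤ.- s ℤ.* pos (A * (suc e choose suc m))
    ≡⟨ cong (λ c → s ℤ.* pos (A * (e choose m)) ℤ.- s ℤ.* pos (A * c))
        (sym (nCk+nC[k+1]≡[n+1]C[k+1] e m)) ⟩
  s ℤ.* pos (A * (e choose m)) ℤ.- s ℤ.* pos (A * ((e choose m) + (e choose suc m)))
    ≡⟨ cong (λ c → s ℤ.* pos (A * (e choose m)) ℤ.- s ℤ.* pos c)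
        (ℕ.*-distribˡ-+ A (e choose m) (e choose suc m)) ⟩
  s ℤ.* pos (A * (e choose m)) ℤ.- s ℤ.* (pos (A * (e choose m)) ℤ.+ pos (A * (e choose suc m)))
    ≡⟨ regroup s (pos (A * (e choose m))) (pos (A * (e choose suc m))) ⟩
  ℤ.- s ℤ.* pos (A * (e choose suc m))
    ≡⟨ cong (λ k → [-1]^ (suc k) ℤ.* pos (A * (e choose suc m))) (sym (ℕ.+-suc a m)) ⟩
  _ ∎
  where
  d A : ℕ
  d = suc (a + e)
  A = d choose a
  s : ℤ
  s = [-1]^ (suc (a + m))
  regroup : ∀ s x y → s ℤ.* x ℤ.- s ℤ.* (x ℤ.+ y) ≡ ℤ.- s ℤ.* y
  regroup = ℤ-Ring.solve-∀
  product : ∀ m e → (suc (a + e) choose suc (a + m)) * (suc (a + m) choose a) ≡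
      (suc (a + e) choose a) * (suc e choose suc m)
  product m e with ℕ.<-≤-connex e m
  ... | inj₁ e<m = trans
    (cong (_* (suc (a + m) choose a)) (k>n⇒nCk≡0 (s≤s (ℕ.+-monoʳ-< a e<m))))
    (sym (trans (cong ((suc (a + e) choose a) *_) (k>n⇒nCk≡0 (s≤s e<m)))
        (ℕ.*-zeroʳ (suc (a + e) choose a))))
  ... | inj₂ m≤e with ℕ.m≤n⇒∃[o]m+o≡n m≤e
  ...   | r , refl = begin
    (suc (a + (m + r)) choose suc (a + m)) * (suc (a + m) choose a)
      ≡⟨ cong₂ (λ x y → (x choose y) * (y choose a))
          (trans (cong suc (sym (ℕ.+-assoc a m r))) (cong (_+ r) (sym (ℕ.+-suc a m))))
              (sym (ℕ.+-suc a m)) ⟩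
    ((a + suc m + r) choose (a + suc m)) * ((a + suc m) choose a)
        ≡⟨ trinomial-revision a (suc m) r ⟩
    ((a + (suc m + r)) choose a) * (suc (m + r) choose suc m)
        ≡⟨ cong (λ x → (x choose a) * (suc (m + r) choose suc m)) (ℕ.+-suc a (m + r)) ⟩
    _ ∎

regroup-degree : ∀ h e → suc (h + (2 + h + e)) ≡ suc (2 + h + (h + e))
regroup-degree = ℕ-Ring.solve-∀

-- With q = (2h + e + 3)! / ((h + 2)! h! e!), the two sides are q / (h + e + 3)
-- and q / (h + e + 1).

C-product-≤ : ∀ h e →
  (suc (h + (2 + h + e)) choose h) * ((2 + h + e) choose (2 + h)) ℕ.≤
  (suc (2 + h + (h + e)) choose (2 + h)) * ((h + e) choose h)
C-product-≤ h e = ℕ.*-cancelʳ-≤ Y X (1 + s) (subst (Y * (1 + s) ℕ.≤_) (sym X∼Y)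
    (ℕ.*-monoʳ-≤ Y (ℕ.m≤n+m (1 + s) 2)))
  where
  s D X Y K : ℕ
  s = h + e
  D = suc (h + (2 + h + e))
  X = (suc (2 + h + (h + e)) choose (2 + h)) * ((h + e) choose h)
  Y = (suc (h + (2 + h + e)) choose h) * ((2 + h + e) choose (2 + h))
  K = (2 + h) ! * h ! * e !
  instance
    K≢0 : ℕ.NonZero K
    K≢0 = ℕ.m*n≢0 ((2 + h) ! * h !) (e !) {{(2 + h) ℕ.!* h !≢0}} {{e ℕ.!≢0}}
    s!≢0 : ℕ.NonZero (s !)
    s!≢0 = s ℕ.!≢0
    [2+s]!≢0 : ℕ.NonZero ((2 + s) !)
    [2+s]!≢0 = (2 + s) ℕ.!≢0
  X-top : (suc (2 + h + s) choose (2 + h)) * ((2 + h) ! * (1 + s) !) ≡ D !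
  X-top = begin
    _ ≡⟨ cong (λ n → (n choose (2 + h)) * ((2 + h) ! * (1 + s) !)) (sym (ℕ.+-suc (2 + h) s)) ⟩
    _ ≡⟨ C*!*!≡! (2 + h) (1 + s) ⟩
    _ ≡⟨ cong _! (trans (ℕ.+-suc (2 + h) s) (sym (regroup-degree h e))) ⟩
    D ! ∎
  Y-top : (suc (h + (2 + h + e)) choose h) * (h ! * (3 + s) !) ≡ D !
  Y-top = begin
    _ ≡⟨ cong (λ n → (n choose h) * (h ! * (3 + s) !)) (sym (ℕ.+-suc h (2 + h + e))) ⟩
    _ ≡⟨ C*!*!≡! h (3 + s) ⟩
    _ ≡⟨ cong _! (ℕ.+-suc h (2 + h + e)) ⟩
    D ! ∎
  X-eq : X * (1 + s) * K ≡ D !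
  X-eq = ℕ.*-cancelʳ-≡ _ _ (s !) (begin
    X * (1 + s) * K * s ! ≡⟨ regroup (suc (2 + h + (h + e)) choose (2 + h)) ((h + e) choose h)
        (1 + s) ((2 + h) !) (h !) (e !) (s !) ⟩
    _ ≡⟨ cong₂ _*_ X-top (C*!*!≡! h e) ⟩
    D ! * s ! ∎)
    where
    regroup : ∀ x y t a b c u → x * y * t * (a * b * c) * u ≡ x * (a * (t * u)) * (y * (b * c))
    regroup = ℕ-Ring.solve-∀
  Y-eq : Y * (3 + s) * K ≡ D !
  Y-eq = ℕ.*-cancelʳ-≡ _ _ ((2 + s) !) (begin
    Y * (3 + s) * K * (2 + s) ! ≡⟨ regroup (suc (h + (2 + h + e)) choose h)
        ((2 + h + e) choose (2 + h)) (3 + s) ((2 + h) !) (h !) (e !) ((2 + s) !) ⟩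
    _ ≡⟨ cong₂ _*_ Y-top (C*!*!≡! (2 + h) e) ⟩
    D ! * (2 + s) ! ∎)
    where
    regroup : ∀ x y t a b c u → x * y * t * (a * b * c) * u ≡ x * (b * (t * u)) * (y * (a * c))
    regroup = ℕ-Ring.solve-∀
  X∼Y : X * (1 + s) ≡ Y * (3 + s)
  X∼Y = ℕ.*-cancelʳ-≡ _ _ K (trans X-eq (sym Y-eq))

[-1]^[n+n] : ∀ n → [-1]^ (n + n) ≡ 1ℤ
[-1]^[n+n] zero    = refl
[-1]^[n+n] (suc n) = begin
  ℤ.- [-1]^ (n + suc n)       ≡⟨ cong (λ k → ℤ.- [-1]^ k) (ℕ.+-suc n n) ⟩
  ℤ.- (ℤ.- [-1]^ (n + n))     ≡⟨ ℤ.neg-involutive _ ⟩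
  [-1]^ (n + n)               ≡⟨ [-1]^[n+n] n ⟩
  1ℤ                          ∎

-- Here i = h + 1 and d = 2i + 1 + e, so 2i < d is built in. The threshold 2i + 1 is 1 + a + m both
-- for a = i - 1, m = i + 1 and for a = i + 1, m = i - 1; being odd, it gives both tails the sign
-- -1.
relaxation-closed : ∀ h e → let i = suc h in
  relaxation (suc (h + (2 + h + e))) i ≡
  pos ((suc (2 + h + (h + e)) choose (2 + h)) * ((h + e) choose h)) ℤ.-
  pos ((suc (h + (2 + h + e)) choose h) * ((2 + h + e) choose (2 + h)))
relaxation-closed h e = begin
  relaxation d i
    ≡⟨ binomialSum-cong d (λ _ n _ → split (does (2 * i ℕ.<? n)) ([-1]^ n) (pos (n choose h))
        (pos (n choose suc i))) ⟩
  _ ≡⟨ binomialSum-− d (λ _ n → truncated (suc (2 * i)) h n)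
      (λ _ n → truncated (suc (2 * i)) (2 + h) n) ⟩
  binomialSum d (λ _ n → truncated (suc (2 * i)) h n) ℤ.- binomialSum d
      (λ _ n → truncated (suc (2 * i)) (2 + h) n)
    ≡⟨ cong₂ ℤ._-_
         (trans (cong (λ k → binomialSum d (λ _ n → truncated (suc k) h n)) eq₁)
             (truncated-sum h (2 + h + e) (2 + h)))
         (trans (cong₂ (λ d k → binomialSum d (λ _ n → truncated (suc k) (2 + h) n))
             (regroup-degree h e) eq₂) (truncated-sum (2 + h) (h + e) h)) ⟩
  [-1]^ (suc (h + (2 + h))) ℤ.* Y ℤ.- [-1]^ (suc (2 + h + h)) ℤ.* X
    ≡⟨ cong₂ (λ s t → s ℤ.* Y ℤ.- t ℤ.* X) (parity eq₁) (parity eq₂) ⟩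
  ℤ.- 1ℤ ℤ.* Y ℤ.- ℤ.- 1ℤ ℤ.* X ≡⟨ regroup X Y ⟩
  X ℤ.- Y ∎
  where
  d i : ℕ
  d = suc (h + (2 + h + e))
  i = suc h
  X Y : ℤ
  X = pos ((suc (2 + h + (h + e)) choose (2 + h)) * ((h + e) choose h))
  Y = pos ((suc (h + (2 + h + e)) choose h) * ((2 + h + e) choose (2 + h)))
  eq₁ : 2 * suc h ≡ h + (2 + h)
  eq₁ = lemma h
    where
    lemma : ∀ h → 2 * (1 + h) ≡ h + (2 + h)
    lemma = ℕ-Ring.solve-∀
  eq₂ : 2 * suc h ≡ 2 + h + h
  eq₂ = lemma h
    where
    lemma : ∀ h → 2 * (1 + h) ≡ 2 + h + h
    lemma = ℕ-Ring.solve-∀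
  parity : ∀ {k} → 2 * i ≡ k → [-1]^ (suc k) ≡ ℤ.- 1ℤ
  parity refl = cong ℤ.-_ (trans (cong [-1]^ (2*n≡n+n i)) ([-1]^[n+n] i))
  split : ∀ b s x y → (if b then s ℤ.* (x ℤ.- y) else 0ℤ) ≡
          (if b then s ℤ.* x else 0ℤ) ℤ.- (if b then s ℤ.* y else 0ℤ)
  split true  s x y = distrib s x y
    where
    distrib : ∀ s x y → s ℤ.* (x ℤ.- y) ≡ s ℤ.* x ℤ.- s ℤ.* y
    distrib = ℤ-Ring.solve-∀
  split false s x y = refl
  regroup : ∀ x y → ℤ.- 1ℤ ℤ.* y ℤ.- ℤ.- 1ℤ ℤ.* x ≡ x ℤ.- y
  regroup = ℤ-Ring.solve-∀

relaxation-nonneg : ∀ {d} i → 2 ℕ.≤ d → 0ℤ ≤ relaxation d i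
relaxation-nonneg {d} i 2≤d with ℕ.<-≤-connex (2 * i) d
... | inj₂ d≤2i = ℤ.≤-reflexive (sym (relaxation-≥ {d} {i} d≤2i))
-- For i = 0 the cut-off removes only n = 0, where the weight is 0 anyway, so the full alternating
-- sum is present and vanishes.
relaxation-nonneg {d} zero 2≤d | inj₁ _ = ℤ.≤-reflexive (sym (begin
  relaxation d 0
    ≡⟨ binomialSum-cong d (λ _ n _ → untruncated n) ⟩
  _ ≡⟨ weight-sum 2≤d ⟩
  0ℤ ∎))
  where
  untruncated : ∀ n → kernel n 0 ≡ weight n 0
  untruncated zero    = refl
  untruncated (suc n) = refl
relaxation-nonneg {d} (suc h) 2≤d | inj₁ 2i<d with ℕ.m≤n⇒∃[o]m+o≡n 2i<d
... | e , refl = subst (0ℤ ≤_) (sym (trans (cong (λ d → relaxation d (suc h)) (top h e))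
    (relaxation-closed h e)))
  (ℤ.i≤j⇒0≤j-i (ℤ.+≤+ (C-product-≤ h e)))
  where
  top : ∀ h e → 1 + 2 * (1 + h) + e ≡ 1 + (h + (2 + h + e))
  top = ℕ-Ring.solve-∀

-- Sums over subsets and coefficients of products

sum : List Index → (Index → ℤ) → ℤ
sum []       f = 0ℤ
sum (x ∷ xs) f = f x ℤ.+ sum xs f

sum-cong : ∀ (xs : List Index) {f g : Index → ℤ} → (∀ x → f x ≡ g x) → sum xs f ≡ sum xs g
sum-cong []       f≡g = refl
sum-cong (x ∷ xs) f≡g = cong₂ ℤ._+_ (f≡g x) (sum-cong xs f≡g)

sum-zero : ∀ (xs : List Index) {f : Index → ℤ} → (∀ x → f x ≡ 0ℤ) → sum xs f ≡ 0ℤ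
sum-zero []       f≡0 = refl
sum-zero (x ∷ xs) f≡0 = cong₂ ℤ._+_ (f≡0 x) (sum-zero xs f≡0)

sum-linear : ∀ (xs : List Index) a b (f g : Index → ℤ) →
  sum xs (λ x → a ℤ.* f x ℤ.+ b ℤ.* g x) ≡ a ℤ.* sum xs f ℤ.+ b ℤ.* sum xs g
sum-linear []       a b f g = sym (cong₂ ℤ._+_ (ℤ.*-zeroʳ a) (ℤ.*-zeroʳ b))
sum-linear (x ∷ xs) a b f g = begin
  _ ≡⟨ cong (λ s → (a ℤ.* f x ℤ.+ b ℤ.* g x) ℤ.+ s) (sum-linear xs a b f g) ⟩
  _ ≡⟨ regroup a b (f x) (g x) (sum xs f) (sum xs g) ⟩
  _ ∎
  where
  regroup : ∀ a b x y z w → (a ℤ.* x ℤ.+ b ℤ.* y) ℤ.+ (a ℤ.* z ℤ.+ b ℤ.* w) ≡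
            a ℤ.* (x ℤ.+ z) ℤ.+ b ℤ.* (y ℤ.+ w)
  regroup = ℤ-Ring.solve-∀

sum-+ : ∀ (xs : List Index) (f g : Index → ℤ) → sum xs (λ x → f x ℤ.+ g x) ≡ sum xs f ℤ.+ sum xs g
sum-+ xs f g = begin
  _ ≡⟨ sum-cong xs (λ x → expand (f x) (g x)) ⟩
  _ ≡⟨ sum-linear xs 1ℤ 1ℤ f g ⟩
  _ ≡⟨ sym (expand (sum xs f) (sum xs g)) ⟩
  _ ∎
  where
  expand : ∀ x y → x ℤ.+ y ≡ 1ℤ ℤ.* x ℤ.+ 1ℤ ℤ.* y
  expand = ℤ-Ring.solve-∀

sum-− : ∀ (xs : List Index) (f g : Index → ℤ) → sum xs (λ x → f x ℤ.- g x) ≡ sum xs f ℤ.- sum xs g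
sum-− xs f g = begin
  _ ≡⟨ sum-cong xs (λ x → expand (f x) (g x)) ⟩
  _ ≡⟨ sum-linear xs 1ℤ (ℤ.- 1ℤ) f g ⟩
  _ ≡⟨ sym (expand (sum xs f) (sum xs g)) ⟩
  _ ∎
  where
  expand : ∀ x y → x ℤ.- y ≡ 1ℤ ℤ.* x ℤ.+ (ℤ.- 1ℤ) ℤ.* y
  expand = ℤ-Ring.solve-∀

sum-*ʳ : ∀ (xs : List Index) (f : Index → ℤ) c → sum xs (λ x → f x ℤ.* c) ≡ sum xs f ℤ.* c
sum-*ʳ []       f c = refl
sum-*ʳ (x ∷ xs) f c = trans (cong (λ s → f x ℤ.* c ℤ.+ s) (sum-*ʳ xs f c))
  (sym (ℤ.*-distribʳ-+ c (f x) (sum xs f)))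

sum-swap : ∀ (xs : List Index) (ys : List Index′) (f : Index → Index′ → ℤ) →
  sum xs (λ x → sum ys (f x)) ≡ sum ys (λ y → sum xs (λ x → f x y))
sum-swap []       ys f = sym (sum-zero ys λ _ → refl)
sum-swap (x ∷ xs) ys f = trans (cong (λ s → sum ys (f x) ℤ.+ s) (sum-swap xs ys f))
  (sym (sum-+ ys (f x) λ y → sum xs λ x′ → f x′ y))

sum-filter : ∀ {P : Index → Set} (P? : Decidable P) xs f →
  sum (filter P? xs) f ≡ sum xs (λ x → if does (P? x) then f x else 0ℤ)
sum-filter P? []       f = refl
sum-filter P? (x ∷ xs) f with does (P? x)
... | true  = cong (λ s → f x ℤ.+ s) (sum-filter P? xs f)
... | false = trans (sum-filter P? xs f) (sym (ℤ.+-identityˡ _))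

sum-++ : ∀ (xs ys : List Index) f → sum (xs ++ ys) f ≡ sum xs f ℤ.+ sum ys f
sum-++ []       ys f = sym (ℤ.+-identityˡ _)
sum-++ (x ∷ xs) ys f = trans (cong (λ s → f x ℤ.+ s) (sum-++ xs ys f)) (sym (ℤ.+-assoc (f x) _ _))

sum-map : ∀ (h : Index → Index′) xs f → sum (List.map h xs) f ≡ sum xs (f ∘ h)
sum-map h []       f = refl
sum-map h (x ∷ xs) f = cong (λ s → f (h x) ℤ.+ s) (sum-map h xs f)

sum-subsets : ∀ n (f : Subset (suc n) → ℤ) → sum (subsets (suc n)) f ≡
  sum (subsets n) (f ∘ (outside Vec.∷_)) ℤ.+ sum (subsets n) (f ∘ (inside Vec.∷_))
sum-subsets n f = trans (sum-++ (List.map (outside Vec.∷_) (subsets n)) _ f)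
  (cong₂ ℤ._+_ (sum-map _ (subsets n) f) (sum-map _ (subsets n) f))

sum-⊆ : ∀ (C : Subset n) (g : ℕ → ℤ) →
  sum (subsets n) (λ A → if does (A ⊆? C) then g ∣ A ∣ else 0ℤ) ≡
  binomialSum ∣ C ∣ (λ k _ → g k)
sum-⊆ Vec.[] g = ℤ.+-identityʳ (g 0)
sum-⊆ {suc n} (outside Vec.∷ C) g = begin
  _ ≡⟨ sum-subsets n _ ⟩
  _ ≡⟨ cong₂ ℤ._+_ (sum-⊆ C g) (sum-zero (subsets n) λ _ → refl) ⟩
  _ ≡⟨ ℤ.+-identityʳ _ ⟩
  _ ∎
sum-⊆ {suc n} (inside Vec.∷ C) g =
  trans (sum-subsets n _) (cong₂ ℤ._+_ (sum-⊆ C g) (sum-⊆ C (g ∘ suc)))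

sum-single : ∀ (C : Subset n) (f : Subset n → ℤ) → (∀ A → A ≢ C → f A ≡ 0ℤ) →
  sum (subsets n) f ≡ f C
sum-single Vec.[] f f≡0 = ℤ.+-identityʳ _
sum-single {suc n} (outside Vec.∷ C) f f≡0 = begin
  _ ≡⟨ sum-subsets n f ⟩
  _ ≡⟨ cong₂ ℤ._+_ (sum-single C _ λ A A≢C → f≡0 _ (A≢C ∘ Vec.∷-injectiveʳ))
                   (sum-zero (subsets n) λ A → f≡0 _ λ ()) ⟩
  _ ≡⟨ ℤ.+-identityʳ _ ⟩
  _ ∎
sum-single {suc n} (inside Vec.∷ C) f f≡0 = begin
  _ ≡⟨ sum-subsets n f ⟩
  _ ≡⟨ cong₂ ℤ._+_ (sum-zero (subsets n) λ A → f≡0 _ λ ())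
                   (sum-single C _ λ A A≢C → f≡0 _ (A≢C ∘ Vec.∷-injectiveʳ)) ⟩
  _ ≡⟨ ℤ.+-identityˡ _ ⟩
  _ ∎

-- `A ↦ A ∪ F` is a bijection from the subsets of the complement of `F` to the sets containing `F`.
sum-∪ : ∀ (F : Subset n) (g : Subset n → ℤ) →
  sum (subsets n) (λ A → if does (A ⊆? ∁ F) then g (A ∪ F) else 0ℤ) ≡
  sum (subsets n) (λ C → if does (F ⊆? C) then g C else 0ℤ)
sum-∪ Vec.[] g = refl
sum-∪ {suc n} (outside Vec.∷ F) g = begin
  _ ≡⟨ sum-subsets n _ ⟩
  _ ≡⟨ cong₂ ℤ._+_ (sum-∪ F (g ∘ (outside Vec.∷_))) (sum-∪ F (g ∘ (inside Vec.∷_))) ⟩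
  _ ≡⟨ sym (sum-subsets n _) ⟩
  _ ∎
sum-∪ {suc n} (inside Vec.∷ F) g = begin
  _ ≡⟨ sum-subsets n _ ⟩
  _ ≡⟨ cong₂ ℤ._+_ (sum-∪ F (g ∘ (inside Vec.∷_))) (sum-zero (subsets n) λ _ → refl) ⟩
  S ℤ.+ 0ℤ ≡⟨ ℤ.+-comm S 0ℤ ⟩
  0ℤ ℤ.+ S ≡⟨ cong (ℤ._+ S) (sym (sum-zero (subsets n) λ _ → refl)) ⟩
  _ ≡⟨ sym (sum-subsets n _) ⟩
  _ ∎
  where
  S : ℤ
  S = sum (subsets n) (λ C → if does (F ⊆? C) then g (inside Vec.∷ C) else 0ℤ)

coeff-⊕ : ∀ p q j → coeff (p ⊕ q) j ≡ coeff p j ℤ.+ coeff q j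
coeff-⊕ []      q       j       = sym (ℤ.+-identityˡ _)
coeff-⊕ (a ∷ p) []      j       = sym (ℤ.+-identityʳ _)
coeff-⊕ (a ∷ p) (b ∷ q) zero    = refl
coeff-⊕ (a ∷ p) (b ∷ q) (suc j) = coeff-⊕ p q j

coeff-∑ : ∀ (xs : List Index) f j → coeff (∑ xs f) j ≡ sum xs (λ x → coeff (f x) j)
coeff-∑ []       f j = refl
coeff-∑ (x ∷ xs) f j =
  trans (coeff-⊕ (f x) (∑ xs f) j) (cong (λ s → coeff (f x) j ℤ.+ s) (coeff-∑ xs f j))

coeff-map-* : ∀ a p j → coeff (List.map (a ℤ.*_) p) j ≡ a ℤ.* coeff p j
coeff-map-* a []      j       = sym (ℤ.*-zeroʳ a)
coeff-map-* a (b ∷ p) zero    = refl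
coeff-map-* a (b ∷ p) (suc j) = coeff-map-* a p j

coeff-0∷ : ∀ p j → coeff (0ℤ ∷ p) j ≡ (t· coeff p) j
coeff-0∷ p zero    = refl
coeff-0∷ p (suc j) = refl

-- The second factor is a coefficient sequence, so that a product with χ becomes a combination of
-- the operators `t^ k ·_`.
convolve : Poly → (ℕ → ℤ) → ℕ → ℤ
convolve []      f j = 0ℤ
convolve (a ∷ p) f j = a ℤ.* f j ℤ.+ (t· convolve p f) j

coeff-⊛ : ∀ p q j → coeff (p ⊛ q) j ≡ convolve p (coeff q) j
coeff-⊛ []      q j = refl
coeff-⊛ (a ∷ p) q j = begin
  _ ≡⟨ coeff-⊕ (List.map (a ℤ.*_) q) _ j ⟩
  _ ≡⟨ cong₂ ℤ._+_ (coeff-map-* a q j) (trans (coeff-0∷ (p ⊛ q) j) (t·-cong (coeff-⊛ p q) j)) ⟩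
  _ ∎

t·-zero : ∀ {f : ℕ → ℤ} → (∀ j → f j ≡ 0ℤ) → ∀ j → (t· f) j ≡ 0ℤ
t·-zero f≡0 zero    = refl
t·-zero f≡0 (suc j) = f≡0 j

convolve-⊕ : ∀ p q f j → convolve (p ⊕ q) f j ≡ convolve p f j ℤ.+ convolve q f j
convolve-⊕ []      q       f j = sym (ℤ.+-identityˡ _)
convolve-⊕ (a ∷ p) []      f j = sym (ℤ.+-identityʳ _)
convolve-⊕ (a ∷ p) (b ∷ q) f j = begin
  _ ≡⟨ cong (λ s → (a ℤ.+ b) ℤ.* f j ℤ.+ s)
         (trans (t·-cong (convolve-⊕ p q f) j) (t·-+ (convolve p f) (convolve q f) j)) ⟩
  _ ≡⟨ regroup a b (f j) ((t· convolve p f) j) ((t· convolve q f) j) ⟩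
  _ ∎
  where
  t·-+ : ∀ f g j → (t· λ i → f i ℤ.+ g i) j ≡ (t· f) j ℤ.+ (t· g) j
  t·-+ f g zero    = refl
  t·-+ f g (suc j) = refl
  regroup : ∀ a b x y z → (a ℤ.+ b) ℤ.* x ℤ.+ (y ℤ.+ z) ≡ (a ℤ.* x ℤ.+ y) ℤ.+ (b ℤ.* x ℤ.+ z)
  regroup = ℤ-Ring.solve-∀

convolve-monomial : ∀ a k f j → convolve (monomial a k) f j ≡ a ℤ.* (t^ k · f) j
convolve-monomial a zero    f j =
  trans (cong (λ s → a ℤ.* f j ℤ.+ s) (t·-zero (λ _ → refl) j)) (ℤ.+-identityʳ _)
convolve-monomial a (suc k) f zero    = sym (ℤ.*-zeroʳ a)
convolve-monomial a (suc k) f (suc j) = trans (ℤ.+-identityˡ _) (convolve-monomial a k f j)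

convolve-∑ : ∀ (xs : List Index) (p : Index → Poly) f j →
  convolve (∑ xs p) f j ≡ sum xs (λ x → convolve (p x) f j)
convolve-∑ []       p f j = refl
convolve-∑ (x ∷ xs) p f j = trans (convolve-⊕ (p x) (∑ xs p) f j)
  (cong (λ s → convolve (p x) f j ℤ.+ s) (convolve-∑ xs p f j))

coeff-∑monomial-⊛ : ∀ (xs : List Index) (a : Index → ℤ) (k : Index → ℕ) q j →
  coeff (∑ xs (λ x → monomial (a x) (k x)) ⊛ q) j ≡
  sum xs (λ x → a x ℤ.* (t^ k x · coeff q) j)
coeff-∑monomial-⊛ xs a k q j = begin
  _ ≡⟨ coeff-⊛ (∑ xs (λ x → monomial (a x) (k x))) q j ⟩
  _ ≡⟨ convolve-∑ xs _ (coeff q) j ⟩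
  _ ≡⟨ sum-cong xs (λ x → convolve-monomial (a x) (k x) (coeff q) j) ⟩
  _ ∎

coeff-map-applyUpTo : ∀ (f : ℕ → ℤ) g m {j} → j ℕ.< m →
  coeff (List.map f (applyUpTo g m)) j ≡ f (g j)
coeff-map-applyUpTo f g (suc m) {zero}  _         = refl
coeff-map-applyUpTo f g (suc m) {suc j} (s≤s j<m) = coeff-map-applyUpTo f (g ∘ suc) m j<m

coeff-reciprocal : ∀ r p {j} → j ℕ.≤ r → coeff (reciprocal r p) j ≡ coeff p (r ∸ j)
coeff-reciprocal r p j≤r = coeff-map-applyUpTo (λ j → coeff p (r ∸ j)) id (suc r) (s≤s j≤r)

-- Subsets, rank and flats

x∈p─q⁻ : ∀ {x : Fin n} (p q : Subset n) → x ∈ p ─ q → x ∈ p × x ∉ q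
x∈p─q⁻ p q x∈ = p─q⊆p p q x∈ , x∉q p q x∈
  where
  x∉q : ∀ {n} {x : Fin n} (p q : Subset n) → x ∈ p ─ q → x ∉ q
  x∉q (_ Vec.∷ p)       (_ Vec.∷ q)       (Vec.there x∈) (Vec.there x∈q) = x∉q p q x∈ x∈q
  x∉q (outside Vec.∷ p) (inside Vec.∷ q) () Vec.here
  x∉q (inside Vec.∷ p)  (inside Vec.∷ q) () Vec.here

∣p∪⁅x⁆∣≤ : ∀ (p : Subset n) x → ∣ p ∪ ⁅ x ⁆ ∣ ℕ.≤ suc ∣ p ∣
∣p∪⁅x⁆∣≤ p x = ℕ.≤-trans (∣p∪q∣≤∣p∣+∣q∣ p ⁅ x ⁆)
  (ℕ.≤-reflexive (trans (cong (λ s → ∣ p ∣ + s) (∣⁅x⁆∣≡1 x)) (ℕ.+-comm ∣ p ∣ 1)))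

∣p∪⁅x⁆∣ : ∀ {x : Fin n} (p : Subset n) → x ∉ p → ∣ p ∪ ⁅ x ⁆ ∣ ≡ suc ∣ p ∣
∣p∪⁅x⁆∣ {x = x} p x∉p = ℕ.≤-antisym (∣p∪⁅x⁆∣≤ p x) (p⊂q⇒∣p∣<∣q∣ (p⊂p∪⁅x⁆ p x x∉p))

x∉p-x : ∀ (p : Subset n) x → x ∉ p - x
x∉p-x p x x∈ = proj₂ (x∈p─q⁻ p ⁅ x ⁆ x∈) (x∈⁅x⁆ x)

p-x∪⁅x⁆≡p : ∀ {x : Fin n} (p : Subset n) → x ∈ p → (p - x) ∪ ⁅ x ⁆ ≡ p
p-x∪⁅x⁆≡p {x = x} p x∈p = ⊆-antisym (∪-least (p─q⊆p p ⁅ x ⁆) (⁅⁆⊆ x∈p)) p⊆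
  where
  p⊆ : p ⊆ (p - x) ∪ ⁅ x ⁆
  p⊆ {y} y∈p with y ∈? ⁅ x ⁆
  ... | yes y∈x = ⊆∪ʳ (p - x) ⁅ x ⁆ y∈x
  ... | no  y∉x = ⊆∪ˡ (p - x) ⁅ x ⁆ (x∈p∧x∉q⇒x∈p─q y∈p y∉x)

∣p-x∣ : ∀ {x : Fin n} (p : Subset n) → x ∈ p → suc ∣ p - x ∣ ≡ ∣ p ∣
∣p-x∣ {x = x} p x∈p = trans (sym (∣p∪⁅x⁆∣ (p - x) (x∉p-x p x))) (cong ∣_∣ (p-x∪⁅x⁆≡p p x∈p))

⊆∧∣q∣≤∣p∣⇒≡ : ∀ {p q : Subset n} → p ⊆ q → ∣ q ∣ ℕ.≤ ∣ p ∣ → p ≡ q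
⊆∧∣q∣≤∣p∣⇒≡ {p = p} {q} p⊆q ∣q∣≤∣p∣ = ⊆-antisym p⊆q q⊆p
  where
  q⊆p : q ⊆ p
  q⊆p {x} x∈q with x ∈? p
  ... | yes x∈p = x∈p
  ... | no  x∉p = contradiction (p⊂q⇒∣p∣<∣q∣ (p⊆q , x , x∈q , x∉p)) (ℕ.≤⇒≯ ∣q∣≤∣p∣)

∣p∣≡0⇒p≡⊥ : ∀ {p : Subset n} → ∣ p ∣ ≡ 0 → p ≡ ⊥
∣p∣≡0⇒p≡⊥ {n} {p} ∣p∣≡0 = sym (⊆∧∣q∣≤∣p∣⇒≡ (⊆-min p) (ℕ.≤-trans (ℕ.≤-reflexive ∣p∣≡0) z≤n))

⊈⇒∃ : ∀ {p q : Subset n} → p ⊆ q → p ≢ q → ∃ λ x → x ∈ q × x ∉ p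
⊈⇒∃ {p = p} {q} p⊆q p≢q = ∣p∣<∣q∣⇒∃x∈q─p p q (ℕ.≰⇒> (p≢q ∘ ⊆∧∣q∣≤∣p∣⇒≡ p⊆q))

-- Exchanging a single element moves a set by at most 2, short of the distance 4 between
-- circuit-hyperplanes; contradictions to separation arise in this form.
∣[A∪x]△[A∪y]∣≤2 : ∀ (A : Subset n) x y → ∣ (A ∪ ⁅ x ⁆) △ (A ∪ ⁅ y ⁆) ∣ ℕ.≤ 2
∣[A∪x]△[A∪y]∣≤2 A x y = ℕ.≤-trans (p⊆q⇒∣p∣≤∣q∣
    (∪-least (difference x y) (λ z∈ → swap (difference y x z∈))))
  (ℕ.≤-trans (∣p∪q∣≤∣p∣+∣q∣ ⁅ x ⁆ ⁅ y ⁆) (ℕ.≤-reflexive (cong₂ _+_ (∣⁅x⁆∣≡1 x) (∣⁅x⁆∣≡1 y))))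
  where
  difference : ∀ x y → (A ∪ ⁅ x ⁆) ─ (A ∪ ⁅ y ⁆) ⊆ ⁅ x ⁆ ∪ ⁅ y ⁆
  difference x y z∈ with x∈p─q⁻ (A ∪ ⁅ x ⁆) (A ∪ ⁅ y ⁆) z∈
  ... | z∈Ax , z∉Ay with x∈p∪q⁻ A ⁅ x ⁆ z∈Ax
  ...   | inj₁ z∈A = contradiction (⊆∪ˡ A ⁅ y ⁆ z∈A) z∉Ay
  ...   | inj₂ z∈x = ⊆∪ˡ ⁅ x ⁆ ⁅ y ⁆ z∈x
  swap : ⁅ y ⁆ ∪ ⁅ x ⁆ ⊆ ⁅ x ⁆ ∪ ⁅ y ⁆
  swap = ∪-least (⊆∪ʳ ⁅ x ⁆ ⁅ y ⁆) (⊆∪ˡ ⁅ x ⁆ ⁅ y ⁆)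

∈-subsets : ∀ (A : Subset n) → A ∈ᴸ subsets n
∈-subsets Vec.[]            = here refl
∈-subsets {suc n} (outside Vec.∷ A) = ∈-++⁺ˡ (∈-map⁺ (outside Vec.∷_) (∈-subsets A))
∈-subsets {suc n} (inside Vec.∷ A)  =
  ∈-++⁺ʳ (List.map (outside Vec.∷_) (subsets n)) (∈-map⁺ (inside Vec.∷_) (∈-subsets A))

⋂-⊆ : ∀ {ps : List (Subset n)} {p} → p ∈ᴸ ps → ⋂ ps ⊆ p
⋂-⊆ {ps = p ∷ ps} (here refl) = p∩q⊆p p (⋂ ps)
⋂-⊆ {ps = q ∷ ps} (there p∈)  = ⋂-⊆ p∈ ∘ p∩q⊆q q (⋂ ps)

⊆-⋂ : ∀ {ps : List (Subset n)} {q} → (∀ {p} → p ∈ᴸ ps → q ⊆ p) → q ⊆ ⋂ ps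
⊆-⋂ {ps = []}     q⊆ _   = ∈⊤
⊆-⋂ {ps = p ∷ ps} q⊆ x∈q = x∈p∩q⁺ (q⊆ (here refl) x∈q , ⊆-⋂ (q⊆ ∘ there) x∈q)

module _ (M : Matroid n) where

  rk-≤ : ∀ {A k} → (∀ I → Indep M I → I ⊆ A → ∣ I ∣ ℕ.≤ k) → rk M A ℕ.≤ k
  rk-≤ {A} bound = max≤v⁺ z≤n (map⁺ (All.map (λ (i , I⊆A) → bound _ i I⊆A)
    (all-filter (λ I → indep? M I ×-dec (I ⊆? A)) (subsets n))))

  ≤-rk : ∀ {A I} → Indep M I → I ⊆ A → ∣ I ∣ ℕ.≤ rk M A
  ≤-rk {A} {I} i I⊆A = All.lookup (xs≤max 0 _)
      (∈-map⁺ ∣_∣ (∈-filter⁺ (λ I → indep? M I ×-dec (I ⊆? A)) (∈-subsets I) (i , I⊆A)))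

  rk-basis : ∀ {A B} → IsBasisOf M A B → rk M A ≡ ∣ B ∣
  rk-basis {A} {B} b = ℕ.≤-antisym (rk-≤ bound) (≤-rk (indep b) (basis⊆ b))
    where
    open IsBasisOf
    bound : ∀ I → Indep M I → I ⊆ A → ∣ I ∣ ℕ.≤ ∣ B ∣
    bound I i I⊆A = ℕ.≮⇒≥ λ ∣B∣<∣I∣ →
      let e , e∈I , e∉B , j = augment M (indep b) i ∣B∣<∣I∣
      in basis⇒stuck M b e (I⊆A e∈I) e∉B j

  rk-mono : ∀ {A B} → A ⊆ B → rk M A ℕ.≤ rk M B
  rk-mono A⊆B = rk-≤ λ I i I⊆A → ≤-rk i (A⊆B ∘ I⊆A)

  rk≤∣∣ : ∀ A → rk M A ℕ.≤ ∣ A ∣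
  rk≤∣∣ A = rk-≤ λ I i I⊆A → p⊆q⇒∣p∣≤∣q∣ I⊆A

  rk-indep : ∀ {I} → Indep M I → rk M I ≡ ∣ I ∣
  rk-indep {I} i = ℕ.≤-antisym (rk≤∣∣ I) (≤-rk i id)

  flat-ground : IsFlat M (ground M)
  flat-ground = id , λ e e∈ e∉ → contradiction e∈ e∉

module _ (M : Matroid n) where

  rk-localization : ∀ {F G} → G ⊆ F → rk (localization M F) G ≡ rk M G
  rk-localization {F} {G} G⊆F = ℕ.≤-antisym
    (rk-≤ (localization M F) λ I (_ , i) I⊆G → ≤-rk M i I⊆G)
    (rk-≤ M λ I i I⊆G → ≤-rk (localization M F) ((G⊆F ∘ I⊆G) , i) I⊆G)

  rank-contraction : ∀ F → rank (contraction M F) ℕ.≤ rank M ∸ rk M F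
  rank-contraction F = rk-≤ (contraction M F) λ { I (I⊆ , B , b , i) _ →
    ℕ.m+n≤o⇒m≤o∸n ∣ I ∣ (ℕ.≤-trans
      (ℕ.+-monoʳ-≤ ∣ I ∣ (ℕ.≤-reflexive (rk-basis M b)))
      (ℕ.≤-trans
        (disjoint⇒∣p∣+∣q∣≤∣p∪q∣ I B λ x∈I x∈B →
          proj₂ (x∈p─q⁻ (ground M) F (I⊆ x∈I)) (IsBasisOf.basis⊆ b x∈B))
        (≤-rk M i (support M i)))) }

  -- A basis of `F` can be augmented from a larger basis of `F ∪ ⁅ e ⁆`. The new element is not in
  -- `F`, where the first basis is maximal, so it is `e`. Thus contracting a flat leaves no loops.
  flat-extends : ∀ {F e} → IsFlat M F → e ∈ ground M → e ∉ F → Indep (contraction M F) ⁅ e ⁆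
  flat-extends {F} {e} (F⊆ , grows) e∈ e∉ with basis-exists M F | basis-exists M (F ∪ ⁅ e ⁆)
  ... | B , b | D , d with augment M (IsBasisOf.indep b) (IsBasisOf.indep d)
                             (subst₂ ℕ._<_ (rk-basis M b) (rk-basis M d) (grows e e∈ e∉))
  ...   | x , x∈D , x∉B , i with x∈p∪q⁻ F ⁅ e ⁆ (IsBasisOf.basis⊆ d x∈D)
  ...     | inj₁ x∈F = contradiction i (basis⇒stuck M b x x∈F x∉B)
  ...     | inj₂ x∈e with refl ← x∈⁅y⁆⇒x≡y e x∈e =
    ⁅⁆⊆ (x∈p∧x∉q⇒x∈p─q e∈ e∉) , B , b , down M (∪-least (⊆∪ʳ B ⁅ e ⁆) (⊆∪ˡ B ⁅ e ⁆)) i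

  -- The elements of `Z` are loops, and adjoining a loop to a set cannot raise its rank.
  rank-zero⊆flat : ∀ {Z G} → Z ⊆ ground M → rk M Z ≡ 0 → IsFlat M G → Z ⊆ G
  rank-zero⊆flat {Z} {G} Z⊆ rkZ≡0 (_ , grows) {x} x∈Z with x ∈? G
  ... | yes x∈G = x∈G
  ... | no  x∉G = contradiction (grows x (Z⊆ x∈Z) x∉G) (ℕ.≤⇒≯ (rk-≤ M bound))
    where
    bound : ∀ I → Indep M I → I ⊆ G ∪ ⁅ x ⁆ → ∣ I ∣ ℕ.≤ rk M G
    bound I i I⊆ = ≤-rk M i I⊆G
      where
      I⊆G : I ⊆ G
      I⊆G {y} y∈I with x∈p∪q⁻ G ⁅ x ⁆ (I⊆ y∈I)
      ... | inj₁ y∈G = y∈G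
      ... | inj₂ y∈x with refl ← x∈⁅y⁆⇒x≡y x y∈x = contradiction
        (ℕ.≤-trans (ℕ.≤-reflexive (sym (∣⁅x⁆∣≡1 x))) (≤-rk M (down M (⁅⁆⊆ y∈I) i) (⁅⁆⊆ x∈Z)))
        (ℕ.<⇒≱ (ℕ.≤-reflexive (cong suc rkZ≡0)))

  ∈-flats : ∀ {F} → IsFlat M F → F ∈ᴸ flats M
  ∈-flats {F} f = ∈-filter⁺ (isFlat? M) (∈-subsets F) f

  0̂-rank-zero : ∀ {Z} → IsFlat M Z → rk M Z ≡ 0 → 0̂ M ≡ Z
  0̂-rank-zero z@(Z⊆ , _) rkZ≡0 = ⊆-antisym (⋂-⊆ (∈-flats z))
    (⊆-⋂ λ G∈ → rank-zero⊆flat Z⊆ rkZ≡0 (proj₂ (∈-filter⁻ (isFlat? M) {xs = subsets n} G∈)))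

-- The Möbius function on Boolean intervals

möbius-refl : ∀ (L : List (Subset n)) x → möbius L x x ≡ 1ℤ
möbius-refl L x = möbius-acc-refl (⊂-wellFounded x)
  where
  möbius-acc-refl : ∀ (a : Acc _⊂_ x) → möbius-acc L x x a ≡ 1ℤ
  möbius-acc-refl (acc rs) =
    cong (if_then 1ℤ else ℤ.- List.foldr (λ z s → möbius-term L x rs z (x ⊆? z) (z ⊂? x) ℤ.+ s) 0ℤ
        L)
      (dec-true (x ≟ˢ x) refl)

foldr-sum : ∀ {A : Set} (f : A → ℤ) xs → List.foldr (λ x s → f x ℤ.+ s) 0ℤ xs ≡ sum xs f
foldr-sum f []       = refl
foldr-sum f (x ∷ xs) = cong (λ s → f x ℤ.+ s) (foldr-sum f xs)

[-1]^-sum : ∀ {d} → 0 ℕ.< d → binomialSum d (λ k _ → [-1]^ k) ≡ 0ℤ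
[-1]^-sum {suc d} _ = trans (cong (λ s → S ℤ.+ s) (binomialSum-neg d λ k _ → [-1]^ k))
    (ℤ.+-inverseʳ S)
  where
  S : ℤ
  S = binomialSum d (λ k _ → [-1]^ k)

-- The recursion sums (-1)^|z| over z ⊊ y. Over all z ⊆ y the sum is 0 when y is non-empty, so what
-- remains is minus the term z = y.
möbius-boolean : ∀ (M : Matroid n) y → (∀ {z} → z ⊆ y → IsFlat M z) →
  möbius (flats M) ⊥ y ≡ [-1]^ ∣ y ∣
möbius-boolean {n} M y flat = go y (⊂-wellFounded y) flat
  where
  L : List (Subset n)
  L = flats M
  -- The accessibility proof is arbitrary because recursive calls receive `rs p` rather than
  -- `⊂-wellFounded z`.
  go : ∀ y (a : Acc _⊂_ y) → (∀ {z} → z ⊆ y → IsFlat M z) → möbius-acc L ⊥ y a ≡ [-1]^ ∣ y ∣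
  go y (acc rs) flat with ⊥ ≟ˢ y
  ... | yes refl = cong [-1]^ (sym (∣⊥∣≡0 n))
  ... | no ⊥≢y = begin
    ℤ.- List.foldr (λ z s → term z ℤ.+ s) 0ℤ L ≡⟨ cong ℤ.-_ (foldr-sum term L) ⟩
    ℤ.- sum L term ≡⟨ cong ℤ.-_ (sum-filter (isFlat? M) (subsets n) term) ⟩
    ℤ.- sum (subsets n) (λ z → if does (isFlat? M z) then term z else 0ℤ)
      ≡⟨ cong ℤ.-_ (sum-cong (subsets n) value) ⟩
    ℤ.- sum (subsets n) (λ z → below z ℤ.- top z)
      ≡⟨ cong ℤ.-_ (sum-− (subsets n) below top) ⟩
    ℤ.- (sum (subsets n) below ℤ.- sum (subsets n) top)
      ≡⟨ cong₂ (λ s t → ℤ.- (s ℤ.- t))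
           (trans (sum-⊆ y [-1]^) ([-1]^-sum (ℕ.n≢0⇒n>0 (⊥≢y ∘ sym ∘ ∣p∣≡0⇒p≡⊥))))
           (trans (sum-single y top λ z z≢y → cong (if_then [-1]^ ∣ z ∣ else 0ℤ)
               (dec-false (z ≟ˢ y) z≢y))
                  (cong (if_then [-1]^ ∣ y ∣ else 0ℤ) (dec-true (y ≟ˢ y) refl))) ⟩
    ℤ.- (0ℤ ℤ.- [-1]^ ∣ y ∣) ≡⟨ cancel ([-1]^ ∣ y ∣) ⟩
    [-1]^ ∣ y ∣ ∎
    where
    term below top : Subset n → ℤ
    term z = möbius-term L ⊥ rs z (⊥ ⊆? z) (z ⊂? y)
    below z = if does (z ⊆? y) then [-1]^ ∣ z ∣ else 0ℤ
    top z = if does (z ≟ˢ y) then [-1]^ ∣ z ∣ else 0ℤ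
    cancel : ∀ x → ℤ.- (0ℤ ℤ.- x) ≡ x
    cancel = ℤ-Ring.solve-∀
    term-⊂ : ∀ z → z ⊂ y → term z ≡ [-1]^ ∣ z ∣
    term-⊂ z z⊂y with ⊥ ⊆? z | z ⊂? y
    ... | yes _  | yes p = go z (rs p) (λ w⊆z → flat (proj₁ z⊂y ∘ w⊆z))
    ... | yes _  | no ¬p = contradiction z⊂y ¬p
    ... | no ⊥⊈z | _     with () ← ⊥⊈z (⊆-min z)
    term-⊄ : ∀ z → ¬ z ⊂ y → term z ≡ 0ℤ
    term-⊄ z z⊄y with ⊥ ⊆? z | z ⊂? y
    ... | yes _  | yes p = contradiction p z⊄y
    ... | yes _  | no _  = refl
    ... | no _   | _     = refl
    if-0 : ∀ b → (if b then 0ℤ else 0ℤ) ≡ 0ℤ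
    if-0 true  = refl
    if-0 false = refl
    value : ∀ z → (if does (isFlat? M z) then term z else 0ℤ) ≡ below z ℤ.- top z
    value z with z ⊆? y | z ≟ˢ y
    ... | yes z⊆y | yes refl = begin
      _ ≡⟨ cong (λ t → if does (isFlat? M z) then t else 0ℤ) (term-⊄ z (⊂-irref refl)) ⟩
      _ ≡⟨ if-0 (does (isFlat? M z)) ⟩
      _ ≡⟨ sym (ℤ.+-inverseʳ ([-1]^ ∣ z ∣)) ⟩
      _ ∎
    ... | yes z⊆y | no z≢y = begin
      _ ≡⟨ cong (if_then term z else 0ℤ) (dec-true (isFlat? M z) (flat z⊆y)) ⟩
      _ ≡⟨ term-⊂ z (z⊆y , ⊈⇒∃ z⊆y z≢y) ⟩
      _ ≡⟨ sym (ℤ.+-identityʳ _) ⟩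
      _ ∎
    ... | no z⊈y | yes refl with () ← z⊈y id
    ... | no z⊈y | no _ = begin
      _ ≡⟨ cong (λ t → if does (isFlat? M z) then t else 0ℤ) (term-⊄ z (λ z⊂y → z⊈y (proj₁ z⊂y))) ⟩
      _ ≡⟨ if-0 (does (isFlat? M z)) ⟩
      _ ∎

-- Kazhdan–Lusztig polynomials in rank one and products with χ

t^-one-> : ∀ {k j} → k ℕ.< j → (t^ k · one) j ≡ 0ℤ
t^-one-> {zero}  {suc j} _         = refl
t^-one-> {suc k} {suc j} (s≤s k<j) = t^-one-> {k} k<j

if-zero : ∀ b {x} → x ≡ 0ℤ → (if b then x else 0ℤ) ≡ 0ℤ
if-zero true  x≡0 = x≡0
if-zero false x≡0 = refl

if-yes : ∀ {A : Set} (a? : Dec A) {x} → A → (if does a? then x else 0ℤ) ≡ x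
if-yes a? {x} a = cong (if_then x else 0ℤ) (dec-true a? a)

if-no : ∀ {A : Set} (a? : Dec A) {x} → ¬ A → (if does a? then x else 0ℤ) ≡ 0ℤ
if-no a? {x} ¬a = cong (if_then x else 0ℤ) (dec-false a? ¬a)

if-≡0 : ∀ {A : Set} (a? : Dec A) {x} → (A → x ≡ 0ℤ) → (if does a? then x else 0ℤ) ≡ 0ℤ
if-≡0 (yes a) x≡0 = x≡0 a
if-≡0 (no _)  x≡0 = refl

module _ (N : Matroid n) where

  χ-term : Poly → ℕ → Subset n → ℤ
  χ-term q j G = möbius (flats N) (0̂ N) G ℤ.* (t^ (rank N ∸ rk N G) · coeff q) j

  coeff-χ-⊛ : ∀ q j → coeff (χ N ⊛ q) j ≡
    sum (subsets n) (λ G → if does (isFlat? N G) then χ-term q j G else 0ℤ)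
  coeff-χ-⊛ q j = trans
    (coeff-∑monomial-⊛ (flats N) (möbius (flats N) (0̂ N)) (λ G → rank N ∸ rk N G) q j)
    (sum-filter (isFlat? N) (subsets n) (χ-term q j))

  coeff-χ-⊛-rank-zero : ∀ q j → rank N ≡ 0 → coeff q j ≡ 0ℤ → coeff (χ N ⊛ q) j ≡ 0ℤ
  coeff-χ-⊛-rank-zero q j rank≡0 qj≡0 = trans (coeff-χ-⊛ q j)
    (sum-zero (subsets n) λ G → if-zero (does (isFlat? N G)) (vanish G))
    where
    vanish : ∀ G → χ-term q j G ≡ 0ℤ
    vanish G = begin
      μ ℤ.* (t^ (rank N ∸ rk N G) · coeff q) j
        ≡⟨ cong (λ k → μ ℤ.* (t^ k · coeff q) j)
            (trans (cong (_∸ rk N G) rank≡0) (ℕ.0∸n≡0 (rk N G))) ⟩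
      μ ℤ.* coeff q j ≡⟨ cong (μ ℤ.*_) qj≡0 ⟩
      μ ℤ.* 0ℤ        ≡⟨ ℤ.*-zeroʳ μ ⟩
      0ℤ ∎
      where
      μ : ℤ
      μ = möbius (flats N) (0̂ N) G

  rk-⊥ : rk N ⊥ ≡ 0
  rk-⊥ = trans (rk-indep N (empty N)) (∣⊥∣≡0 n)

  extensible-flat : ∀ {z} → z ⊆ ground N → (∀ {e} → e ∈ ground N → Indep N (z ∪ ⁅ e ⁆)) → IsFlat N z
  extensible-flat {z} z⊆ extends = z⊆ , λ e e∈ e∉ → ℕ.≤-trans
    (s≤s (rk≤∣∣ N z)) (ℕ.≤-reflexive (trans (sym (∣p∪⁅x⁆∣ z e∉)) (sym (rk-indep N (extends e∈)))))

  -- The hypothesis passes to subsets, so every subset of `G` is a flat and the interval below `G`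
  -- is Boolean; in particular `⊥` is a flat of rank 0, hence the minimum.
  extensible-möbius : ∀ {G} → G ⊆ ground N → (∀ {e} → e ∈ ground N → Indep N (G ∪ ⁅ e ⁆)) →
    möbius (flats N) (0̂ N) G ≡ [-1]^ ∣ G ∣
  extensible-möbius {G} G⊆ extends = trans
    (cong (λ x → möbius (flats N) x G) (0̂-rank-zero N (flat (⊆-min G)) rk-⊥))
    (möbius-boolean N G flat)
    where
    flat : ∀ {z} → z ⊆ G → IsFlat N z
    flat z⊆G = extensible-flat (G⊆ ∘ z⊆G)
      λ {e} e∈ → down N (∪-least (⊆∪ˡ G ⁅ e ⁆ ∘ z⊆G) (⊆∪ʳ G ⁅ e ⁆)) (extends e∈)

  -- Every subset of an independent ground set is a flat, so the lattice is Boolean and χ is a power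
  -- of t - 1.
  coeff-χ-⊛-free : ∀ q j → Indep N (ground N) →
    coeff (χ N ⊛ q) j ≡ ([t-1]^ ∣ ground N ∣ · coeff q) j
  coeff-χ-⊛-free q j free = begin
    _ ≡⟨ coeff-χ-⊛ q j ⟩
    _ ≡⟨ sum-cong (subsets n) value ⟩
    _ ≡⟨ sum-⊆ E (λ k → [-1]^ k ℤ.* (t^ (∣ E ∣ ∸ k) · coeff q) j) ⟩
    _ ≡⟨ binomialSum-cong ∣ E ∣ (λ k l eq → cong (λ m → [-1]^ k ℤ.* (t^ m · coeff q) j)
           (trans (cong (_∸ k) (sym eq)) (ℕ.m+n∸m≡n k l))) ⟩
    _ ≡⟨ sym ([t-1]^-expand ∣ E ∣ (coeff q) j) ⟩
    _ ∎
    where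
    E : Subset n
    E = ground N
    value : ∀ G → (if does (isFlat? N G) then χ-term q j G else 0ℤ) ≡
      (if does (G ⊆? E) then [-1]^ ∣ G ∣ ℤ.* (t^ (∣ E ∣ ∸ ∣ G ∣) · coeff q) j else 0ℤ)
    value G = by-cases (G ⊆? E)
      where
      by-cases : Dec (G ⊆ E) → _
      by-cases (no G⊈E) = trans (if-no (isFlat? N G) (λ f → G⊈E (proj₁ f)))
          (sym (if-no (G ⊆? E) G⊈E))
      by-cases (yes G⊆E) = begin
        _ ≡⟨ if-yes (isFlat? N G) (extensible-flat G⊆E extends) ⟩
        _ ≡⟨ cong₂ (λ μ k → μ ℤ.* (t^ k · coeff q) j) (extensible-möbius G⊆E extends)
               (cong₂ _∸_ (rk-indep N free) (rk-indep N (down N G⊆E free))) ⟩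
        _ ≡⟨ sym (if-yes (G ⊆? E) G⊆E) ⟩
        _ ∎
        where
        extends : ∀ {e} → e ∈ E → Indep N (G ∪ ⁅ e ⁆)
        extends e∈ = down N (∪-least G⊆E (⁅⁆⊆ e∈)) free

  -- Only flats of corank at least 2 contribute to t^j with j ≥ 2, and below
  -- those the lattice of flats is Boolean.

  coeff-χ-⊛-paving : ∀ q {j} → (∀ i → coeff q i ≡ one i) → 1 ℕ.< j →
    (∀ {z} → z ⊆ ground N → ∣ z ∣ ℕ.< rank N → Indep N z) →
    coeff (χ N ⊛ q) j ≡
    binomialSum ∣ ground N ∣ (λ k _ → [-1]^ k ℤ.* (t^ (rank N ∸ k) · one) j)
  coeff-χ-⊛-paving q {j} q≈1 1<j indep-< = begin
    _ ≡⟨ coeff-χ-⊛ q j ⟩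
    _ ≡⟨ sum-cong (subsets n) value ⟩
    _ ≡⟨ sum-⊆ E (λ k → [-1]^ k ℤ.* (t^ (r ∸ k) · one) j) ⟩
    _ ∎
    where
    E : Subset n
    E = ground N
    r : ℕ
    r = rank N
    vanish : ∀ {k} → r ℕ.≤ suc k → ∀ x {f} → (∀ i → f i ≡ one i) → x ℤ.* (t^ (r ∸ k) · f) j ≡ 0ℤ
    vanish {k} r≤1+k x f≈1 = trans
      (cong (x ℤ.*_) (trans (t^-cong (r ∸ k) f≈1 j)
        (t^-one-> {r ∸ k} (ℕ.≤-<-trans (ℕ.m≤n+o⇒m∸n≤o r k
            (ℕ.≤-trans r≤1+k (ℕ.≤-reflexive (ℕ.+-comm 1 k)))) 1<j))))
      (ℤ.*-zeroʳ x)
    -- A basis of `G` with fewer than r - 1 elements could be enlarged inside `G`, since every set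
    -- of size below `r` is independent.
    rk-large : ∀ {G} → G ⊆ E → r ℕ.≤ suc ∣ G ∣ → r ℕ.≤ suc (rk N G)
    rk-large {G} G⊆E r≤ with basis-exists N G
    ... | B , b = subst (λ k → r ℕ.≤ suc k) (sym (rk-basis N b)) (ℕ.≮⇒≥ λ 1+∣B∣<r →
      let x , x∈G , x∉B = ∣p∣<∣q∣⇒∃x∈q─p B G (ℕ.s≤s⁻¹ (ℕ.<-≤-trans 1+∣B∣<r r≤))
      in basis⇒stuck N b x x∈G x∉B (indep-< (∪-least (G⊆E ∘ IsBasisOf.basis⊆ b) (⁅⁆⊆ (G⊆E x∈G)))
           (subst (ℕ._< r) (sym (∣p∪⁅x⁆∣ B x∉B)) 1+∣B∣<r)))
    value : ∀ G → (if does (isFlat? N G) then χ-term q j G else 0ℤ) ≡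
      (if does (G ⊆? E) then [-1]^ ∣ G ∣ ℤ.* (t^ (r ∸ ∣ G ∣) · one) j else 0ℤ)
    value G = by-cases (G ⊆? E) (ℕ.<-≤-connex (suc ∣ G ∣) r)
      where
      by-cases : Dec (G ⊆ E) → _ → _
      by-cases (no G⊈E) _ = trans (if-no (isFlat? N G) (λ f → G⊈E (proj₁ f)))
          (sym (if-no (G ⊆? E) G⊈E))
      -- Such a `G` may or may not be a flat, but neither side sees it: the exponents r - rk G and r
      -- - |G| are at most 1, and 1 < j.
      by-cases (yes G⊆E) (inj₂ r≤) = trans
        (if-zero (does (isFlat? N G)) (vanish (rk-large G⊆E r≤) (möbius (flats N) (0̂ N) G) q≈1))
        (sym (if-zero (does (G ⊆? E)) (vanish r≤ ([-1]^ ∣ G ∣) λ _ → refl)))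
      by-cases (yes G⊆E) (inj₁ 1+∣G∣<r) = begin
        _ ≡⟨ if-yes (isFlat? N G) (extensible-flat G⊆E extends) ⟩
        _ ≡⟨ cong₂ ℤ._*_ (extensible-möbius G⊆E extends)
               (trans (cong (λ k → (t^ (r ∸ k) · coeff q) j)
                        (rk-indep N (indep-< G⊆E (ℕ.<-trans (ℕ.n<1+n _) 1+∣G∣<r))))
                      (t^-cong (r ∸ ∣ G ∣) q≈1 j)) ⟩
        _ ≡⟨ sym (if-yes (G ⊆? E) G⊆E) ⟩
        _ ∎
        where
        extends : ∀ {e} → e ∈ E → Indep N (G ∪ ⁅ e ⁆)
        extends {e} e∈ = indep-< (∪-least G⊆E (⁅⁆⊆ e∈)) (ℕ.≤-<-trans (∣p∪⁅x⁆∣≤ G e) 1+∣G∣<r)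

module _ (P : ∀ {n} → Matroid n → Poly) (KL : IsKazhdanLusztig P) where

  open IsKazhdanLusztig KL

  KL-recursion : ∀ (M : Matroid n) {j} → j ℕ.≤ rank M → coeff (P M) (rank M ∸ j) ≡
    sum (subsets n) (λ F → if does (isFlat? M F)
      then coeff (χ (localization M F) ⊛ P (contraction M F)) j else 0ℤ)
  KL-recursion {n} M {j} j≤r = begin
    _ ≡⟨ sym (coeff-reciprocal (rank M) (P M) j≤r) ⟩
    _ ≡⟨ recursion M j ⟩
    _ ≡⟨ coeff-∑ (flats M) _ j ⟩
    _ ≡⟨ sum-filter (isFlat? M) (subsets n) _ ⟩
    _ ∎

  KL-degree : ∀ (M : Matroid n) {i} → rank M ℕ.≤ 2 * i → 0 ℕ.< i → coeff (P M) i ≡ 0ℤ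
  KL-degree M {suc i} r≤2i _ with rank M ℕ.≟ 0
  ... | yes r≡0 = rank-zero M r≡0 (suc i)
  ... | no r≢0 with coeff (P M) (suc i) ℤ.≟ 0ℤ
  ...   | yes c≡0 = c≡0
  ...   | no c≢0 = contradiction (degree M (ℕ.n≢0⇒n>0 r≢0) (suc i) c≢0) (ℕ.≤⇒≯ r≤2i)

  -- The degree bound leaves the constant term, which the recursion reads off at t¹. A flat other
  -- than the ground set has rank 0 and contributes only in degree 0. For the ground set, the
  -- coefficient of t in χ is the Möbius value 1 of `Z`, the set of loops.
  KL-rank-one : ∀ (M : Matroid n) {Z} → rank M ≡ 1 → IsFlat M Z → rk M Z ≡ 0 →
    ∀ i → coeff (P M) i ≡ one i
  KL-rank-one M rank≡1 _ _ (suc i) =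
    KL-degree M (subst (ℕ._≤ 2 * suc i) (sym rank≡1) (s≤s z≤n)) (s≤s z≤n)
  KL-rank-one {n} M {Z} rank≡1 z rkZ≡0 zero = begin
    coeff (P M) 0 ≡⟨ cong (λ r → coeff (P M) (r ∸ 1)) (sym rank≡1) ⟩
    coeff (P M) (rank M ∸ 1) ≡⟨ KL-recursion M (ℕ.≤-reflexive (sym rank≡1)) ⟩
    _ ≡⟨ sum-single E _ other-flats ⟩
    _ ≡⟨ if-yes (isFlat? M E) (flat-ground M) ⟩
    coeff (χ L ⊛ P (contraction M E)) 1 ≡⟨ coeff-χ-⊛ L (P (contraction M E)) 1 ⟩
    _ ≡⟨ sum-single Z _ other-terms ⟩
    _ ≡⟨ if-yes (isFlat? L Z) (loc-flat z) ⟩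
    χ-term L (P (contraction M E)) 1 Z
      ≡⟨ cong₂ ℤ._*_ μ≡1 (trans (cong (λ k → (t^ k · coeff (P (contraction M E))) 1)
          (cong₂ _∸_ L-rank (trans (L-rk Z⊆E) rkZ≡0)))
           (rank-zero (contraction M E) contr-rank 0)) ⟩
    1ℤ ∎
    where
    E : Subset n
    E = ground M
    Z⊆E : Z ⊆ E
    Z⊆E = proj₁ z
    L : Matroid n
    L = localization M E
    L-rk : ∀ {G} → G ⊆ E → rk L G ≡ rk M G
    L-rk = rk-localization M
    L-rank : rank L ≡ 1
    L-rank = trans (L-rk id) rank≡1
    loc-flat : ∀ {G} → IsFlat M G → IsFlat L G
    loc-flat {G} (G⊆ , grows) = G⊆ , λ e e∈ e∉ →
      subst₂ ℕ._<_ (sym (L-rk G⊆)) (sym (L-rk (∪-least G⊆ (⁅⁆⊆ e∈)))) (grows e e∈ e∉)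
    unloc-flat : ∀ {G} → IsFlat L G → IsFlat M G
    unloc-flat {G} (G⊆ , grows) = G⊆ , λ e e∈ e∉ →
      subst₂ ℕ._<_ (L-rk G⊆) (L-rk (∪-least G⊆ (⁅⁆⊆ e∈))) (grows e e∈ e∉)
    μ≡1 : möbius (flats L) (0̂ L) Z ≡ 1ℤ
    μ≡1 = trans (cong (λ x → möbius (flats L) x Z)
        (0̂-rank-zero L (loc-flat z) (trans (L-rk Z⊆E) rkZ≡0)))
                (möbius-refl (flats L) Z)
    contr-rank : rank (contraction M E) ≡ 0
    contr-rank = ℕ.n≤0⇒n≡0 (ℕ.≤-trans (rank-contraction M E) (ℕ.≤-reflexive (ℕ.n∸n≡0 (rank M))))
    rank-zero-flat : ∀ {F} → IsFlat M F → F ≢ E → rk M F ≡ 0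
    rank-zero-flat (F⊆E , grows) F≢E with ⊈⇒∃ F⊆E F≢E
    ... | e , e∈E , e∉F = ℕ.n≤0⇒n≡0 (ℕ.s≤s⁻¹ (ℕ.<-≤-trans (grows e e∈E e∉F)
        (ℕ.≤-trans (rk-mono M (∪-least F⊆E (⁅⁆⊆ e∈E))) (ℕ.≤-reflexive rank≡1))))
    other-flats : ∀ F → F ≢ E → (if does (isFlat? M F) then
      coeff (χ (localization M F) ⊛ P (contraction M F)) 1 else 0ℤ) ≡ 0ℤ
    other-flats F F≢E = if-≡0 (isFlat? M F) λ f → coeff-χ-⊛-rank-zero (localization M F)
        (P (contraction M F)) 1
      (trans (rk-localization M id) (rank-zero-flat f F≢E))
      (KL-degree (contraction M F) (ℕ.≤-trans (rank-contraction M F)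
        (ℕ.≤-trans (ℕ.m∸n≤m (rank M) (rk M F)) (ℕ.≤-trans (ℕ.≤-reflexive rank≡1) (s≤s z≤n))))
            (s≤s z≤n))
    other-terms : ∀ G → G ≢ Z → (if does (isFlat? L G) then
      χ-term L (P (contraction M E)) 1 G else 0ℤ) ≡ 0ℤ
    other-terms G G≢Z = if-≡0 (isFlat? L G) λ g → by-cases g (rk M G) refl
      where
      by-cases : IsFlat L G → ∀ k → rk M G ≡ k → χ-term L (P (contraction M E)) 1 G ≡ 0ℤ
      by-cases g zero rkG = contradiction
        (⊆-antisym (rank-zero⊆flat M (proj₁ g) rkG z) (rank-zero⊆flat M Z⊆E rkZ≡0 (unloc-flat g)))
            G≢Z
      by-cases g (suc k) rkG = trans
        (cong (λ m → möbius (flats L) (0̂ L) G ℤ.* (t^ m · coeff (P (contraction M E))) 1)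
          (trans (cong₂ _∸_ L-rank (trans (L-rk (proj₁ g)) rkG)) (ℕ.0∸n≡0 k)))
        (trans (cong (möbius (flats L) (0̂ L) G ℤ.*_) (rank-zero (contraction M E) contr-rank 1))
               (ℤ.*-zeroʳ (möbius (flats L) (0̂ L) G)))

  -- The contraction by a hyperplane has rank one and, `F` being a flat, no loops; its flat of rank
  -- 0 is therefore `⊥`.
  KL-hyperplane : ∀ (M : Matroid n) {F} → IsFlat M F → suc (rk M F) ≡ rank M →
    ∀ i → coeff (P (contraction M F)) i ≡ one i
  KL-hyperplane {n} M {F} f 1+rk≡rank = KL-rank-one N rank≡1 ⊥-flat (rk-⊥ N)
    where
    N : Matroid n
    N = contraction M F
    indep-single : ∀ {e} → e ∈ ground M ─ F → Indep N ⁅ e ⁆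
    indep-single e∈ = flat-extends M f (proj₁ (x∈p─q⁻ (ground M) F e∈))
        (proj₂ (x∈p─q⁻ (ground M) F e∈))
    ⊥-flat : IsFlat N ⊥
    ⊥-flat = extensible-flat N (⊆-min _) λ {e} e∈ → subst (Indep N) (sym (∪-identityˡ ⁅ e ⁆))
        (indep-single e∈)
    point : ∃ λ e → e ∈ ground M × e ∉ F
    point = ⊈⇒∃ (proj₁ f) λ { refl → ℕ.1+n≢n 1+rk≡rank }
    rank≡1 : rank N ≡ 1
    rank≡1 with point
    ... | e , e∈ , e∉ = ℕ.≤-antisym
      (ℕ.≤-trans (rank-contraction M F) (ℕ.≤-reflexive
          (trans (cong (_∸ rk M F) (sym 1+rk≡rank)) (ℕ.m+n∸n≡m 1 (rk M F)))))
      (ℕ.≤-trans (ℕ.≤-reflexive (sym (∣⁅x⁆∣≡1 e)))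
        (≤-rk N (indep-single (x∈p∧x∉q⇒x∈p─q e∈ e∉)) (⁅⁆⊆ (x∈p∧x∉q⇒x∈p─q e∈ e∉))))

-- Sparse paving matroids

-- H is the characteristic function of the set of circuit-hyperplanes.

record Sparse (M : Matroid n) (d : ℕ) (H : Subset n → Bool) : Set where
  field
    indep⇒    : ∀ {I} → Indep M I → ∣ I ∣ ℕ.≤ d × H I ≡ false
    indep⇐    : ∀ {I} → I ⊆ ground M → ∣ I ∣ ℕ.≤ d → H I ≡ false → Indep M I
    H⇒        : ∀ {C} → H C ≡ true → C ⊆ ground M × ∣ C ∣ ≡ d
    separated : ∀ {C C′} → H C ≡ true → H C′ ≡ true → C ≢ C′ → 4 ℕ.≤ ∣ C △ C′ ∣
    spans     : ∃ λ B → Indep M B × ∣ B ∣ ≡ d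

¬true⇒false : ∀ {b} → b ≢ true → b ≡ false
¬true⇒false = Bool.¬-not

grow : ∀ (M : Matroid n) {I B} k → k + ∣ I ∣ ≡ ∣ B ∣ → Indep M I → Indep M B →
       ∃ λ J → I ⊆ J × Indep M J × ∣ J ∣ ≡ ∣ B ∣
grow M {I} zero    eq i b = I , id , i , eq
grow M {I} {B} (suc k) eq i b
  with augment M i b (ℕ.≤-trans (s≤s (ℕ.m≤n+m ∣ I ∣ k)) (ℕ.≤-reflexive eq))
... | e , _ , e∉I , i′
  with grow M k (trans (cong (λ s → k + s) (∣p∪⁅x⁆∣ I e∉I)) (trans (ℕ.+-suc k ∣ I ∣) eq)) i′ b
...   | J , I∪e⊆J , j , ∣J∣ = J , I∪e⊆J ∘ ⊆∪ˡ I ⁅ e ⁆ , j , ∣J∣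

∣p∪q∣ : ∀ (p q : Subset n) → (∀ {x} → x ∈ p → x ∉ q) → ∣ p ∪ q ∣ ≡ ∣ p ∣ + ∣ q ∣
∣p∪q∣ p q disjoint = ℕ.≤-antisym (∣p∪q∣≤∣p∣+∣q∣ p q) (disjoint⇒∣p∣+∣q∣≤∣p∪q∣ p q disjoint)

module _ {M : Matroid n} {d : ℕ} {H : Subset n → Bool} (S : Sparse M d H) where

  open Sparse S

  small-indep : ∀ {I} → I ⊆ ground M → ∣ I ∣ ℕ.< d → Indep M I
  small-indep I⊆ ∣I∣<d = indep⇐ I⊆ (ℕ.<⇒≤ ∣I∣<d) (¬true⇒false λ h → ℕ.<⇒≢ ∣I∣<d (proj₂ (H⇒ h)))

  sparse-rank : rank M ≡ d
  sparse-rank = ℕ.≤-antisym (rk-≤ M λ I i _ → proj₁ (indep⇒ i))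
    (let B , b , ∣B∣≡d = spans in subst (ℕ._≤ rank M) ∣B∣≡d (≤-rk M b (support M b)))

  H⇒dependent : ∀ {C} → H C ≡ true → ¬ Indep M C
  H⇒dependent h i with () ← trans (sym h) (proj₂ (indep⇒ i))

  H-adjacent : ∀ {A x y} → H (A ∪ ⁅ x ⁆) ≡ true → H (A ∪ ⁅ y ⁆) ≡ true → A ∪ ⁅ x ⁆ ≡ A ∪ ⁅ y ⁆
  H-adjacent {A} {x} {y} hx hy with (A ∪ ⁅ x ⁆) ≟ˢ (A ∪ ⁅ y ⁆)
  ... | yes eq = eq
  ... | no neq = contradiction (ℕ.≤-trans (separated hx hy neq) (∣[A∪x]△[A∪y]∣≤2 A x y))
      (ℕ.<⇒≱ (s≤s (s≤s (s≤s z≤n))))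

  H-rk-< : ∀ {C} → H C ≡ true → rk M C ℕ.< d
  H-rk-< {C} h with basis-exists M C
  ... | B , b = subst (ℕ._< d) (sym (rk-basis M b)) (ℕ.≰⇒> λ d≤∣B∣ →
    H⇒dependent h (subst (Indep M)
      (⊆∧∣q∣≤∣p∣⇒≡ (IsBasisOf.basis⊆ b) (ℕ.≤-trans (ℕ.≤-reflexive (proj₂ (H⇒ h))) d≤∣B∣))
      (IsBasisOf.indep b)))

  H-nonempty : ∀ {C} → H C ≡ true → Nonempty C
  H-nonempty {C} h with ∣p∣<∣q∣⇒∃x∈q─p ⊥ C (subst₂ ℕ._<_ (sym (∣⊥∣≡0 n)) (sym (proj₂ (H⇒ h)))
      (ℕ.≤-<-trans z≤n (H-rk-< h)))
  ... | x , x∈C , _ = x , x∈C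

  H-rk : ∀ {C} → H C ≡ true → suc (rk M C) ≡ d
  H-rk {C} h with H-nonempty h
  ... | x , x∈C = ℕ.≤-antisym (H-rk-< h) (subst (ℕ._≤ suc (rk M C)) (proj₂ (H⇒ h))
    (subst (ℕ._≤ suc (rk M C)) (∣p-x∣ C x∈C) (s≤s
      (≤-rk M (small-indep (proj₁ (H⇒ h) ∘ p─q⊆p C ⁅ x ⁆)
                (ℕ.≤-reflexive (trans (∣p-x∣ C x∈C) (proj₂ (H⇒ h))))) (p─q⊆p C ⁅ x ⁆)))))

  small-flat : ∀ {F} → F ⊆ ground M → suc ∣ F ∣ ℕ.< d → IsFlat M F
  small-flat {F} F⊆ 1+∣F∣<d = extensible-flat M F⊆ λ {e} e∈ →
    small-indep (∪-least F⊆ (⁅⁆⊆ e∈)) (ℕ.≤-<-trans (∣p∪⁅x⁆∣≤ F e) 1+∣F∣<d)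

  hyperplane-flat : ∀ {F} → F ⊆ ground M → suc ∣ F ∣ ≡ d →
      (∀ {C} → F ⊆ C → H C ≡ false) → IsFlat M F
  hyperplane-flat {F} F⊆ 1+∣F∣≡d free = extensible-flat M F⊆ λ {e} e∈ →
    indep⇐ (∪-least F⊆ (⁅⁆⊆ e∈)) (ℕ.≤-trans (∣p∪⁅x⁆∣≤ F e) (ℕ.≤-reflexive 1+∣F∣≡d))
        (free (⊆∪ˡ F ⁅ e ⁆))

  -- `F` is independent of size d - 1 and `C` has rank d - 1, so adjoining a point of `C` outside
  -- `F` does not raise the rank.
  below-H-not-flat : ∀ {F C} → suc ∣ F ∣ ≡ d → F ⊆ C → H C ≡ true → ¬ IsFlat M F
  below-H-not-flat {F} {C} 1+∣F∣≡d F⊆C h (F⊆ , grows)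
    with ⊈⇒∃ F⊆C (λ { refl → ℕ.1+n≢n (trans 1+∣F∣≡d (sym (proj₂ (H⇒ h)))) })
  ... | e , e∈C , e∉F = ℕ.<⇒≱
    (ℕ.≤-<-trans (ℕ.<-≤-trans (grows e (proj₁ (H⇒ h) e∈C) e∉F)
        (rk-mono M (∪-least F⊆C (⁅⁆⊆ e∈C)))) (H-rk-< h))
    (subst (ℕ._≤ suc (rk M F)) 1+∣F∣≡d
      (s≤s (ℕ.≤-reflexive (sym (rk-indep M (small-indep F⊆ (ℕ.≤-reflexive 1+∣F∣≡d)))))))

  -- Exchanging some `x` of `C` for a point `e` outside gives a d-set adjacent to `C`. By separation
  -- it is no circuit-hyperplane, hence independent, and `C ∪ ⁅ e ⁆` has rank at least `d`.
  H-flat : ∀ {C} → H C ≡ true → IsFlat M C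
  H-flat {C} h = proj₁ (H⇒ h) , grows
    where
    grows : ∀ e → e ∈ ground M → e ∉ C → rk M C ℕ.< rk M (C ∪ ⁅ e ⁆)
    grows e e∈ e∉C with H-nonempty h
    ... | x , x∈C = ℕ.<-≤-trans (H-rk-< h) (subst (ℕ._≤ rk M (C ∪ ⁅ e ⁆)) ∣A∪e∣
        (≤-rk M A∪e-indep A∪e⊆))
      where
      A : Subset n
      A = C - x
      A⊆C : A ⊆ C
      A⊆C = p─q⊆p C ⁅ x ⁆
      A∪e⊆ : A ∪ ⁅ e ⁆ ⊆ C ∪ ⁅ e ⁆
      A∪e⊆ = ∪-least (⊆∪ˡ C ⁅ e ⁆ ∘ A⊆C) (⊆∪ʳ C ⁅ e ⁆)
      ∣A∪e∣ : ∣ A ∪ ⁅ e ⁆ ∣ ≡ d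
      ∣A∪e∣ = trans (∣p∪⁅x⁆∣ A (e∉C ∘ A⊆C)) (trans (∣p-x∣ C x∈C) (proj₂ (H⇒ h)))
      A∪e-indep : Indep M (A ∪ ⁅ e ⁆)
      A∪e-indep = indep⇐ (∪-least (proj₁ (H⇒ h) ∘ A⊆C) (⁅⁆⊆ e∈)) (ℕ.≤-reflexive ∣A∪e∣)
        (¬true⇒false λ h′ → e∉C (subst (e ∈_)
          (trans (sym (H-adjacent (subst (λ D → H D ≡ true) (sym (p-x∪⁅x⁆≡p C x∈C)) h) h′))
              (p-x∪⁅x⁆≡p C x∈C))
          (x∈p∪⁅x⁆ A e)))

  basis-< : ∀ {F B e} → IsFlat M F → IsBasisOf M F B → e ∈ ground M → e ∉ F → ∣ B ∣ ℕ.< d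
  basis-< (F⊆ , grows) b e∈E e∉F = subst₂ ℕ._<_ (rk-basis M b) sparse-rank
    (ℕ.<-≤-trans (grows _ e∈E e∉F) (rk-mono M (∪-least F⊆ (⁅⁆⊆ e∈E))))

  -- A basis `B` of the proper flat `F` has fewer than `d` elements. For each y in `F` outside `B`,
  -- the set `B ∪ ⁅ y ⁆` is dependent of size at most `d`, hence a circuit-hyperplane. Two of these
  -- would be adjacent, so there is only one such set, and it is `F`.
  large-flat : ∀ {F} → IsFlat M F → F ≢ ground M → d ℕ.≤ ∣ F ∣ → H F ≡ true
  large-flat {F} f@(F⊆ , _) F≢E d≤∣F∣ with basis-exists M F | ⊈⇒∃ F⊆ F≢E
  ... | B , b | e , e∈E , e∉F with ∣p∣<∣q∣⇒∃x∈q─p B F (ℕ.<-≤-trans (basis-< f b e∈E e∉F) d≤∣F∣)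
  ...   | x , x∈F , x∉B = subst (λ D → H D ≡ true)
      (⊆-antisym (∪-least (basis⊆ b) (⁅⁆⊆ x∈F)) F⊆B∪x) (H-B∪ x∈F x∉B)
    where
    open IsBasisOf
    ∣B∣<d : ∣ B ∣ ℕ.< d
    ∣B∣<d = basis-< f b e∈E e∉F
    H-B∪ : ∀ {y} → y ∈ F → y ∉ B → H (B ∪ ⁅ y ⁆) ≡ true
    H-B∪ {y} y∈F y∉B = Bool.¬-not λ h → basis⇒stuck M b y y∈F y∉B
      (indep⇐ (∪-least (F⊆ ∘ basis⊆ b) (⁅⁆⊆ (F⊆ y∈F))) (ℕ.≤-trans (∣p∪⁅x⁆∣≤ B y) ∣B∣<d) h)
    F⊆B∪x : F ⊆ B ∪ ⁅ x ⁆
    F⊆B∪x {y} y∈F with y ∈? B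
    ... | yes y∈B = ⊆∪ˡ B ⁅ x ⁆ y∈B
    ... | no  y∉B = subst (y ∈_) (H-adjacent (H-B∪ y∈F y∉B) (H-B∪ x∈F x∉B)) (x∈p∪⁅x⁆ B y)

  ¬H-ground : H (ground M) ≡ false
  ¬H-ground = ¬true⇒false λ h → let B , b , ∣B∣≡d = spans in
    H⇒dependent h (subst (Indep M)
      (⊆∧∣q∣≤∣p∣⇒≡ (support M b) (ℕ.≤-reflexive (trans (proj₂ (H⇒ h)) (sym ∣B∣≡d)))) b)

contract : (Subset n → Bool) → Subset n → Subset n → Bool
contract H F A = does (A ⊆? ∁ F) ∧ H (A ∪ F)

∧-true⁻ : ∀ {a b} → a ∧ b ≡ true → a ≡ true × b ≡ true
∧-true⁻ {true} {true} _ = refl , refl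

does-true⁻ : ∀ {A : Set} (a? : Dec A) → does a? ≡ true → A
does-true⁻ (yes a) _ = a

-- As |F| < d, the set `F` is independent and is its own basis, so independence of `I` in the
-- contraction is independence of `I ∪ F`. Distances survive because sets disjoint from `F` differ
-- exactly where their unions with `F` do.
sparse-contraction : ∀ {M : Matroid n} {d H F} → Sparse M d H → F ⊆ ground M → ∣ F ∣ ℕ.< d →
  Sparse (contraction M F) (d ∸ ∣ F ∣) (contract H F)
sparse-contraction {n} {M} {d} {H} {F} S F⊆ ∣F∣<d = record
  { indep⇒ = λ { {I} (I⊆ , B , b , i) → indep⇒′ I⊆ b i }
  ; indep⇐ = indep⇐′
  ; H⇒ = λ {C} h → let C⊆∁F , h′ = H/⁻ h in
      (λ x∈C → x∈p∧x∉q⇒x∈p─q (proj₁ (H⇒ h′) (⊆∪ˡ C F x∈C)) (x∈∁p⇒x∉p (C⊆∁F x∈C))) ,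
      trans (sym (ℕ.m+n∸n≡m ∣ C ∣ ∣ F ∣))
        (cong (_∸ ∣ F ∣) (trans (sym (∣p∪q∣ C F (x∈∁p⇒x∉p ∘ C⊆∁F))) (proj₂ (H⇒ h′))))
  ; separated = separated′
  ; spans = spans′
  }
  where
  open Sparse S
  H/⁻ : ∀ {C} → contract H F C ≡ true → C ⊆ ∁ F × H (C ∪ F) ≡ true
  H/⁻ {C} h = let a , b = ∧-true⁻ h in does-true⁻ (C ⊆? ∁ F) a , b
  F-indep : Indep M F
  F-indep = small-indep S F⊆ ∣F∣<d
  ─-disjoint : ∀ {I} → I ⊆ ground M ─ F → ∀ {x} → x ∈ I → x ∉ F
  ─-disjoint I⊆ x∈I = proj₂ (x∈p─q⁻ (ground M) F (I⊆ x∈I))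
  indep⇒′ : ∀ {I B} → I ⊆ ground M ─ F → IsBasisOf M F B → Indep M (I ∪ B) →
            ∣ I ∣ ℕ.≤ d ∸ ∣ F ∣ × contract H F I ≡ false
  indep⇒′ {I} {B} I⊆ b i = ℕ.m+n≤o⇒m≤o∸n ∣ I ∣
      (ℕ.≤-trans (ℕ.≤-reflexive (sym (∣p∪q∣ I F (─-disjoint I⊆)))) (proj₁ (indep⇒ i′))) ,
    trans (cong (does (I ⊆? ∁ F) ∧_) (proj₂ (indep⇒ i′))) (Bool.∧-zeroʳ (does (I ⊆? ∁ F)))
    where
    open IsBasisOf b
    i′ : Indep M (I ∪ F)
    -- Maximality of `B` among the independent subsets of `F`, applied to `F` itself, gives F ⊆ B.
    i′ = down M (∪-least (⊆∪ˡ I B) (⊆∪ʳ I B ∘ maximal F F-indep basis⊆ id)) i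
  indep⇐′ : ∀ {I} → I ⊆ ground M ─ F → ∣ I ∣ ℕ.≤ d ∸ ∣ F ∣ → contract H F I ≡ false →
            Indep (contraction M F) I
  indep⇐′ {I} I⊆ ∣I∣≤ h = I⊆ , F ,
    record { basis⊆ = id ; indep = F-indep ; maximal = λ _ _ _ I⊆F → I⊆F } ,
    indep⇐ (∪-least (p─q⊆p (ground M) F ∘ I⊆) F⊆)
      (ℕ.≤-trans (∣p∪q∣≤∣p∣+∣q∣ I F) (ℕ.≤-trans (ℕ.+-monoˡ-≤ ∣ F ∣ ∣I∣≤)
          (ℕ.≤-reflexive (ℕ.m∸n+n≡m (ℕ.<⇒≤ ∣F∣<d)))))
      (trans (cong (_∧ H (I ∪ F)) (sym (dec-true (I ⊆? ∁ F)
          (λ x∈I → x∉p⇒x∈∁p (─-disjoint I⊆ x∈I))))) h)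
  ∪F-cancel : ∀ {C C′} → C ⊆ ∁ F → C ∪ F ≡ C′ ∪ F → C ⊆ C′
  ∪F-cancel {C} {C′} C⊆∁F eq {x} x∈C with x∈p∪q⁻ C′ F (subst (x ∈_) eq (⊆∪ˡ C F x∈C))
  ... | inj₁ x∈C′ = x∈C′
  ... | inj₂ x∈F  = contradiction x∈F (x∈∁p⇒x∉p (C⊆∁F x∈C))
  ─-∪F : ∀ C C′ → (C ∪ F) ─ (C′ ∪ F) ⊆ C ─ C′
  ─-∪F C C′ x∈ with x∈p─q⁻ (C ∪ F) (C′ ∪ F) x∈
  ... | x∈CF , x∉C′F with x∈p∪q⁻ C F x∈CF
  ...   | inj₁ x∈C = x∈p∧x∉q⇒x∈p─q x∈C (x∉C′F ∘ ⊆∪ˡ C′ F)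
  ...   | inj₂ x∈F = contradiction (⊆∪ʳ C′ F x∈F) x∉C′F
  separated′ : ∀ {C C′} → contract H F C ≡ true → contract H F C′ ≡ true → C ≢ C′ → 4 ℕ.≤ ∣ C △ C′ ∣
  separated′ {C} {C′} h h′ C≢C′ with H/⁻ {C} h | H/⁻ {C′} h′
  ... | C⊆ , k | C′⊆ , k′ = ℕ.≤-trans
    (separated k k′ λ eq → C≢C′ (⊆-antisym (∪F-cancel C⊆ eq) (∪F-cancel C′⊆ (sym eq))))
    (p⊆q⇒∣p∣≤∣q∣ (∪-least (⊆∪ˡ (C ─ C′) (C′ ─ C) ∘ ─-∪F C C′) (⊆∪ʳ (C ─ C′) (C′ ─ C) ∘ ─-∪F C′ C)))
  spans′ : ∃ λ B → Indep (contraction M F) B × ∣ B ∣ ≡ d ∸ ∣ F ∣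
  spans′ with spans
  ... | B , b , ∣B∣≡d with grow M (d ∸ ∣ F ∣) (trans (ℕ.m∸n+n≡m (ℕ.<⇒≤ ∣F∣<d)) (sym ∣B∣≡d))
      F-indep b
  ...   | J , F⊆J , j , ∣J∣ = J ─ F ,
    ( (λ x∈ → let x∈J , x∉F = x∈p─q⁻ J F x∈ in x∈p∧x∉q⇒x∈p─q (support M j x∈J) x∉F)
    , F , record { basis⊆ = id ; indep = F-indep ; maximal = λ _ _ _ I⊆F → I⊆F }
    , down M (∪-least (p─q⊆p J F) F⊆J) j ) ,
    trans (sym (ℕ.m+n∸n≡m ∣ J ─ F ∣ ∣ F ∣)) (cong (_∸ ∣ F ∣)
      (trans (sym (∣p∪q∣ (J ─ F) F λ x∈ → proj₂ (x∈p─q⁻ J F x∈)))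
          (trans (cong ∣_∣ J─F∪F≡J) (trans ∣J∣ ∣B∣≡d))))
    where
    J─F∪F≡J : (J ─ F) ∪ F ≡ J
    J─F∪F≡J = ⊆-antisym (∪-least (p─q⊆p J F) F⊆J) J⊆
      where
      J⊆ : J ⊆ (J ─ F) ∪ F
      J⊆ {x} x∈J with x ∈? F
      ... | yes x∈F = ⊆∪ʳ (J ─ F) F x∈F
      ... | no  x∉F = ⊆∪ˡ (J ─ F) F (x∈p∧x∉q⇒x∈p─q x∈J x∉F)

-- The effect of relaxing all circuit-hyperplanes

indicator : Bool → ℤ
indicator b = if b then 1ℤ else 0ℤ

count : (Subset n → Bool) → ℤ
count {n} H = sum (subsets n) (λ C → indicator (H C))

countAbove : (Subset n → Bool) → Subset n → ℤ
countAbove {n} H F = sum (subsets n) (λ C → if does (F ⊆? C) then indicator (H C) else 0ℤ)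

count-contract : ∀ (H : Subset n → Bool) F → count (contract H F) ≡ countAbove H F
count-contract {n} H F = trans
  (sum-cong (subsets n) λ A → split (does (A ⊆? ∁ F)) (H (A ∪ F)))
  (sum-∪ F (indicator ∘ H))
  where
  split : ∀ a b → indicator (a ∧ b) ≡ (if a then indicator b else 0ℤ)
  split true  b = refl
  split false b = refl

countAbove-zero : ∀ (H : Subset n → Bool) F → (∀ {C} → F ⊆ C → H C ≡ false) → countAbove H F ≡ 0ℤ
countAbove-zero {n} H F none =
  sum-zero (subsets n) λ C → if-≡0 (F ⊆? C) λ F⊆C → cong indicator (none F⊆C)

countAbove-one : ∀ (H : Subset n → Bool) {F C} → F ⊆ C → H C ≡ true →
  (∀ {C′} → F ⊆ C′ → H C′ ≡ true → C′ ≡ C) → countAbove H F ≡ 1ℤ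
countAbove-one {n} H {F} {C} F⊆C h unique = trans
  (sum-single C _ λ C′ C′≢C → if-≡0 (F ⊆? C′) λ F⊆C′ → cong indicator
      (¬true⇒false (C′≢C ∘ unique F⊆C′)))
  (trans (if-yes (F ⊆? C) F⊆C) (cong indicator h))

-- Exchange of summation over the pairs F ⊆ C: each circuit-hyperplane `C` has `d` elements and so
-- contributes the same sum over its subsets.
sum-countAbove : ∀ (H : Subset n → Bool) {d} → (∀ {C} → H C ≡ true → ∣ C ∣ ≡ d) → ∀ (g : ℕ → ℤ) →
  sum (subsets n) (λ F → countAbove H F ℤ.* g ∣ F ∣) ≡ count H ℤ.* binomialSum d (λ k _ → g k)
sum-countAbove {n} H {d} size g = begin
  _ ≡⟨ sum-cong Ss (λ F → sym (sum-*ʳ Ss _ (g ∣ F ∣))) ⟩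
  _ ≡⟨ sum-swap Ss Ss (λ F C → (if does (F ⊆? C) then indicator (H C) else 0ℤ) ℤ.* g ∣ F ∣) ⟩
  _ ≡⟨ sum-cong Ss inner ⟩
  _ ≡⟨ sum-*ʳ Ss (λ C → indicator (H C)) (binomialSum d (λ k _ → g k)) ⟩
  _ ∎
  where
  Ss : List (Subset n)
  Ss = subsets n
  regroup : ∀ b x y → (if b then x else 0ℤ) ℤ.* y ≡ (if b then y else 0ℤ) ℤ.* x
  regroup true  x y = ℤ.*-comm x y
  regroup false x y = refl
  scaled : ∀ b {x y} → (b ≡ true → x ≡ y) → x ℤ.* indicator b ≡ indicator b ℤ.* y
  scaled true  {x} x≡y = trans (ℤ.*-comm x 1ℤ) (cong (1ℤ ℤ.*_) (x≡y refl))
  scaled false {x} x≡y = ℤ.*-zeroʳ x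
  inner : ∀ C → sum Ss (λ F → (if does (F ⊆? C) then indicator (H C) else 0ℤ) ℤ.* g ∣ F ∣) ≡
                indicator (H C) ℤ.* binomialSum d (λ k _ → g k)
  inner C = begin
    _ ≡⟨ sum-cong Ss (λ F → regroup (does (F ⊆? C)) (indicator (H C)) (g ∣ F ∣)) ⟩
    _ ≡⟨ sum-*ʳ Ss (λ F → if does (F ⊆? C) then g ∣ F ∣ else 0ℤ) (indicator (H C)) ⟩
    _ ≡⟨ cong (ℤ._* indicator (H C)) (sum-⊆ C g) ⟩
    _ ≡⟨ scaled (H C) (λ h → cong (λ k → binomialSum k (λ k _ → g k)) (size h)) ⟩
    _ ∎

count-nonneg : ∀ (H : Subset n → Bool) → 0ℤ ≤ count H
count-nonneg {n} H = go (subsets n)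
  where
  indicator-nonneg : ∀ b → 0ℤ ≤ indicator b
  indicator-nonneg true  = ℤ.+≤+ z≤n
  indicator-nonneg false = ℤ.≤-refl
  go : ∀ Cs → 0ℤ ≤ sum Cs (λ C → indicator (H C))
  go []       = ℤ.≤-refl
  go (C ∷ Cs) = ℤ.+-mono-≤ (indicator-nonneg (H C)) (go Cs)

[t-1]^-difference : ∀ k (u m r : ℕ → ℤ) c → (∀ i → u i ℤ.- m i ≡ c ℤ.* r i) → ∀ j →
  ([t-1]^ k · u) j ℤ.- ([t-1]^ k · m) j ≡ c ℤ.* ([t-1]^ k · r) j
[t-1]^-difference zero    u m r c eq j = eq j
[t-1]^-difference (suc k) u m r c eq j = begin
  (tu ℤ.- qu) ℤ.- (tm ℤ.- qm) ≡⟨ regroup tu qu tm qm ⟩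
  (tu ℤ.- tm) ℤ.- (qu ℤ.- qm) ≡⟨ cong₂ ℤ._-_ (shifted j) ([t-1]^-difference k u m r c eq j) ⟩
  c ℤ.* (t· ([t-1]^ k · r)) j ℤ.- c ℤ.* ([t-1]^ k · r) j
    ≡⟨ factor c ((t· ([t-1]^ k · r)) j) (([t-1]^ k · r) j) ⟩
  c ℤ.* ([t-1]^ suc k · r) j ∎
  where
  tu qu tm qm : ℤ
  tu = (t· ([t-1]^ k · u)) j
  qu = ([t-1]^ k · u) j
  tm = (t· ([t-1]^ k · m)) j
  qm = ([t-1]^ k · m) j
  shifted : ∀ j → (t· ([t-1]^ k · u)) j ℤ.- (t· ([t-1]^ k · m)) j ≡ c ℤ.* (t· ([t-1]^ k · r)) j
  shifted zero    = sym (ℤ.*-zeroʳ c)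
  shifted (suc j) = [t-1]^-difference k u m r c eq j
  regroup : ∀ a b c d → (a ℤ.- b) ℤ.- (c ℤ.- d) ≡ (a ℤ.- c) ℤ.- (b ℤ.- d)
  regroup = ℤ-Ring.solve-∀
  factor : ∀ c x y → c ℤ.* x ℤ.- c ℤ.* y ≡ c ℤ.* (x ℤ.- y)
  factor = ℤ-Ring.solve-∀

-- What a set of size k contained in a given circuit-hyperplane C contributes to
-- the difference of the recursions for t^j; it is C itself when k = d.

contribution : ℕ → ℕ → ℕ → ℤ
contribution d j k = if does (k ℕ.<? d)
  then ([t-1]^ k · relaxation (d ∸ k)) j
  else ℤ.- ([t-1]^ d · one) (suc j)

contribution-< : ∀ {d j k} → k ℕ.< d → contribution d j k ≡ ([t-1]^ k · relaxation (d ∸ k)) j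
contribution-< {d} {j} {k} k<d =
  cong (if_then ([t-1]^ k · relaxation (d ∸ k)) j else ℤ.- ([t-1]^ d · one) (suc j))
      (dec-true (k ℕ.<? d) k<d)

contribution-≥ : ∀ {d j k} → d ℕ.≤ k → contribution d j k ≡ ℤ.- ([t-1]^ d · one) (suc j)
contribution-≥ {d} {j} {k} d≤k =
  cong (if_then ([t-1]^ k · relaxation (d ∸ k)) j else ℤ.- ([t-1]^ d · one) (suc j))
      (dec-false (k ℕ.<? d) (ℕ.≤⇒≯ d≤k))

contribution-sum : ∀ {d i j} → j + i ≡ d → suc i ℕ.< d →
  binomialSum d (λ k _ → contribution d j k) ≡ relaxation d i
contribution-sum {d} {i} {j} j+i≡d 1+i<d = begin
  _ ≡⟨ binomialSum-cong d value ⟩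
  _ ≡⟨ binomialSum-− d (λ k l → ([t-1]^ k · relaxation l) j) (λ _ l → if l ℕ.≡ᵇ 0 then X else 0ℤ) ⟩
  _ ≡⟨ cong (λ x → binomialSum d (λ k l → ([t-1]^ k · relaxation l) j) ℤ.- x)
         (trans (binomialSum-select d 0 X) (ℤ.*-identityˡ X)) ⟩
  _ ≡⟨ relaxation-recursion j+i≡d 1+i<d ⟩
  _ ∎
  where
  X : ℤ
  X = ([t-1]^ d · one) (suc j)
  value : ∀ k l → k + l ≡ d → contribution d j k ≡
    ([t-1]^ k · relaxation l) j ℤ.- (if l ℕ.≡ᵇ 0 then X else 0ℤ)
  -- `relaxation 0` is 0, so the place k = d of the binomial sum is free for the term of the
  -- circuit-hyperplane itself.
  value k zero eq = begin
    contribution d j k ≡⟨ contribution-≥ (ℕ.≤-reflexive (trans (sym eq) (ℕ.+-identityʳ k))) ⟩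
    ℤ.- X ≡⟨ sym (ℤ.+-identityˡ (ℤ.- X)) ⟩
    0ℤ ℤ.- X ≡⟨ cong (ℤ._- X) (sym ([t-1]^-zero k (λ _ → refl) j)) ⟩
    _ ∎
  value k (suc l) eq = begin
    contribution d j k ≡⟨ contribution-< (subst (k ℕ.<_) eq (ℕ.m<m+n k (s≤s z≤n))) ⟩
    ([t-1]^ k · relaxation (d ∸ k)) j
      ≡⟨ cong (λ m → ([t-1]^ k · relaxation m) j)
          (trans (cong (_∸ k) (sym eq)) (ℕ.m+n∸m≡n k (suc l))) ⟩
    ([t-1]^ k · relaxation (suc l)) j ≡⟨ sym (ℤ.+-identityʳ _) ⟩
    _ ∎

-- A circuit-hyperplane has `d` elements but rank d - 1, so in degrees j ≥ 2 its χ looks like (t -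
-- 1)^d divided by t. At k = d truncated subtraction gives the exponent 0 instead of -1, which does
-- not reach tʲ either.
circuit-sum : ∀ d j → 1 ℕ.< j →
  binomialSum d (λ k _ → [-1]^ k ℤ.* (t^ (d ∸ 1 ∸ k) · one) j) ≡ ([t-1]^ d · one) (suc j)
circuit-sum d j 1<j = trans (binomialSum-cong d value) (sym ([t-1]^-expand d one (suc j)))
  where
  value : ∀ k l → k + l ≡ d →
    [-1]^ k ℤ.* (t^ (d ∸ 1 ∸ k) · one) j ≡ [-1]^ k ℤ.* (t^ l · one) (suc j)
  value k zero eq = cong ([-1]^ k ℤ.*_) (trans
    (cong (λ m → (t^ m · one) j) (ℕ.m≤n⇒m∸n≡0 (ℕ.≤-trans (ℕ.m∸n≤m d 1)
        (ℕ.≤-reflexive (trans (sym eq) (ℕ.+-identityʳ k))))))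
    (t^-one-> {0} (ℕ.<-trans (ℕ.n<1+n 0) 1<j)))
  value k (suc l) eq = cong (λ m → [-1]^ k ℤ.* (t^ m · one) j)
    (trans (cong (λ d → d ∸ 1 ∸ k) (trans (sym eq) (ℕ.+-suc k l))) (ℕ.m+n∸m≡n k l))

-- Induction on the rank

module _ (P : ∀ {n} → Matroid n → Poly) (KL : IsKazhdanLusztig P) where

  -- The induction is applied to contractions of both matroids by a common flat, so the ground set
  -- and `H` vary, and `U` is uniform only in the sense of having no circuit-hyperplanes.
  Relaxes : ℕ → Set₁
  Relaxes d = ∀ {n} {M U : Matroid n} {H} → ground U ≡ ground M →
    Sparse M d H → Sparse U d (λ _ → false) →
    ∀ i → coeff (P U) i ℤ.- coeff (P M) i ≡ count H ℤ.* relaxation d i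

  flat-term : Matroid n → ℕ → Subset n → ℤ
  flat-term M j F = coeff (χ (localization M F) ⊛ P (contraction M F)) j

  module _ {M : Matroid n} {d : ℕ} {H : Subset n → Bool} (S : Sparse M d H) where

    open Sparse S

    free-term : ∀ {F} j → F ⊆ ground M → ∣ F ∣ ℕ.< d →
      flat-term M j F ≡ ([t-1]^ ∣ F ∣ · coeff (P (contraction M F))) j
    free-term {F} j F⊆ ∣F∣<d =
      coeff-χ-⊛-free (localization M F) (P (contraction M F)) j (id , small-indep S F⊆ ∣F∣<d)

    hyperplane-term : ∀ {F} j → IsFlat M F → suc ∣ F ∣ ≡ d → flat-term M j F ≡
        ([t-1]^ ∣ F ∣ · one) j
    hyperplane-term {F} j f 1+∣F∣≡d = trans (free-term j (proj₁ f) ∣F∣<d)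
      ([t-1]^-cong ∣ F ∣ (KL-hyperplane P KL M f
        (trans (cong suc (rk-indep M (small-indep S (proj₁ f) ∣F∣<d)))
            (trans 1+∣F∣≡d (sym (sparse-rank S))))) j)
      where
      ∣F∣<d : ∣ F ∣ ℕ.< d
      ∣F∣<d = ℕ.≤-reflexive 1+∣F∣≡d

    -- Only `d` and the size of the ground set enter, so the terms of `M` and `U` at the ground set
    -- cancel.
    ground-term : ∀ {j} → 1 ℕ.< j → flat-term M j (ground M) ≡
      binomialSum ∣ ground M ∣ (λ k _ → [-1]^ k ℤ.* (t^ (d ∸ k) · one) j)
    ground-term {j} 1<j = trans
      (coeff-χ-⊛-paving L (P N) (IsKazhdanLusztig.rank-zero KL N N-rank) 1<j
        λ z⊆ ∣z∣< → z⊆ , small-indep S z⊆ (subst (_ ℕ.<_) L-rank ∣z∣<))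
      (cong (λ r → binomialSum ∣ ground M ∣ (λ k _ → [-1]^ k ℤ.* (t^ (r ∸ k) · one) j)) L-rank)
      where
      L N : Matroid n
      L = localization M (ground M)
      N = contraction M (ground M)
      L-rank : rank L ≡ d
      L-rank = trans (rk-localization M id) (sparse-rank S)
      N-rank : rank N ≡ 0
      N-rank = ℕ.n≤0⇒n≡0 (ℕ.≤-trans (rank-contraction M (ground M))
          (ℕ.≤-reflexive (ℕ.n∸n≡0 (rank M))))

    circuit-term : ∀ {j C} → 1 ℕ.< j → H C ≡ true → flat-term M j C ≡ ([t-1]^ d · one) (suc j)
    circuit-term {j} {C} 1<j h = begin
      _ ≡⟨ coeff-χ-⊛-paving L (P (contraction M C))
             (KL-hyperplane P KL M (H-flat S h) (trans (H-rk S h) (sym (sparse-rank S)))) 1<j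
             (λ z⊆ ∣z∣< → z⊆ , small-indep S (proj₁ (H⇒ h) ∘ z⊆)
                 (ℕ.<-≤-trans ∣z∣< (ℕ.≤-trans (ℕ.≤-reflexive L-rank) (ℕ.m∸n≤m d 1)))) ⟩
      _ ≡⟨ cong₂ (λ c r → binomialSum c (λ k _ → [-1]^ k ℤ.* (t^ (r ∸ k) · one) j))
          (proj₂ (H⇒ h)) L-rank ⟩
      _ ≡⟨ circuit-sum d j 1<j ⟩
      _ ∎
      where
      L : Matroid n
      L = localization M C
      L-rank : rank L ≡ d ∸ 1
      L-rank = trans (rk-localization M id) (cong (_∸ 1) (H-rk S h))

  module Step {d : ℕ} (ih : ∀ {d′} → d′ ℕ.< d → 2 ℕ.≤ d′ → Relaxes d′) (2≤d : 2 ℕ.≤ d)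
              {n : ℕ} {M U : Matroid n} {H : Subset n → Bool} (U≡M : ground U ≡ ground M)
              (S : Sparse M d H) (T : Sparse U d (λ _ → false))
              {i j : ℕ} (j+i≡d : j + i ≡ d) (2i<d : 2 * i ℕ.< d) where

    open Sparse S

    d<2j : d ℕ.< 2 * j
    d<2j = ℕ.+-cancelʳ-< (2 * i) d (2 * j) (subst (d + 2 * i ℕ.<_) total (ℕ.+-monoʳ-< d 2i<d))
      where
      total : d + d ≡ 2 * j + 2 * i
      total = trans (sym (2*n≡n+n d)) (trans (cong (2 *_) (sym j+i≡d)) (ℕ.*-distribˡ-+ 2 j i))

    1<j : 1 ℕ.< j
    1<j = ℕ.*-cancelˡ-< 2 1 j (ℕ.≤-<-trans 2≤d d<2j)

    1+i<d : suc i ℕ.< d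
    1+i<d = ℕ.<-≤-trans (ℕ.+-monoˡ-< i 1<j) (ℕ.≤-reflexive j+i≡d)

    difference : Subset n → ℤ
    difference F = (if does (isFlat? U F) then flat-term U j F else 0ℤ) ℤ.-
                   (if does (isFlat? M F) then flat-term M j F else 0ℤ)

    both-flat : ∀ {F} → IsFlat U F → IsFlat M F → difference F ≡ flat-term U j F ℤ.- flat-term M j F
    both-flat {F} u m = cong₂ ℤ._-_ (if-yes (isFlat? U F) u) (if-yes (isFlat? M F) m)

    no-flat : ∀ {F} → ¬ IsFlat U F → ¬ IsFlat M F → difference F ≡ 0ℤ
    no-flat {F} u m = cong₂ ℤ._-_ (if-no (isFlat? U F) u) (if-no (isFlat? M F) m)

    none-above : ∀ {F} → (∀ {C} → F ⊆ C → H C ≡ false) → difference F ≡ 0ℤ →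
      difference F ≡ countAbove H F ℤ.* contribution d j ∣ F ∣
    none-above {F} none eq = trans eq (sym (cong (ℤ._* contribution d j ∣ F ∣)
        (countAbove-zero H F none)))

    one-above : ∀ {F C} → F ⊆ C → H C ≡ true → (∀ {C′} → F ⊆ C′ → H C′ ≡ true → C′ ≡ C) →
      difference F ≡ contribution d j ∣ F ∣ →
      difference F ≡ countAbove H F ℤ.* contribution d j ∣ F ∣
    one-above {F} F⊆C h unique eq = trans eq (trans (sym (ℤ.*-identityˡ _))
      (sym (cong (ℤ._* contribution d j ∣ F ∣) (countAbove-one H F⊆C h unique))))

    ⊆U : ∀ {F} → F ⊆ ground M → F ⊆ ground U
    ⊆U = subst (_ ⊆_) (sym U≡M)

    -- The contraction by the empty set still has rank `d`, out of reach of the induction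
    -- hypothesis; but d < 2j puts tʲ beyond the degree bound, and `relaxation d j` vanishes for the
    -- same reason.
    empty-difference : ∀ {F} → F ⊆ ground M → ∣ F ∣ ≡ 0 →
      difference F ≡ countAbove H F ℤ.* contribution d j ∣ F ∣
    empty-difference {F} F⊆ ∣F∣≡0 = begin
      _ ≡⟨ both-flat (small-flat T (⊆U F⊆) 1+∣F∣<d) (small-flat S F⊆ 1+∣F∣<d) ⟩
      _ ≡⟨ cong₂ ℤ._-_ (vanish T (⊆U F⊆)) (vanish S F⊆) ⟩
      0ℤ ≡⟨ sym (ℤ.*-zeroʳ (countAbove H F)) ⟩
      _ ≡⟨ cong (countAbove H F ℤ.*_) (sym contribution≡0) ⟩
      _ ∎
      where
      1+∣F∣<d : suc ∣ F ∣ ℕ.< d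
      1+∣F∣<d = subst (λ k → suc k ℕ.< d) (sym ∣F∣≡0) 2≤d
      ∣F∣<d : ∣ F ∣ ℕ.< d
      ∣F∣<d = ℕ.<-trans (ℕ.n<1+n _) 1+∣F∣<d
      vanish : ∀ {N : Matroid n} {K} → Sparse N d K → F ⊆ ground N → flat-term N j F ≡ 0ℤ
      vanish {N} R F⊆ = begin
        _ ≡⟨ free-term R j F⊆ ∣F∣<d ⟩
        _ ≡⟨ cong (λ k → ([t-1]^ k · coeff (P (contraction N F))) j) ∣F∣≡0 ⟩
        _ ≡⟨ KL-degree P KL (contraction N F)
               (ℕ.≤-trans (ℕ.≤-trans (rank-contraction N F) (ℕ.m∸n≤m (rank N) (rk N F)))
                 (ℕ.≤-trans (ℕ.≤-reflexive (sparse-rank R)) (ℕ.<⇒≤ d<2j)))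
                     (ℕ.<-trans (ℕ.n<1+n 0) 1<j) ⟩
        0ℤ ∎
      contribution≡0 : contribution d j ∣ F ∣ ≡ 0ℤ
      contribution≡0 = begin
        _ ≡⟨ contribution-< ∣F∣<d ⟩
        _ ≡⟨ cong (λ k → ([t-1]^ k · relaxation (d ∸ k)) j) ∣F∣≡0 ⟩
        _ ≡⟨ relaxation-≥ (ℕ.<⇒≤ d<2j) ⟩
        0ℤ ∎

    small-difference : ∀ {F} → F ⊆ ground M → suc ∣ F ∣ ℕ.< d → ∣ F ∣ ≢ 0 →
      difference F ≡ countAbove H F ℤ.* contribution d j ∣ F ∣
    small-difference {F} F⊆ 1+∣F∣<d ∣F∣≢0 = begin
      _ ≡⟨ both-flat (small-flat T (⊆U F⊆) 1+∣F∣<d) (small-flat S F⊆ 1+∣F∣<d) ⟩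
      _ ≡⟨ cong₂ ℤ._-_ (free-term T j (⊆U F⊆) ∣F∣<d) (free-term S j F⊆ ∣F∣<d) ⟩
      _ ≡⟨ [t-1]^-difference ∣ F ∣ (coeff (P (contraction U F))) (coeff (P (contraction M F)))
             (relaxation (d ∸ ∣ F ∣)) (countAbove H F) contractions j ⟩
      _ ≡⟨ cong (countAbove H F ℤ.*_) (sym (contribution-< ∣F∣<d)) ⟩
      _ ∎
      where
      ∣F∣<d : ∣ F ∣ ℕ.< d
      ∣F∣<d = ℕ.<-trans (ℕ.n<1+n _) 1+∣F∣<d
      -- `contract (λ _ → false) F` is a conjunction with `false` that does not compute to `false`,
      -- so the fields are transferred one by one.
      uniform-contraction : Sparse (contraction U F) (d ∸ ∣ F ∣) (λ _ → false)
      uniform-contraction = record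
        { indep⇒ = λ i → proj₁ (Sparse.indep⇒ R i) , refl
        ; indep⇐ = λ {I} I⊆ ∣I∣≤ _ → Sparse.indep⇐ R I⊆ ∣I∣≤ (Bool.∧-zeroʳ (does (I ⊆? ∁ F)))
        ; H⇒ = λ ()
        ; separated = λ ()
        ; spans = Sparse.spans R
        }
        where
        R : Sparse (contraction U F) (d ∸ ∣ F ∣) (contract (λ _ → false) F)
        R = sparse-contraction T (⊆U F⊆) ∣F∣<d
      contractions : ∀ i → coeff (P (contraction U F)) i ℤ.- coeff (P (contraction M F)) i ≡
                           countAbove H F ℤ.* relaxation (d ∸ ∣ F ∣) i
      contractions i = trans
        -- The rank drops to d - |F| because `F` is non-empty, and stays at least 2 because |F| + 1
        -- < d.
        (ih (ℕ.∸-monoʳ-< {d} (ℕ.n≢0⇒n>0 ∣F∣≢0) (ℕ.<⇒≤ ∣F∣<d))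
            (ℕ.m+n≤o⇒m≤o∸n 2 1+∣F∣<d) (cong (_─ F) U≡M)
            (sparse-contraction S F⊆ ∣F∣<d) uniform-contraction i)
        (cong (ℤ._* relaxation (d ∸ ∣ F ∣) i) (count-contract H F))

    hyperplane-difference : ∀ {F} → F ⊆ ground M → suc ∣ F ∣ ≡ d →
      difference F ≡ countAbove H F ℤ.* contribution d j ∣ F ∣
    hyperplane-difference {F} F⊆ 1+∣F∣≡d = by-cases
        (anySubset? (λ C → (F ⊆? C) ×-dec (H C Bool.≟ true)))
      where
      ∣F∣<d : ∣ F ∣ ℕ.< d
      ∣F∣<d = ℕ.≤-reflexive 1+∣F∣≡d
      u : IsFlat U F
      u = hyperplane-flat T (⊆U F⊆) 1+∣F∣≡d λ _ → refl
      by-cases : Dec (∃ λ C → F ⊆ C × H C ≡ true) →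
        difference F ≡ countAbove H F ℤ.* contribution d j ∣ F ∣
      by-cases (no none) = none-above none-above-F (begin
        _ ≡⟨ both-flat u m ⟩
        _ ≡⟨ cong₂ ℤ._-_ (hyperplane-term T j u 1+∣F∣≡d) (hyperplane-term S j m 1+∣F∣≡d) ⟩
        _ ≡⟨ ℤ.+-inverseʳ (([t-1]^ ∣ F ∣ · one) j) ⟩
        0ℤ ∎)
        where
        none-above-F : ∀ {C} → F ⊆ C → H C ≡ false
        none-above-F {C} F⊆C = ¬true⇒false λ h → none (C , F⊆C , h)
        m : IsFlat M F
        m = hyperplane-flat S F⊆ 1+∣F∣≡d none-above-F
      by-cases (yes (C , F⊆C , h)) = one-above F⊆C h unique (begin
        _ ≡⟨ cong₂ ℤ._-_ (if-yes (isFlat? U F) u)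
            (if-no (isFlat? M F) (below-H-not-flat S 1+∣F∣≡d F⊆C h)) ⟩
        _ ≡⟨ ℤ.+-identityʳ _ ⟩
        _ ≡⟨ hyperplane-term T j u 1+∣F∣≡d ⟩
        _ ≡⟨ [t-1]^-cong ∣ F ∣ (λ i → trans (sym (relaxation-1 i))
               (cong (λ k → relaxation k i) (trans (sym (ℕ.m+n∸n≡m 1 ∣ F ∣))
                   (cong (_∸ ∣ F ∣) 1+∣F∣≡d)))) j ⟩
        _ ≡⟨ sym (contribution-< ∣F∣<d) ⟩
        _ ∎)
        where
        adjoin : ∀ {C} → F ⊆ C → H C ≡ true → ∃ λ x → C ≡ F ∪ ⁅ x ⁆
        adjoin {C} F⊆C h with ∣p∣<∣q∣⇒∃x∈q─p F C
            (ℕ.<-≤-trans ∣F∣<d (ℕ.≤-reflexive (sym (proj₂ (H⇒ h)))))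
        ... | x , x∈C , x∉F = x , sym (⊆∧∣q∣≤∣p∣⇒≡ (∪-least F⊆C (⁅⁆⊆ x∈C))
          (ℕ.≤-reflexive (trans (proj₂ (H⇒ h)) (trans (sym 1+∣F∣≡d) (sym (∣p∪⁅x⁆∣ F x∉F))))))
        unique : ∀ {C′} → F ⊆ C′ → H C′ ≡ true → C′ ≡ C
        unique F⊆C′ h′ with adjoin F⊆C h | adjoin F⊆C′ h′
        ... | x , refl | y , refl = H-adjacent S h′ h

    ground-difference : difference (ground M) ≡ 0ℤ
    ground-difference = begin
      _ ≡⟨ both-flat (subst (IsFlat U) U≡M (flat-ground U)) (flat-ground M) ⟩
      _ ≡⟨ cong₂ ℤ._-_ (subst (λ E → flat-term U j E ≡ binomialSum ∣ E ∣ f) U≡M (ground-term T 1<j))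
                         (ground-term S 1<j) ⟩
      _ ≡⟨ ℤ.+-inverseʳ (binomialSum ∣ ground M ∣ f) ⟩
      0ℤ ∎
      where
      f : ℕ → ℕ → ℤ
      f k _ = [-1]^ k ℤ.* (t^ (d ∸ k) · one) j

    large-difference : ∀ {F} → d ℕ.≤ ∣ F ∣ → Dec (F ≡ ground M) →
      difference F ≡ countAbove H F ℤ.* contribution d j ∣ F ∣
    large-difference {F} d≤∣F∣ F≟E = by-cases F≟E (H F Bool.≟ true)
      where
      equal : ∀ {C} → F ⊆ C → H C ≡ true → C ≡ F
      equal F⊆C h = sym (⊆∧∣q∣≤∣p∣⇒≡ F⊆C (ℕ.≤-trans (ℕ.≤-reflexive (proj₂ (H⇒ h))) d≤∣F∣))
      none : H F ≡ false → ∀ {C} → F ⊆ C → H C ≡ false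
      none ¬h F⊆C = ¬true⇒false λ h → Bool.not-¬ ¬h (subst (λ D → H D ≡ true) (equal F⊆C h) h)
      not-flat : F ≢ ground M → ¬ IsFlat U F
      not-flat F≢E u with () ← large-flat T u (λ F≡U → F≢E (trans F≡U U≡M)) d≤∣F∣
      by-cases : Dec (F ≡ ground M) → Dec (H F ≡ true) →
        difference F ≡ countAbove H F ℤ.* contribution d j ∣ F ∣
      by-cases (yes refl) _ = none-above (none (¬H-ground S)) ground-difference
      by-cases (no F≢E) (no ¬h) = none-above (none (¬true⇒false ¬h))
        (no-flat (not-flat F≢E) λ m → ¬h (large-flat S m F≢E d≤∣F∣))
      by-cases (no F≢E) (yes h) = one-above id h equal (begin
        _ ≡⟨ cong₂ ℤ._-_ (if-no (isFlat? U F) (not-flat F≢E))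
            (trans (if-yes (isFlat? M F) (H-flat S h)) (circuit-term S 1<j h)) ⟩
        _ ≡⟨ ℤ.+-identityˡ (ℤ.- ([t-1]^ d · one) (suc j)) ⟩
        _ ≡⟨ sym (contribution-≥ d≤∣F∣) ⟩
        _ ∎)

    flat-difference : ∀ F → difference F ≡ countAbove H F ℤ.* contribution d j ∣ F ∣
    flat-difference F = by-cases (F ⊆? ground M) (ℕ.<-cmp (suc ∣ F ∣) d) (∣ F ∣ ℕ.≟ 0)
      where
      by-cases : Dec (F ⊆ ground M) → Tri (suc ∣ F ∣ ℕ.< d) (suc ∣ F ∣ ≡ d) (d ℕ.< suc ∣ F ∣) →
        Dec (∣ F ∣ ≡ 0) → difference F ≡ countAbove H F ℤ.* contribution d j ∣ F ∣
      by-cases (no F⊈) _ _ = none-above (λ F⊆C → ¬true⇒false λ h → F⊈ (proj₁ (H⇒ h) ∘ F⊆C))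
        (no-flat (λ u → F⊈ (subst (F ⊆_) U≡M (proj₁ u))) (λ m → F⊈ (proj₁ m)))
      by-cases (yes F⊆) (tri< lt _ _) (yes ∣F∣≡0) = empty-difference F⊆ ∣F∣≡0
      by-cases (yes F⊆) (tri< lt _ _) (no ∣F∣≢0)  = small-difference F⊆ lt ∣F∣≢0
      by-cases (yes F⊆) (tri≈ _ eq _) _           = hyperplane-difference F⊆ eq
      by-cases (yes F⊆) (tri> _ _ gt) _           = large-difference (ℕ.s≤s⁻¹ gt) (F ≟ˢ ground M)

    coefficient-difference : coeff (P U) i ℤ.- coeff (P M) i ≡ count H ℤ.* relaxation d i
    coefficient-difference = begin
      _ ≡⟨ cong₂ ℤ._-_ (expand T) (expand S) ⟩
      _ ≡⟨ sym (sum-− (subsets n) (λ F → if does (isFlat? U F) then flat-term U j F else 0ℤ)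
                 (λ F → if does (isFlat? M F) then flat-term M j F else 0ℤ)) ⟩
      _ ≡⟨ sum-cong (subsets n) flat-difference ⟩
      _ ≡⟨ sum-countAbove H (proj₂ ∘ H⇒) (contribution d j) ⟩
      _ ≡⟨ cong (count H ℤ.*_) (contribution-sum j+i≡d 1+i<d) ⟩
      _ ∎
      where
      expand : ∀ {N : Matroid n} {K} → Sparse N d K →
        coeff (P N) i ≡ sum (subsets n) (λ F → if does (isFlat? N F) then flat-term N j F else 0ℤ)
      expand {N} R = trans
        (cong (coeff (P N)) (sym (trans (cong (_∸ j) (trans (sparse-rank R) (sym j+i≡d)))
            (ℕ.m+n∸m≡n j i))))
        (KL-recursion P KL N (ℕ.≤-trans (ℕ.m≤m+n j i)
            (ℕ.≤-reflexive (trans j+i≡d (sym (sparse-rank R))))))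

  relaxes : ∀ d → 2 ℕ.≤ d → Relaxes d
  relaxes = <-rec (λ d → 2 ℕ.≤ d → Relaxes d) step
    where
    step : ∀ d → (∀ {d′} → d′ ℕ.< d → 2 ℕ.≤ d′ → Relaxes d′) → 2 ℕ.≤ d → Relaxes d
    step d ih 2≤d {M = M} {U} {H} U≡M S T i = by-cases (ℕ.<-≤-connex (2 * i) d)
      where
      by-cases : _ → coeff (P U) i ℤ.- coeff (P M) i ≡ count H ℤ.* relaxation d i
      by-cases (inj₁ 2i<d) = Step.coefficient-difference ih 2≤d U≡M S T
        (ℕ.m∸n+n≡m (ℕ.≤-trans (ℕ.m≤n*m i 2) (ℕ.<⇒≤ 2i<d))) 2i<d
      by-cases (inj₂ d≤2i) = trans
        (cong₂ ℤ._-_ (vanish T) (vanish S))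
        (sym (trans (cong (count H ℤ.*_) (relaxation-≥ d≤2i)) (ℤ.*-zeroʳ (count H))))
        where
        vanish : ∀ {N : Matroid _} {K} → Sparse N d K → coeff (P N) i ≡ 0ℤ
        vanish {N} R = KL-degree P KL N (ℕ.≤-trans (ℕ.≤-reflexive (sparse-rank R)) d≤2i)
          (ℕ.*-cancelˡ-< 2 0 i (ℕ.<-≤-trans (ℕ.<-≤-trans (s≤s z≤n) 2≤d) d≤2i))

-- From the stated notions to `Sparse`, and the low ranks

⊈⇒∃∈∉ : ∀ {p q : Subset n} → ¬ p ⊆ q → ∃ λ x → x ∈ p × x ∉ q
⊈⇒∃∈∉ {p = p} {q} p⊈q with ⊈⇒∃ (p∩q⊆p p q) (λ eq → p⊈q λ x∈p → p∩q⊆q p q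
    (subst (_ ∈_) (sym eq) x∈p))
... | x , x∈p , x∉p∩q = x , x∈p , λ x∈q → x∉p∩q (x∈p∩q⁺ (x∈p , x∈q))

module _ {m d : ℕ} {M : Matroid (m + d)} (S : IsSparsePaving m d M) where

  open IsSparsePaving S renaming (separated to 𝒞ℋ-separated)
  open IsBasisOf

  𝒞ℋ? : Decidable (𝒞ℋ {m} {d} M)
  𝒞ℋ? C = (∣ C ∣ ℕ.≟ d) ×-dec ¬? (isBasisOf? M (ground M) C)

  isCircuitHyperplane : Subset (m + d) → Bool
  isCircuitHyperplane C = does (𝒞ℋ? C)

  𝒞ℋ⁻ : ∀ C → isCircuitHyperplane C ≡ true → 𝒞ℋ {m} {d} M C
  𝒞ℋ⁻ C = does-true⁻ (𝒞ℋ? C)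

  sparsePaving⇒sparse : Sparse M d isCircuitHyperplane
  sparsePaving⇒sparse = record
    { indep⇒    = λ {I} i → size≤d i , ¬true⇒false λ h →
        proj₂ (𝒞ℋ⁻ I h) (stuck⇒basis M (support M i) i λ e _ e∉I i′ →
          ℕ.<⇒≱ (ℕ.≤-reflexive (sym (trans (∣p∪⁅x⁆∣ I e∉I) (cong suc (proj₁ (𝒞ℋ⁻ I h))))))
              (size≤d i′))
    ; indep⇐    = indep⇐′
    ; H⇒        = λ {C} h → subst (C ⊆_) (sym ground≡⊤) (⊆-max C) , proj₁ (𝒞ℋ⁻ C h)
    ; separated = λ {C} {C′} h h′ → 𝒞ℋ-separated C C′ (𝒞ℋ⁻ C h) (𝒞ℋ⁻ C′ h′)
    ; spans     = B , indep b , ∣B∣≡d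
    }
    where
    B : Subset (m + d)
    B = proj₁ (basis-exists M (ground M))
    b : IsBasis M B
    b = proj₂ (basis-exists M (ground M))
    ∣B∣≡d : ∣ B ∣ ≡ d
    ∣B∣≡d = trans (sym (rk-basis M b)) rank≡d
    size≤d : ∀ {I} → Indep M I → ∣ I ∣ ℕ.≤ d
    size≤d i = subst (_ ℕ.≤_) rank≡d (≤-rk M i (support M i))
    full : ∀ {C} → ∣ C ∣ ≡ d → ¬ 𝒞ℋ {m} {d} M C → Indep M C
    full {C} ∣C∣≡d ¬h with isBasisOf? M (ground M) C
    ... | yes c = indep c
    ... | no ¬c = contradiction (∣C∣≡d , ¬c) ¬h
    ∃B─ : ∀ I → ∣ I ∣ ℕ.< d → ∃ λ e → e ∈ B × e ∉ I
    ∃B─ I ∣I∣<d = ∣p∣<∣q∣⇒∃x∈q─p I B (ℕ.<-≤-trans ∣I∣<d (ℕ.≤-reflexive (sym ∣B∣≡d)))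
    -- Elements of the basis `B` are added up to size `d`. If the last set `I ∪ ⁅ e ⁆` is a
    -- circuit-hyperplane, it differs from `B`, so some x in `B` lies outside it. Then `I ∪ ⁅ x ⁆`
    -- is too close to be another circuit-hyperplane, and is independent.
    small : ∀ k {I} → suc k + ∣ I ∣ ≡ d → Indep M I
    small k {I} eq with ∃B─ I (ℕ.≤-trans (s≤s (ℕ.m≤n+m ∣ I ∣ k)) (ℕ.≤-reflexive eq))
    small (suc k) {I} eq | e , _ , e∉I = down M (⊆∪ˡ I ⁅ e ⁆)
      (small k (trans (cong (λ s → suc k + s) (∣p∪⁅x⁆∣ I e∉I)) (trans (ℕ.+-suc (suc k) ∣ I ∣) eq)))
    small zero {I} eq | e , _ , e∉I with 𝒞ℋ? (I ∪ ⁅ e ⁆)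
    ... | no ¬h = down M (⊆∪ˡ I ⁅ e ⁆) (full (trans (∣p∪⁅x⁆∣ I e∉I) eq) ¬h)
    ... | yes h with ⊈⇒∃∈∉ {p = B} {q = I ∪ ⁅ e ⁆} (λ B⊆ →
              proj₂ h (subst (IsBasis M) (⊆∧∣q∣≤∣p∣⇒≡ B⊆
                  (ℕ.≤-reflexive (trans (proj₁ h) (sym ∣B∣≡d)))) b))
    ...   | x , _ , x∉Ie = down M (⊆∪ˡ I ⁅ x ⁆)
        (full (trans (∣p∪⁅x⁆∣ I (x∉Ie ∘ ⊆∪ˡ I ⁅ e ⁆)) eq) λ h′ →
      ℕ.<⇒≱ (s≤s (s≤s (s≤s z≤n))) (ℕ.≤-trans
        (𝒞ℋ-separated _ _ h h′ λ eq′ → x∉Ie (subst (x ∈_) (sym eq′) (x∈p∪⁅x⁆ I x)))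
        (∣[A∪x]△[A∪y]∣≤2 I e x)))
    indep⇐′ : ∀ {I} → I ⊆ ground M → ∣ I ∣ ℕ.≤ d → isCircuitHyperplane I ≡ false → Indep M I
    indep⇐′ {I} _ ∣I∣≤d ¬h with ℕ.m≤n⇒∃[o]m+o≡n ∣I∣≤d
    ... | zero  , eq = full (trans (sym (ℕ.+-identityʳ ∣ I ∣)) eq) λ h →
      Bool.not-¬ ¬h (dec-true (𝒞ℋ? I) h)
    ... | suc k , eq = small k (trans (ℕ.+-comm (suc k) ∣ I ∣) eq)

uniform-sparse : ∀ m d → Sparse (uniform m d) d (λ _ → false)
uniform-sparse m d = record
  { indep⇒    = λ ∣I∣≤d → ∣I∣≤d , refl
  ; indep⇐    = λ _ ∣I∣≤d _ → ∣I∣≤d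
  ; H⇒        = λ ()
  ; separated = λ ()
  ; spans     = spans′
  }
  where
  spans′ : ∃ λ B → ∣ B ∣ ℕ.≤ d × ∣ B ∣ ≡ d
  spans′ with basis-exists (uniform m d) ⊤
  ... | B , b = B , indep , ℕ.≤-antisym indep (ℕ.≮⇒≥ λ ∣B∣<d →
    let e , e∈⊤ , e∉B = ∣p∣<∣q∣⇒∃x∈q─p B ⊤ (ℕ.<-≤-trans ∣B∣<d
          (ℕ.≤-trans (ℕ.m≤n+m d m) (ℕ.≤-reflexive (sym (∣⊤∣≡n (m + d))))))
    in basis⇒stuck (uniform m d) b e e∈⊤ e∉B (ℕ.≤-trans (ℕ.≤-reflexive (∣p∪⁅x⁆∣ B e∉B)) ∣B∣<d))
    where open IsBasisOf b

-- In rank one a circuit-hyperplane is a single loop, and separation allows at most one. So the flat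
-- of loops is that circuit-hyperplane if there is one and empty otherwise.
rank-one-sparse : (P : ∀ {n} → Matroid n → Poly) → IsKazhdanLusztig P →
  ∀ {M : Matroid n} {H} → Sparse M 1 H → ∀ i → coeff (P M) i ≡ one i
rank-one-sparse {n} P KL {M} {H} S with anySubset? (λ C → H C Bool.≟ true)
... | yes (C , h) = KL-rank-one P KL M (sparse-rank S) (H-flat S h) (ℕ.suc-injective (H-rk S h))
... | no none = KL-rank-one P KL M (sparse-rank S)
  (hyperplane-flat S (⊆-min (ground M)) (cong suc (∣⊥∣≡0 n)) λ {C} _ → ¬true⇒false λ h → none
      (C , h)) (rk-⊥ M)

mainTheorem2 : (P : ∀ {n} → Matroid n → Poly) → IsKazhdanLusztig P →
    (m d : ℕ) (S : Matroid (m + d)) → IsSparsePaving m d S →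
    (i : ℕ) → coeff (P S) i ≤ coeff (P (uniform m d)) i
mainTheorem2 P KL m zero S sp i = ℤ.≤-reflexive (trans
  (rank-zero S (sparse-rank (sparsePaving⇒sparse sp)) i)
  (sym (rank-zero (uniform m 0) (sparse-rank (uniform-sparse m 0)) i)))
  where open IsKazhdanLusztig KL
-- In rank one both polynomials are 1 although `relaxation 1` is not 0, so the identity `Relaxes 1`
-- fails as soon as there is a circuit-hyperplane.
mainTheorem2 P KL m (suc zero) S sp i = ℤ.≤-reflexive (trans
  (rank-one-sparse P KL (sparsePaving⇒sparse sp) i)
  (sym (rank-one-sparse P KL (uniform-sparse m 1) i)))
mainTheorem2 P KL m d@(suc (suc _)) S sp i = ℤ.0≤i-j⇒j≤i (subst (0ℤ ≤_)
  (sym (relaxes P KL d (s≤s (s≤s z≤n)) (sym (IsSparsePaving.ground≡⊤ sp)) (sparsePaving⇒sparse sp)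
      (uniform-sparse m d) i))
  (nonneg-* (count-nonneg (isCircuitHyperplane sp)) (relaxation-nonneg {d} i (s≤s (s≤s z≤n)))))
  where
  nonneg-* : ∀ {x y} → 0ℤ ≤ x → 0ℤ ≤ y → 0ℤ ≤ x ℤ.* y
  nonneg-* {x} {y} 0≤x 0≤y = subst (_≤ x ℤ.* y) (ℤ.*-zeroʳ x)
      (ℤ.*-monoˡ-≤-nonNeg x {{ℤ.nonNegative 0≤x}} 0≤y)
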